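{- **[A.] ($H$-orbits)** The set of $H$-orbits on elements of $\mathrm{Hyp}_V\times\mathrm{Hyp}_W$ is in bijection with the set of quintuples $(s,r,d,m,n)\in\mathbb Z^2\times\mathbb Z_{\ge0}^3/\sim$, where the equivalence relation $\sim$ is given by - $(s,r,d,m,n)\sim(s,r,d,0,n)$ for $d\ge0$, $m\le n$; - $(s,r,d,m,n)\sim(s,r,d,m,0)$ for $d\ge0$, $m\ge n+d$. A representative with invariants $(s,r,d,m,n)$ is the pair of lattices determined by the column vectors of the matrices $$\varpi^s\begin{pmatrix}1&0&\varpi^{ -m}\\0&1&\varpi^{ -n}\\0&0&1\end{pmatrix}\qquad\text{and}\qquad\varpi^r\begin{pmatrix}\varpi^d&0\\0&1\end{pmatrix}.$$ **[B.] ($H_0$-orbits)** The $H_0$-orbits contained in a given $H$-orbit corresponding to a quintuple $(s,r,d,m,n)$ are indexed by a parameter $k\in\mathbb Z$. A representative of invariant $(k,s,r,d,m,n)$ is explicitly given by the column vectors of the matrices $$\varpi^s\begin{pmatrix}\varpi^k&0&\varpi^{k-m}\\0&1&\varpi^{ -n}\\0&0&1\end{pmatrix}\qquad\text{and}\qquad\begin{pmatrix}\varpi^{k+d+r}&0\\0&\varpi^{r}\end{pmatrix}.$$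
   Context: $k_0$ is the completion of a totally real number field at a finite place, with ring of integers $\mathcal O$, uniformizer $\varpi$ and normalized valuation $v$. $V$ is a $3$-dimensional $k_0$-vector space, $W\subset V$ a $2$-dimensional subspace, $D\subset V$ a line not contained in $W$. $L_W\subset W$ and $L_D\subset D$ are fixed lattices with $\mathcal O$-bases $\{e_1,e_2\}$ and $\{e_3\}$; column vectors are taken with respect to $e_1,e_2,e_3$ in $V$ and $e_1,e_2$ in $W$. $\mathrm{Hyp}_V$ (resp. $\mathrm{Hyp}_W$) is the set of $\mathcal O$-lattices in $V$ (resp. $W$). $H=\mathrm{GL}(W)\cong\mathrm{GL}_2(k_0)$ acts on $\mathrm{Hyp}_V\times\mathrm{Hyp}_W$ diagonally, acting on $V=W\oplus D$ through $h\mapsto h\oplus\mathrm{id}_D$, and $H_0=\{h\in H:v(\det h)=0\}$.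
   Formalization: The relation ∼ is corrected: (m,n)∼(0,n) for m+d≤n and (m,n)∼(m,0) for m≥n. The printed conditions (m≤n; m≥n+d) fail for the displayed matrices: they identify (0,0,1,1,1) with (0,0,1,0,1), whose representatives lie in different H-orbits. -}

module Defs where

open import Level using (Level; _⊔_; 0ℓ) renaming (suc to lsuc)
open import Algebra.Bundles using (CommutativeMonoid; CommutativeRing; Semiring)
open import Algebra.Module.Bundles using (LeftModule)
open import Algebra.Module.Morphism.Structures
  using (IsLeftModuleMonomorphism; IsLeftModuleIsomorphism)
open import Algebra.Morphism.Structures using (IsRingHomomorphism)
open import Data.Empty using (⊥; ⊥-elim)
open import Data.Fin.Base as Fin using (Fin; zero; suc; punchIn)
open import Data.Fin.Induction using (<-wellFounded)
open import Data.Fin.Properties using (<-cmp; punchInᵢ≢i)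
open import Data.Integer.Base as ℤ using (ℤ; +_; -[1+_])
open import Data.Nat.Base as ℕ using (ℕ)
open import Data.Product.Base using (Σ; Σ-syntax; ∃; ∃-syntax; _×_; _,_; proj₁; proj₂)
open import Data.Rational.Base as ℚ using (ℚ; 0ℚ; 1ℚ)
open import Data.Sum.Base using (_⊎_; inj₁; inj₂)
open import Data.Vec.Base as Vec using (Vec; []; _∷_; lookup)
open import Data.Vec.Functional using (removeAt) renaming ([] to []ᶠ; _∷_ to _∷ᶠ_)
open import Induction.WellFounded using (Acc; acc)
open import Relation.Binary.Definitions using (tri<; tri≈; tri>)
open import Relation.Binary.Construct.Add.Supremum.NonStrict ℤ._≤_ using (_≤⁺_)
open import Relation.Binary.Construct.Closure.Equivalence using (EqClosure)
open import Relation.Binary.PropositionalEquality as ≡ using (_≡_)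
open import Relation.Nullary.Construct.Add.Supremum using (_⁺; [_]; ⊤⁺)
open import Relation.Nullary.Negation.Core using (¬_)
open import Relation.Unary using (Pred; U; _≐_)
import Algebra.Definitions.RawMonoid as RawMonoidDefs
import Algebra.Definitions.RawSemiring as RawSemiringDefs
import Relation.Binary.Reasoning.Setoid as ≈-Reasoning

private
  variable
    c ℓ f ℓf a ℓa w ℓw l ℓl u ℓu p : Level

------------------------------------------------------------------------
-- Fields and number fields

record IsField (R : CommutativeRing c ℓ) : Set (c ⊔ ℓ) where
  open CommutativeRing R
  field
    1≉0     : ¬ (1# ≈ 0#)
    inverse : ∀ x → ¬ (x ≈ 0#) → ∃[ y ] x * y ≈ 1#

  open RawSemiringDefs (Semiring.rawSemiring semiring) using (_^_)
  open ≈-Reasoning setoid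

  inverse≉0 : ∀ x x≉0 → ¬ (proj₁ (inverse x x≉0) ≈ 0#)
  inverse≉0 x x≉0 y≈0 = 1≉0 (begin
    1#                        ≈⟨ proj₂ (inverse x x≉0) ⟨
    x * proj₁ (inverse x x≉0) ≈⟨ *-congˡ y≈0 ⟩
    x * 0#                    ≈⟨ zeroʳ x ⟩
    0# ∎)

  *≉0 : ∀ {x y} → ¬ (x ≈ 0#) → ¬ (y ≈ 0#) → ¬ (x * y ≈ 0#)
  *≉0 {x} {y} x≉0 y≉0 xy≈0 = let y⁻¹ , yy⁻¹ = inverse y y≉0 in x≉0 (begin
    x             ≈⟨ *-identityʳ x ⟨
    x * 1#        ≈⟨ *-congˡ yy⁻¹ ⟨
    x * (y * y⁻¹) ≈⟨ *-assoc x y y⁻¹ ⟨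
    x * y * y⁻¹   ≈⟨ *-congʳ xy≈0 ⟩
    0# * y⁻¹      ≈⟨ zeroˡ y⁻¹ ⟩
    0# ∎)

  ^≉0 : ∀ {x} → ¬ (x ≈ 0#) → ∀ n → ¬ (x ^ n ≈ 0#)
  ^≉0 x≉0 ℕ.zero    = 1≉0
  ^≉0 x≉0 (ℕ.suc n) = *≉0 x≉0 (^≉0 x≉0 n)

record IsNumberField (F : CommutativeRing f ℓf) : Set (f ⊔ ℓf) where
  open CommutativeRing F
  open RawMonoidDefs +-rawMonoid using (sum)
  field
    isField          : IsField F
    fromℚ            : ℚ → Carrier
    fromℚ-isRingHom  : IsRingHomomorphism ℚ.+-*-rawRing rawRing fromℚ
    finiteOverℚ      : ∃[ n ] Σ[ b ∈ (Fin n → Carrier) ]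
                         ∀ x → Σ[ q ∈ (Fin n → ℚ) ] x ≈ sum (λ i → fromℚ (q i) * b i)

Null : (ℕ → ℚ) → Set
Null q = ∀ ε → 0ℚ ℚ.< ε → ∃[ N ] ∀ n → N ℕ.≤ n → ℚ.∣ q n ∣ ℚ.< ε

Cauchy : (ℕ → ℚ) → Set
Cauchy q = ∀ ε → 0ℚ ℚ.< ε →
  ∃[ N ] ∀ n n′ → N ℕ.≤ n → N ℕ.≤ n′ → ℚ.∣ q n ℚ.- q n′ ∣ ℚ.< ε

-- A ring homomorphism F → ℂ.  A complex number is presented by two Cauchy
-- sequences of rationals (its real and imaginary parts), and two
-- presentations are equal when their difference is a null sequence.
record ComplexEmbedding (F : CommutativeRing f ℓf) : Set (f ⊔ ℓf) where
  open CommutativeRing F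
  field
    re im  : Carrier → ℕ → ℚ
    re-cauchy : ∀ x → Cauchy (re x)
    im-cauchy : ∀ x → Cauchy (im x)
    re-cong : ∀ {x y} → x ≈ y → Null (λ n → re x n ℚ.- re y n)
    im-cong : ∀ {x y} → x ≈ y → Null (λ n → im x n ℚ.- im y n)
    re-1 : Null (λ n → re 1# n ℚ.- 1ℚ)
    im-1 : Null (im 1#)
    re-+ : ∀ x y → Null (λ n → re (x + y) n ℚ.- (re x n ℚ.+ re y n))
    im-+ : ∀ x y → Null (λ n → im (x + y) n ℚ.- (im x n ℚ.+ im y n))
    re-* : ∀ x y → Null (λ n →
      re (x * y) n ℚ.- (re x n ℚ.* re y n ℚ.- im x n ℚ.* im y n))
    im-* : ∀ x y → Null (λ n →
      im (x * y) n ℚ.- (re x n ℚ.* im y n ℚ.+ im x n ℚ.* re y n))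

TotallyReal : CommutativeRing f ℓf → Set (f ⊔ ℓf)
TotallyReal F = ∀ (σ : ComplexEmbedding F) x → Null (ComplexEmbedding.im σ x)

------------------------------------------------------------------------
-- Discrete valuations

infixl 6 _+⁺_

_+⁺_ : ℤ ⁺ → ℤ ⁺ → ℤ ⁺
[ a ] +⁺ [ b ] = [ a ℤ.+ b ]
[ a ] +⁺ ⊤⁺    = ⊤⁺
⊤⁺    +⁺ b     = ⊤⁺

-- v 0 = ⊤⁺ (that is, ∞).  Since v is a total function, equality with 0 is
-- decidable, as in the classical theory.
record IsValuation (R : CommutativeRing c ℓ) (v : CommutativeRing.Carrier R → ℤ ⁺)
                   : Set (c ⊔ ℓ) where
  open CommutativeRing R
  field
    v-cong : ∀ {x y} → x ≈ y → v x ≡ v y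
    v-0    : v 0# ≡ ⊤⁺
    v-⊤    : ∀ x → v x ≡ ⊤⁺ → x ≈ 0#
    v-*    : ∀ x y → v (x * y) ≡ v x +⁺ v y
    v-+    : ∀ x y z → z ≤⁺ v x → z ≤⁺ v y → z ≤⁺ v (x + y)

-- The completion k₀ of a totally real number field F at a finite place,
-- i.e. at the nonarchimedean place of F given by v ∘ ι, together with a
-- uniformizer ϖ; v is normalized by v ϖ = 1.
record CompletedField c ℓ f ℓf : Set (lsuc (c ⊔ ℓ ⊔ f ⊔ ℓf)) where
  field
    F             : CommutativeRing f ℓf
    isNumberField : IsNumberField F
    totallyReal   : TotallyReal F

    k₀            : CommutativeRing c ℓ
    isField       : IsField k₀

  open CommutativeRing k₀ public

  field
    v             : Carrier → ℤ ⁺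
    isValuation   : IsValuation k₀ v
    ϖ             : Carrier
    v-ϖ           : v ϖ ≡ [ + 1 ]

    complete      : (x : ℕ → Carrier) →
      (∀ z → ∃[ N ] ∀ n n′ → N ℕ.≤ n → N ℕ.≤ n′ → [ z ] ≤⁺ v (x n - x n′)) →
      ∃[ y ] ∀ z → ∃[ N ] ∀ n → N ℕ.≤ n → [ z ] ≤⁺ v (x n - y)

    ι             : CommutativeRing.Carrier F → Carrier
    ι-isRingHom   : IsRingHomomorphism (CommutativeRing.rawRing F) rawRing ι
    ι-dense       : ∀ x z → ∃[ a ] [ z ] ≤⁺ v (x - ι a)

  open IsField isField public
  open IsValuation isValuation public

  𝒪 : Pred Carrier 0ℓ
  𝒪 x = [ + 0 ] ≤⁺ v x

  ϖ≉0 : ¬ (ϖ ≈ 0#)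
  ϖ≉0 ϖ≈0 with ≡.trans (≡.sym v-ϖ) (≡.trans (v-cong ϖ≈0) v-0)
  ... | ()

  ≈0? : ∀ x → x ≈ 0# ⊎ ¬ (x ≈ 0#)
  ≈0? x with v x in eq
  ... | ⊤⁺    = inj₁ (v-⊤ x eq)
  ... | [ _ ] = inj₂ λ x≈0 → case-⊥ (≡.trans (≡.sym eq) (≡.trans (v-cong x≈0) v-0))
    where
    case-⊥ : ∀ {z : ℤ} → [ z ] ≡ ⊤⁺ → ⊥
    case-⊥ ()

  open RawSemiringDefs (Semiring.rawSemiring semiring) using (_^_)

  infixr 8 ϖ^_

  ϖ^_ : ℤ → Carrier
  ϖ^ (+ n)    = ϖ ^ n
  ϖ^ -[1+ n ] = proj₁ (inverse ϖ ϖ≉0) ^ ℕ.suc n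

  ϖ^≉0 : ∀ z → ¬ (ϖ^ z ≈ 0#)
  ϖ^≉0 (+ n)    = ^≉0 ϖ≉0 n
  ϖ^≉0 -[1+ n ] = ^≉0 (inverse≉0 ϖ ϖ≉0) (ℕ.suc n)

------------------------------------------------------------------------
-- Linear algebra

module LinearAlgebra {R : CommutativeRing c ℓ}
                     (M : LeftModule (CommutativeRing.ring R) a ℓa) where
  open CommutativeRing R using (Carrier; 0#; _≈_)
  open LeftModule M
  open import Algebra.Properties.CommutativeMonoid.Sum +ᴹ-commutativeMonoid
    using (sum; sum-remove)
  open import Algebra.Properties.CommutativeSemigroup
    (CommutativeMonoid.commutativeSemigroup +ᴹ-commutativeMonoid) using (interchange)

  lc : ∀ {n} → (Fin n → Carrier) → (Fin n → Carrierᴹ) → Carrierᴹ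
  lc a b = sum (λ i → a i *ₗ b i)

  Span : ∀ {n} → (Fin n → Carrierᴹ) → Pred Carrierᴹ (c ⊔ ℓa)
  Span b x = ∃[ a ] x ≈ᴹ lc a b

  private module R = CommutativeRing R

  lc-cong : ∀ {n} {a a′ : Fin n → Carrier} b → (∀ i → a i ≈ a′ i) → lc a b ≈ᴹ lc a′ b
  lc-cong {ℕ.zero}  b a≈ = ≈ᴹ-refl
  lc-cong {ℕ.suc n} b a≈ =
    +ᴹ-cong (*ₗ-cong (a≈ zero) ≈ᴹ-refl) (lc-cong (λ i → b (suc i)) (λ i → a≈ (suc i)))

  lc-0 : ∀ {n} (b : Fin n → Carrierᴹ) → lc (λ _ → 0#) b ≈ᴹ 0ᴹ
  lc-0 {ℕ.zero}  b = ≈ᴹ-refl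
  lc-0 {ℕ.suc n} b =
    ≈ᴹ-trans (+ᴹ-cong (*ₗ-zeroˡ _) (lc-0 (λ i → b (suc i)))) (+ᴹ-identityˡ _)

  lc-+ : ∀ {n} a a′ (b : Fin n → Carrierᴹ) →
         lc (λ i → a i R.+ a′ i) b ≈ᴹ lc a b +ᴹ lc a′ b
  lc-+ {ℕ.zero}  a a′ b = ≈ᴹ-sym (+ᴹ-identityˡ _)
  lc-+ {ℕ.suc n} a a′ b = ≈ᴹ-trans
    (+ᴹ-cong (*ₗ-distribʳ _ _ _) (lc-+ (λ i → a (suc i)) (λ i → a′ (suc i)) (λ i → b (suc i))))
    (interchange _ _ _ _)

  lc-* : ∀ {n} r a (b : Fin n → Carrierᴹ) → lc (λ i → r R.* a i) b ≈ᴹ r *ₗ lc a b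
  lc-* {ℕ.zero}  r a b = ≈ᴹ-sym (*ₗ-zeroʳ r)
  lc-* {ℕ.suc n} r a b = ≈ᴹ-trans
    (+ᴹ-cong (*ₗ-assoc _ _ _) (lc-* r (λ i → a (suc i)) (λ i → b (suc i))))
    (≈ᴹ-sym (*ₗ-distribˡ _ _ _))

  record IsSubspace (P : Pred Carrierᴹ p) : Set (c ⊔ a ⊔ ℓa ⊔ p) where
    field
      resp  : ∀ {x y} → x ≈ᴹ y → P x → P y
      zeroᴹ : P 0ᴹ
      add   : ∀ {x y} → P x → P y → P (x +ᴹ y)
      scale : ∀ {x} r → P x → P (r *ₗ x)

    lc-closed : ∀ {n} a (b : Fin n → Carrierᴹ) → (∀ i → P (b i)) → P (lc a b)
    lc-closed {ℕ.zero}  a b pb = zeroᴹ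
    lc-closed {ℕ.suc n} a b pb = add (scale (a zero) (pb zero))
      (lc-closed (λ i → a (suc i)) (λ i → b (suc i)) (λ i → pb (suc i)))

    cancel : ∀ r r⁻¹ → r R.* r⁻¹ ≈ R.1# → ∀ {x y} → P y → P (r *ₗ x +ᴹ y) → P x
    cancel r r⁻¹ rr⁻¹ {x} {y} py pz = resp eq (scale r⁻¹ (add pz (scale (R.- R.1#) py)))
      where
      open ≈-Reasoning ≈ᴹ-setoid
      y-y : y +ᴹ (R.- R.1#) *ₗ y ≈ᴹ 0ᴹ
      y-y = begin
        y +ᴹ (R.- R.1#) *ₗ y            ≈⟨ +ᴹ-cong (≈ᴹ-sym (*ₗ-identityˡ y)) ≈ᴹ-refl ⟩
        R.1# *ₗ y +ᴹ (R.- R.1#) *ₗ y    ≈⟨ ≈ᴹ-sym (*ₗ-distribʳ y _ _) ⟩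
        (R.1# R.+ R.- R.1#) *ₗ y        ≈⟨ *ₗ-cong (R.-‿inverseʳ R.1#) ≈ᴹ-refl ⟩
        0# *ₗ y                         ≈⟨ *ₗ-zeroˡ y ⟩
        0ᴹ ∎
      eq : r⁻¹ *ₗ ((r *ₗ x +ᴹ y) +ᴹ (R.- R.1#) *ₗ y) ≈ᴹ x
      eq = begin
        r⁻¹ *ₗ ((r *ₗ x +ᴹ y) +ᴹ (R.- R.1#) *ₗ y)  ≈⟨ *ₗ-cong R.refl (+ᴹ-assoc _ _ _) ⟩
        r⁻¹ *ₗ (r *ₗ x +ᴹ (y +ᴹ (R.- R.1#) *ₗ y))  ≈⟨ *ₗ-cong R.refl (+ᴹ-cong ≈ᴹ-refl y-y) ⟩
        r⁻¹ *ₗ (r *ₗ x +ᴹ 0ᴹ)                      ≈⟨ *ₗ-cong R.refl (+ᴹ-identityʳ _) ⟩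
        r⁻¹ *ₗ (r *ₗ x)                            ≈⟨ ≈ᴹ-sym (*ₗ-assoc _ _ _) ⟩
        (r⁻¹ R.* r) *ₗ x                           ≈⟨ *ₗ-cong (R.trans (R.*-comm _ _) rr⁻¹) ≈ᴹ-refl ⟩
        R.1# *ₗ x                                  ≈⟨ *ₗ-identityˡ x ⟩
        x ∎

  open IsSubspace

  Span-isSubspace : ∀ {n} (b : Fin n → Carrierᴹ) → IsSubspace (Span b)
  Span-isSubspace b .resp x≈y (a , p) = a , ≈ᴹ-trans (≈ᴹ-sym x≈y) p
  Span-isSubspace b .zeroᴹ = (λ _ → 0#) , ≈ᴹ-sym (lc-0 b)
  Span-isSubspace b .add (a , p) (a′ , p′) =
    _ , ≈ᴹ-trans (+ᴹ-cong p p′) (≈ᴹ-sym (lc-+ a a′ b))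
  Span-isSubspace b .scale r (a , p) =
    _ , ≈ᴹ-trans (*ₗ-cong R.refl p) (≈ᴹ-sym (lc-* r a b))

  gen∈Span : ∀ {n} (b : Fin n → Carrierᴹ) i → Span b (b i)
  gen∈Span b zero = resp S
    (≈ᴹ-trans (+ᴹ-cong (*ₗ-identityˡ _) (lc-0 (λ i → b (suc i)))) (+ᴹ-identityʳ _))
    ((λ { zero → R.1# ; (suc _) → 0# }) , ≈ᴹ-refl)
    where S = Span-isSubspace b
  gen∈Span b (suc i) with gen∈Span (λ i → b (suc i)) i
  ... | a , p = (λ { zero → 0# ; (suc j) → a j })
              , ≈ᴹ-trans p (≈ᴹ-trans (≈ᴹ-sym (+ᴹ-identityˡ _))
                                     (+ᴹ-cong (≈ᴹ-sym (*ₗ-zeroˡ _)) ≈ᴹ-refl))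

  _⊞_ : Pred Carrierᴹ (c ⊔ ℓa) → Pred Carrierᴹ (c ⊔ ℓa) → Pred Carrierᴹ (c ⊔ a ⊔ ℓa)
  (P ⊞ Q) x = ∃[ y ] ∃[ z ] P y × Q z × x ≈ᴹ y +ᴹ z

  ⊞-isSubspace : ∀ {P Q} → IsSubspace P → IsSubspace Q → IsSubspace (P ⊞ Q)
  ⊞-isSubspace P Q .resp x≈ (y , z , py , qz , eq) =
    y , z , py , qz , ≈ᴹ-trans (≈ᴹ-sym x≈) eq
  ⊞-isSubspace P Q .zeroᴹ = _ , _ , P .zeroᴹ , Q .zeroᴹ , ≈ᴹ-sym (+ᴹ-identityˡ _)
  ⊞-isSubspace P Q .add (y , z , py , qz , eq) (y′ , z′ , py′ , qz′ , eq′) =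
    _ , _ , P .add py py′ , Q .add qz qz′ ,
    ≈ᴹ-trans (+ᴹ-cong eq eq′) (interchange _ _ _ _)
  ⊞-isSubspace P Q .scale r (y , z , py , qz , eq) =
    _ , _ , P .scale r py , Q .scale r qz , ≈ᴹ-trans (*ₗ-cong R.refl eq) (*ₗ-distribˡ _ _ _)

  module Exchange (isField : IsField R) (0? : ∀ x → x ≈ 0# ⊎ ¬ (x ≈ 0#)) where

    search : ∀ {n} (a : Fin n → Carrier) → (∀ i → a i ≈ 0#) ⊎ (∃[ i ] ¬ (a i ≈ 0#))
    search {ℕ.zero}  a = inj₁ λ ()
    search {ℕ.suc n} a with 0? (a zero) | search (λ i → a (suc i))
    ... | inj₂ a₀≉0 | _ = inj₂ (zero , a₀≉0)
    ... | inj₁ _ | inj₂ (i , aᵢ≉0) = inj₂ (suc i , aᵢ≉0)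
    ... | inj₁ a₀≈0 | inj₁ a≈0 = inj₁ λ { zero → a₀≈0 ; (suc i) → a≈0 i }

    -- The Steinitz exchange step.
    exchange : ∀ {k n} (h : Fin k → Carrierᴹ) (g : Fin (ℕ.suc n) → Carrierᴹ) x →
               (∀ y → (Span h ⊞ Span g) y) → ¬ Span h x →
               Σ[ g′ ∈ (Fin n → Carrierᴹ) ] ∀ y → (Span (x ∷ᶠ h) ⊞ Span g′) y
    exchange h g x spans x∉h with spans x
    ... | y , z , py , (a , z≈) , x≈ with search a
    ...   | inj₁ a≈0 = ⊥-elim (x∉h (resp (Span-isSubspace h)
              (≈ᴹ-sym (≈ᴹ-trans x≈ (≈ᴹ-trans
                (+ᴹ-cong ≈ᴹ-refl (≈ᴹ-trans z≈ (≈ᴹ-trans (lc-cong g a≈0) (lc-0 g))))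
                (+ᴹ-identityʳ y))))
              py))
    ...   | inj₂ (i , aᵢ≉0) = g′ , all∈T
      where
      g′ = removeAt g i
      T = Span (x ∷ᶠ h) ⊞ Span g′
      Tₛ = ⊞-isSubspace (Span-isSubspace (x ∷ᶠ h)) (Span-isSubspace g′)
      left : ∀ {y} → Span (x ∷ᶠ h) y → T y
      left s = _ , _ , s , Span-isSubspace g′ .zeroᴹ , ≈ᴹ-sym (+ᴹ-identityʳ _)
      right : ∀ {y} → Span g′ y → T y
      right s = _ , _ , Span-isSubspace (x ∷ᶠ h) .zeroᴹ , s , ≈ᴹ-sym (+ᴹ-identityˡ _)
      h⊆ : ∀ {y} → Span h y → T y
      h⊆ (b , eq) = resp Tₛ (≈ᴹ-sym eq)
        (lc-closed Tₛ b h λ j → left (gen∈Span (x ∷ᶠ h) (suc j)))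
      rest : ∀ b → T (lc (removeAt b i) g′)
      rest b = right (removeAt b i , ≈ᴹ-refl)
      split : ∀ b → lc b g ≈ᴹ b i *ₗ g i +ᴹ lc (removeAt b i) g′
      split b = sum-remove {i = i} (λ j → b j *ₗ g j)
      gᵢ∈T : T (g i)
      gᵢ∈T = cancel Tₛ (a i) _ (proj₂ (IsField.inverse isField (a i) aᵢ≉0))
        (add Tₛ (rest a) (h⊆ py))
        (resp Tₛ
          (≈ᴹ-trans x≈ (≈ᴹ-trans (+ᴹ-comm y z)
            (≈ᴹ-trans (+ᴹ-cong (≈ᴹ-trans z≈ (split a)) ≈ᴹ-refl) (+ᴹ-assoc _ _ _))))
          (left (gen∈Span (x ∷ᶠ h) zero)))
      all∈T : ∀ y → T y
      all∈T y with spans y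
      ... | y′ , z′ , py′ , (b , z′≈) , y≈ = resp Tₛ (≈ᴹ-sym y≈)
        (add Tₛ (h⊆ py′)
          (resp Tₛ (≈ᴹ-sym (≈ᴹ-trans z′≈ (split b))) (add Tₛ (scale Tₛ (b i) gᵢ∈T) (rest b))))

    triangular-spans : ∀ {n} (A : Fin (ℕ.suc n) → Fin (ℕ.suc n) → Carrier) →
      (∀ i → ¬ (A i i ≈ 0#)) → (∀ i j → j Fin.< i → A i j ≈ 0#) →
      (g : Fin (ℕ.suc n) → Carrierᴹ) → (∀ x → Span g x) →
      ∀ x → Span (λ j → lc (λ i → A i j) g) x
    triangular-spans {n} A diag lower g spans x =
      let a , x≈ = spans x in resp S (≈ᴹ-sym x≈) (lc-closed S a g (λ i → g∈ i (<-wellFounded i)))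
      where
      S = Span-isSubspace (λ j → lc (λ i → A i j) g)
      P = Span (λ j → lc (λ i → A i j) g)
      vanishing : ∀ {a h} → a ≈ 0# → P (a *ₗ h)
      vanishing a≈0 = resp S
        (≈ᴹ-sym (≈ᴹ-trans (*ₗ-cong a≈0 ≈ᴹ-refl) (*ₗ-zeroˡ _))) (S .zeroᴹ)
      sum-closed : ∀ {k} (h : Fin k → Carrierᴹ) → (∀ j → P (h j)) → P (sum h)
      sum-closed {ℕ.zero}  h h∈ = S .zeroᴹ
      sum-closed {ℕ.suc k} h h∈ = add S (h∈ zero) (sum-closed (λ j → h (suc j)) (λ j → h∈ (suc j)))
      g∈ : ∀ i → Acc Fin._<_ i → P (g i)
      g∈ i (acc rec) = cancel S (A i i) _ (proj₂ (IsField.inverse isField (A i i) (diag i)))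
        (sum-closed _ other)
        (resp S (sum-remove {i = i} (λ j → A j i *ₗ g j))
          (gen∈Span (λ j → lc (λ i → A i j) g) i))
        where
        other : ∀ j → P (A (punchIn i j) i *ₗ g (punchIn i j))
        other j with <-cmp (punchIn i j) i
        ... | tri< j<i _ _ = scale S _ (g∈ (punchIn i j) (rec j<i))
        ... | tri≈ _ j≡i _ = ⊥-elim (punchInᵢ≢i i j j≡i)
        ... | tri> _ _ i<j = vanishing (lower (punchIn i j) i i<j)

  record IsBasis {n} (b : Fin n → Carrierᴹ) : Set (c ⊔ ℓ ⊔ a ⊔ ℓa) where
    field
      spans       : ∀ x → Span b x
      independent : ∀ a → lc a b ≈ᴹ 0ᴹ → ∀ i → a i ≈ 0#

    coord : Carrierᴹ → Fin n → Carrier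
    coord x = proj₁ (spans x)

  record GL : Set (c ⊔ a ⊔ ℓa) where
    field
      to            : Carrierᴹ → Carrierᴹ
      isIsomorphism : IsLeftModuleIsomorphism rawLeftModule rawLeftModule to

Image : {A : Set a} {B : Set w} → (B → B → Set ℓw) → (A → B) →
        Pred A p → Pred B (a ⊔ ℓw ⊔ p)
Image _≈_ g L y = ∃[ x ] L x × g x ≈ y

module Lattices (K : CompletedField c ℓ f ℓf)
                (M : LeftModule (CompletedField.ring K) a ℓa) where
  open CompletedField K using (Carrier; 𝒪)
  open LeftModule M using (Carrierᴹ; _≈ᴹ_)
  open LinearAlgebra {R = CompletedField.k₀ K} M

  𝒪-Span : ∀ {n} → (Fin n → Carrierᴹ) → Pred Carrierᴹ (c ⊔ ℓa)
  𝒪-Span b x = ∃[ a ] (∀ i → 𝒪 (a i)) × x ≈ᴹ lc a b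

  -- An 𝒪-lattice: a finitely generated 𝒪-submodule spanning M over k₀.
  record Hyp : Set (lsuc (c ⊔ ℓa) ⊔ a) where
    field
      _∋_      : Pred Carrierᴹ (c ⊔ ℓa)
      #gens    : ℕ
      gens     : Fin #gens → Carrierᴹ
      gen-by   : _∋_ ≐ 𝒪-Span gens
      spanning : ∀ x → Span gens x

  ⟨_⟩ : ∀ {n} (b : Fin n → Carrierᴹ) → (∀ x → Span b x) → Hyp
  ⟨ b ⟩ sp = record
    { _∋_ = 𝒪-Span b ; gens = b ; gen-by = (λ z → z) , (λ z → z) ; spanning = sp }

-- The 3-dimensional space V, the plane W ⊂ V and the line D ⊂ V not contained
-- in W (subspaces being given by their inclusion maps).  The lattices L_W and
-- L_D are the 𝒪-spans of eW and eD; they enter only through these bases.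
record Configuration (K : CompletedField c ℓ f ℓf) u ℓu w ℓw l ℓl
                     : Set (c ⊔ ℓ ⊔ lsuc (u ⊔ ℓu ⊔ w ⊔ ℓw ⊔ l ⊔ ℓl)) where
  open CompletedField K using (k₀; ring)
  field
    V : LeftModule ring u ℓu
    W : LeftModule ring w ℓw
    D : LeftModule ring l ℓl
  module V = LeftModule V
  module W = LeftModule W
  module D = LeftModule D
  module VL = LinearAlgebra {R = k₀} V
  module WL = LinearAlgebra {R = k₀} W
  module DL = LinearAlgebra {R = k₀} D
  field
    inW       : W.Carrierᴹ → V.Carrierᴹ
    inW-mono  : IsLeftModuleMonomorphism W.rawLeftModule V.rawLeftModule inW
    inD       : D.Carrierᴹ → V.Carrierᴹ
    inD-mono  : IsLeftModuleMonomorphism D.rawLeftModule V.rawLeftModule inD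
    D⊄W       : ¬ (∀ y → ∃[ x ] inD y V.≈ᴹ inW x)
    dimV≡3    : ∃ (VL.IsBasis {3})
    eW        : Fin 2 → W.Carrierᴹ
    eW-basis  : WL.IsBasis eW
    eD        : Fin 1 → D.Carrierᴹ
    eD-basis  : DL.IsBasis eD

  frame : Fin 3 → V.Carrierᴹ
  frame zero             = inW (eW zero)
  frame (suc zero)       = inW (eW (suc zero))
  frame (suc (suc zero)) = inD (eD zero)

  private
    module K = CompletedField K
    module inW = IsLeftModuleMonomorphism inW-mono
    module inD = IsLeftModuleMonomorphism inD-mono
    module eW = WL.IsBasis eW-basis
    module eD = DL.IsBasis eD-basis
    open VL.Exchange K.isField K.≈0? using (exchange)
    open VL.IsSubspace
    open VL using (Span; lc; _⊞_; Span-isSubspace; gen∈Span)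

    e₁ e₂ : W.Carrierᴹ
    e₁ = eW zero
    e₂ = eW (suc zero)

    u₁ u₂ u₃ : V.Carrierᴹ
    u₁ = frame zero
    u₂ = frame (suc zero)
    u₃ = frame (suc (suc zero))

    inW-lc : ∀ {n} a (b : Fin n → W.Carrierᴹ) →
             inW (WL.lc a b) V.≈ᴹ lc a (λ i → inW (b i))
    inW-lc {ℕ.zero}  a b = inW.0ᴹ-homo
    inW-lc {ℕ.suc n} a b = V.≈ᴹ-trans (inW.+ᴹ-homo _ _)
      (V.+ᴹ-cong (inW.*ₗ-homo _ _) (inW-lc (λ i → a (suc i)) (λ i → b (suc i))))

    u₁∉ : ¬ Span []ᶠ u₁
    u₁∉ (_ , u₁≈0) = K.1≉0 (eW.independent 1,0 lc≈0 zero)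
      where
      1,0 : Fin 2 → K.Carrier
      1,0 zero    = K.1#
      1,0 (suc _) = K.0#
      lc≈0 : WL.lc 1,0 eW W.≈ᴹ W.0ᴹ
      lc≈0 = begin
        K.1# W.*ₗ e₁ W.+ᴹ (K.0# W.*ₗ e₂ W.+ᴹ W.0ᴹ)
          ≈⟨ W.+ᴹ-cong (W.*ₗ-identityˡ _) (W.+ᴹ-identityʳ _) ⟩
        e₁ W.+ᴹ K.0# W.*ₗ e₂
          ≈⟨ W.+ᴹ-cong (inW.injective (V.≈ᴹ-trans u₁≈0 (V.≈ᴹ-sym inW.0ᴹ-homo))) (W.*ₗ-zeroˡ _) ⟩
        W.0ᴹ W.+ᴹ W.0ᴹ
          ≈⟨ W.+ᴹ-identityˡ _ ⟩
        W.0ᴹ ∎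
        where open ≈-Reasoning W.≈ᴹ-setoid

    u₂∉ : ¬ Span (u₁ ∷ᶠ []ᶠ) u₂
    u₂∉ (a , u₂≈) = K.1≉0 (eW.independent -a,1 lc≈0 (suc zero))
      where
      a₀ = a zero
      -a,1 : Fin 2 → K.Carrier
      -a,1 zero    = K.- a₀
      -a,1 (suc _) = K.1#
      e₂≈ : e₂ W.≈ᴹ a₀ W.*ₗ e₁
      e₂≈ = inW.injective (V.≈ᴹ-trans u₂≈
        (V.≈ᴹ-trans (V.+ᴹ-identityʳ _) (V.≈ᴹ-sym (inW.*ₗ-homo a₀ e₁))))
      lc≈0 : WL.lc -a,1 eW W.≈ᴹ W.0ᴹ
      lc≈0 = begin
        (K.- a₀) W.*ₗ e₁ W.+ᴹ (K.1# W.*ₗ e₂ W.+ᴹ W.0ᴹ)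
          ≈⟨ W.+ᴹ-cong W.≈ᴹ-refl (W.+ᴹ-identityʳ _) ⟩
        (K.- a₀) W.*ₗ e₁ W.+ᴹ K.1# W.*ₗ e₂
          ≈⟨ W.+ᴹ-cong W.≈ᴹ-refl (W.≈ᴹ-trans (W.*ₗ-identityˡ _) e₂≈) ⟩
        (K.- a₀) W.*ₗ e₁ W.+ᴹ a₀ W.*ₗ e₁
          ≈⟨ W.*ₗ-distribʳ _ _ _ ⟨
        (K.- a₀ K.+ a₀) W.*ₗ e₁
          ≈⟨ W.*ₗ-cong (K.-‿inverseˡ a₀) W.≈ᴹ-refl ⟩
        K.0# W.*ₗ e₁
          ≈⟨ W.*ₗ-zeroˡ _ ⟩
        W.0ᴹ ∎
        where open ≈-Reasoning W.≈ᴹ-setoid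

    u₃∉ : ¬ Span (u₂ ∷ᶠ u₁ ∷ᶠ []ᶠ) u₃
    u₃∉ (a , u₃≈) = D⊄W λ y → let t , y≈ = eD.spans y ; t₀ = t zero in
      t₀ W.*ₗ x , (begin
        inD y                             ≈⟨ inD.⟦⟧-cong y≈ ⟩
        inD (t₀ D.*ₗ eD zero D.+ᴹ D.0ᴹ)   ≈⟨ inD.⟦⟧-cong (D.+ᴹ-identityʳ _) ⟩
        inD (t₀ D.*ₗ eD zero)             ≈⟨ inD.*ₗ-homo _ _ ⟩
        t₀ V.*ₗ u₃                        ≈⟨ V.*ₗ-cong K.refl u₃≈inW ⟩
        t₀ V.*ₗ inW x                     ≈⟨ inW.*ₗ-homo _ _ ⟨
        inW (t₀ W.*ₗ x) ∎)
      where
      open ≈-Reasoning V.≈ᴹ-setoid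
      x = WL.lc a (e₂ ∷ᶠ e₁ ∷ᶠ []ᶠ)
      u₃≈inW : u₃ V.≈ᴹ inW x
      u₃≈inW = V.≈ᴹ-trans u₃≈ (V.≈ᴹ-sym (inW-lc a (e₂ ∷ᶠ e₁ ∷ᶠ []ᶠ)))

  abstract
    frame-spans : ∀ x → VL.Span frame x
    frame-spans x =
      let b , b-basis = dimV≡3
          g₁ , s₁ = exchange []ᶠ b u₁ (λ y → _ , _ , ((λ ()) , V.≈ᴹ-refl)
                      , VL.IsBasis.spans b-basis y , V.≈ᴹ-sym (V.+ᴹ-identityˡ y)) u₁∉
          g₂ , s₂ = exchange (u₁ ∷ᶠ []ᶠ) g₁ u₂ s₁ u₂∉
          g₃ , s₃ = exchange (u₂ ∷ᶠ u₁ ∷ᶠ []ᶠ) g₂ u₃ s₂ u₃∉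
          y , z , (a , y≈) , (_ , z≈) , x≈ = s₃ x
          S = Span-isSubspace frame
      in resp S (V.≈ᴹ-sym (V.≈ᴹ-trans x≈ (V.≈ᴹ-trans (V.+ᴹ-cong y≈ z≈) (V.+ᴹ-identityʳ _))))
           (lc-closed S a (u₃ ∷ᶠ u₂ ∷ᶠ u₁ ∷ᶠ []ᶠ) λ
             { zero             → gen∈Span frame (suc (suc zero))
             ; (suc zero)       → gen∈Span frame (suc zero)
             ; (suc (suc zero)) → gen∈Span frame zero })

  -- h ↦ h ⊕ id_D on V = W ⊕ D.
  _⊕id : (W.Carrierᴹ → W.Carrierᴹ) → V.Carrierᴹ → V.Carrierᴹ
  (h ⊕id) x = inW (h (b zero W.*ₗ eW zero W.+ᴹ b (suc zero) W.*ₗ eW (suc zero)))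
       V.+ᴹ inD (b (suc (suc zero)) D.*ₗ eD zero)
    where b = proj₁ (frame-spans x)

------------------------------------------------------------------------
-- Orbits on Hyp_V × Hyp_W

module Orbits {K : CompletedField c ℓ f ℓf} (C : Configuration K u ℓu w ℓw l ℓl) where
  open CompletedField K hiding (zero)
  open Configuration C
  private
    module HV = Lattices K V
    module HW = Lattices K W

  Hyp² : Set _
  Hyp² = HV.Hyp × HW.Hyp

  H : Set _
  H = WL.GL

  det : H → Carrier
  det h = h₁₁ * h₂₂ - h₁₂ * h₂₁
    where
    open WL.IsBasis eW-basis using (coord)
    e₁ = eW zero
    e₂ = eW (suc zero)
    h₁₁ = coord (WL.GL.to h e₁) zero
    h₂₁ = coord (WL.GL.to h e₁) (suc zero)
    h₁₂ = coord (WL.GL.to h e₂) zero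
    h₂₂ = coord (WL.GL.to h e₂) (suc zero)

  H₀ : Pred H 0ℓ
  H₀ h = v (det h) ≡ [ + 0 ]

  -- (L , M) and (L′ , M′) are conjugate under G ⊆ H; lattices are equal when
  -- they have the same elements.
  _≈[_]_ : Hyp² → Pred H 0ℓ → Hyp² → Set _
  (L , M) ≈[ G ] (L′ , M′) = ∃[ h ] G h
    × Image V._≈ᴹ_ (WL.GL.to h ⊕id) (HV.Hyp._∋_ L) ≐ HV.Hyp._∋_ L′
    × Image W._≈ᴹ_ (WL.GL.to h) (HW.Hyp._∋_ M) ≐ HW.Hyp._∋_ M′

  Matrix : ℕ → Set _
  Matrix n = Vec (Vec Carrier n) n

  infixr 7 _·_

  _·_ : ∀ {n} → Carrier → Matrix n → Matrix n
  r · A = Vec.map (Vec.map (r *_)) A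

  entry : ∀ {n} → Matrix n → Fin n → Fin n → Carrier
  entry A i j = lookup (lookup A i) j

  colsV : Matrix 3 → Fin 3 → V.Carrierᴹ
  colsV A j = VL.lc (λ i → entry A i j) frame

  colsW : Matrix 2 → Fin 2 → W.Carrierᴹ
  colsW A j = WL.lc (λ i → entry A i j) eW

  record Quintuple : Set where
    constructor ⟪_,_,_,_,_⟫
    field
      s r   : ℤ
      d m n : ℕ

  -- With respect to e₁, e₂, the common stabilizer in H of ⟨e₁ , e₂⟩ and
  -- ⟨ϖ^d e₁ , e₂⟩ consists of the matrices in GL₂(𝒪) whose (1,2) entry lies in
  -- ϖ^d 𝒪.  Hence ϖ^-m can be cleared against ϖ^-n iff m + d ≤ n (or m = 0), and
  -- ϖ^-n against ϖ^-m iff n ≤ m (or n = 0): it is the first condition that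
  -- carries the summand d.  With the conditions m ≤ n and n + d ≤ m instead,
  -- the representatives below for (0,0,1,1,1) and (0,0,1,0,1) would be
  -- identified although they lie in different H-orbits.
  infix 4 _∼₁_ _∼_

  data _∼₁_ : Quintuple → Quintuple → Set where
    kill-m : ∀ {s r d m n} → m ℕ.+ d ℕ.≤ n → ⟪ s , r , d , m , n ⟫ ∼₁ ⟪ s , r , d , 0 , n ⟫
    kill-n : ∀ {s r d m n} → n ℕ.≤ m → ⟪ s , r , d , m , n ⟫ ∼₁ ⟪ s , r , d , m , 0 ⟫

  _∼_ : Quintuple → Quintuple → Set
  _∼_ = EqClosure _∼₁_

  matV : Quintuple → Matrix 3
  matV ⟪ s , r , d , m , n ⟫ = ϖ^ s ·
    ( (1# ∷ 0# ∷ ϖ^ (ℤ.- + m) ∷ [])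
    ∷ (0# ∷ 1# ∷ ϖ^ (ℤ.- + n) ∷ [])
    ∷ (0# ∷ 0# ∷ 1#           ∷ []) ∷ [])

  matW : Quintuple → Matrix 2
  matW ⟪ s , r , d , m , n ⟫ = ϖ^ r ·
    ( (ϖ^ (+ d) ∷ 0# ∷ [])
    ∷ (0#       ∷ 1# ∷ []) ∷ [])

  matV₀ : ℤ → Quintuple → Matrix 3
  matV₀ k ⟪ s , r , d , m , n ⟫ = ϖ^ s ·
    ( (ϖ^ k ∷ 0# ∷ ϖ^ (k ℤ.- + m) ∷ [])
    ∷ (0#   ∷ 1# ∷ ϖ^ (ℤ.- + n)   ∷ [])
    ∷ (0#   ∷ 0# ∷ 1#             ∷ []) ∷ [])

  matW₀ : ℤ → Quintuple → Matrix 2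
  matW₀ k ⟪ s , r , d , m , n ⟫ =
    ( (ϖ^ (k ℤ.+ + d ℤ.+ r) ∷ 0#   ∷ [])
    ∷ (0#                   ∷ ϖ^ r ∷ []) ∷ [])

  abstract
    private
      ϖ^*1≉0 : ∀ z → ¬ (ϖ^ z * 1# ≈ 0#)
      ϖ^*1≉0 z = *≉0 (ϖ^≉0 z) 1≉0

      colsV-span : ∀ A → (∀ i → ¬ (entry A i i ≈ 0#)) →
                   (∀ i j → j Fin.< i → entry A i j ≈ 0#) → ∀ x → VL.Span (colsV A) x
      colsV-span A diag lower =
        VL.Exchange.triangular-spans isField ≈0? (entry A) diag lower frame frame-spans

      colsW-span : ∀ A → (∀ i → ¬ (entry A i i ≈ 0#)) →
                   (∀ i j → j Fin.< i → entry A i j ≈ 0#) → ∀ x → WL.Span (colsW A) x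
      colsW-span A diag lower =
        WL.Exchange.triangular-spans isField ≈0? (entry A) diag lower eW
          (WL.IsBasis.spans eW-basis)

    matV-span : ∀ q x → VL.Span (colsV (matV q)) x
    matV-span q@(⟪ s , _ , _ , _ , _ ⟫) = colsV-span (matV q)
      (λ { zero → ϖ^*1≉0 s ; (suc zero) → ϖ^*1≉0 s ; (suc (suc zero)) → ϖ^*1≉0 s })
      (λ { zero _ () ; (suc zero) zero _ → zeroʳ _ ; (suc zero) (suc _) (ℕ.s≤s ())
         ; (suc (suc zero)) zero _ → zeroʳ _ ; (suc (suc zero)) (suc zero) _ → zeroʳ _
         ; (suc (suc zero)) (suc (suc _)) (ℕ.s≤s (ℕ.s≤s ())) })

    matV₀-span : ∀ k q x → VL.Span (colsV (matV₀ k q)) x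
    matV₀-span k q@(⟪ s , _ , _ , _ , _ ⟫) = colsV-span (matV₀ k q)
      (λ { zero → *≉0 (ϖ^≉0 s) (ϖ^≉0 k) ; (suc zero) → ϖ^*1≉0 s ; (suc (suc zero)) → ϖ^*1≉0 s })
      (λ { zero _ () ; (suc zero) zero _ → zeroʳ _ ; (suc zero) (suc _) (ℕ.s≤s ())
         ; (suc (suc zero)) zero _ → zeroʳ _ ; (suc (suc zero)) (suc zero) _ → zeroʳ _
         ; (suc (suc zero)) (suc (suc _)) (ℕ.s≤s (ℕ.s≤s ())) })

    matW-span : ∀ q x → WL.Span (colsW (matW q)) x
    matW-span q@(⟪ _ , r , d , _ , _ ⟫) = colsW-span (matW q)
      (λ { zero → *≉0 (ϖ^≉0 r) (ϖ^≉0 (+ d)) ; (suc zero) → ϖ^*1≉0 r })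
      (λ { zero _ () ; (suc zero) zero _ → zeroʳ _ ; (suc zero) (suc _) (ℕ.s≤s ()) })

    matW₀-span : ∀ k q x → WL.Span (colsW (matW₀ k q)) x
    matW₀-span k q@(⟪ _ , r , d , _ , _ ⟫) = colsW-span (matW₀ k q)
      (λ { zero → ϖ^≉0 (k ℤ.+ + d ℤ.+ r) ; (suc zero) → ϖ^≉0 r })
      (λ { zero _ () ; (suc zero) zero _ → refl ; (suc zero) (suc _) (ℕ.s≤s ()) })

  rep : Quintuple → Hyp²
  rep q = HV.⟨ colsV (matV q) ⟩ (matV-span q) , HW.⟨ colsW (matW q) ⟩ (matW-span q)

  rep₀ : ℤ → Quintuple → Hyp²
  rep₀ k q = HV.⟨ colsV (matV₀ k q) ⟩ (matV₀-span k q)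
           , HW.⟨ colsW (matW₀ k q) ⟩ (matW₀-span k q)

  -- The H-orbit of x, and H₀-conjugacy of its elements.
  Orbit : Hyp² → Set _
  Orbit x = ∃[ y ] x ≈[ U ] y

  _≈₀_ : ∀ {x} → Orbit x → Orbit x → Set _
  y ≈₀ z = proj₁ y ≈[ H₀ ] proj₁ z

{-# OPTIONS --safe #-}

-- In coordinates, a pair of lattices is a pair of subsets of k₀³ and k₀², on
-- which GL₂(k₀) acts through the first two coordinates.  Eliminating with a
-- pivot of least valuation brings a lattice of V to the shape
--   { (x , y , z) : s ≤ v z , (x , y) - z (α , β) ∈ Λ },   Λ a lattice of k₀²;
-- an element of H takes Λ to ϖ^s 𝒪², and then the Smith normal form, whose
-- column operations lie in the stabilizer GL₂(𝒪) of Λ, takes the lattice of W to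
-- the diagonal shape.  Only the classes of α and β modulo 𝒪 matter, and scaling
-- the two coordinates by units makes them powers of ϖ.
--
-- Conversely, H fixes the coordinate z and so preserves s and the intersection
-- ϖ^s 𝒪² of the lattice with W; this gives the invariance of r and d, and then of
-- max(m, n) and max(m, n - d), which measure how close (α , β) is to the multiples
-- of ϖ^s 𝒪² and of the lattice of W.  These invariants determine the class of a
-- quintuple since ⟪ s , r , d , m , n ⟫ ∼ ⟪ s , r , d , max(m, n - d) , max(m, n) ⟫.
--
-- The stabilizer of a pair has determinants of valuation 0, so the H₀-orbits in
-- an H-orbit are indexed by the valuation of the determinant of an element
-- carrying rep q to them.

module Submission where

open import Defs
open import Algebra.Bundles using (CommutativeRing)
open import Algebra.Module.Bundles using (LeftModule)
open import Algebra.Module.Morphism.Structures using (IsLeftModuleMonomorphism; IsLeftModuleIsomorphism)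
open import Data.Empty using (⊥-elim)
open import Data.Fin.Base using (Fin; zero; suc)
open import Data.Integer.Base as ℤ using (ℤ; +_; -[1+_])
open import Data.Maybe.Base using (Maybe; just; nothing)
open import Data.Nat.Base as ℕ using (ℕ; _∸_)
open import Data.Product.Base using (Σ-syntax; ∃-syntax; _×_; _,_; proj₁; proj₂)
open import Data.Sum.Base using (_⊎_; inj₁; inj₂)
open import Data.Vec.Functional using (updateAt) renaming ([] to []ᶠ; _∷_ to _∷ᶠ_)
open import Function.Bundles using (_⇔_; mk⇔; Equivalence)
open import Function.Structures using (IsBijection)
open import Level using (Level; _⊔_; 0ℓ) renaming (suc to lsuc)
open import Relation.Binary.Construct.Add.Supremum.NonStrict ℤ._≤_ using (_≤⁺_; [_]; _≤⊤⁺; ≤⁺-total; ≤⁺-trans; ≤⁺-reflexive-≡; [≤]-injective)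
open import Relation.Binary.Construct.Closure.ReflexiveTransitive using (ε; _◅_)
open import Relation.Binary.Construct.Closure.Symmetric using (fwd; bwd)
open import Relation.Binary.PropositionalEquality as ≡ using (_≡_)
open import Relation.Binary.Structures using (IsEquivalence)
open import Relation.Nullary.Construct.Add.Supremum using (_⁺; [_]; ⊤⁺)
open import Relation.Nullary.Decidable using (yes; no)
open import Relation.Nullary.Negation.Core using (¬_)
open import Relation.Unary using (U; _≐_)
import Algebra.Properties.AbelianGroup as AbelianGroupProperties
import Algebra.Properties.Ring as RingProperties
import Algebra.Properties.Semiring.Mult.TCOptimised as Mult
import Algebra.Properties.Semiring.Sum as SemiringSum
import Algebra.Solver.Ring as RingSolver
import Algebra.Solver.Ring.AlmostCommutativeRing as ACR
import Data.Integer.Properties as ℤₚ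
import Data.Integer.Solver as ℤSolver
import Data.Nat.Properties as ℕₚ
import Function.Construct.Composition as Composition
import Relation.Binary.Construct.Closure.Equivalence as EqClosure
import Relation.Binary.Reasoning.Setoid as ≈-Reasoning

-- Abstract modules enter only through one correspondence, between `≈[ G ]` and a relation
-- `X ~[ z ] Y` on coordinates whose index z is the valuation of the determinant. Indices add under
-- composition and change sign under inversion, so conjugacy under H is `~[ z ]` for some z and
-- conjugacy under H₀ is `~[ + 0 ]`; both assertions of the theorem are read off the same chains of
-- conjugacies by adding up indices. A lattice appears in two guises: as the 𝒪-span of finitely many
-- vectors, which is what the definition provides, and as a set cut out by lower bounds on
-- valuations of linear forms. Elimination turns the first into the second, and the invariants are
-- computed with the second alone. Each invariant requires only one inequality, because `~-sym`
-- supplies the opposite one.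

-- The ring solver decides cancellation only if its coefficients have
-- decidable equality, hence integer coefficients, mapped to multiples of 1#.
module IntegerSolver {c ℓ} (R : CommutativeRing c ℓ) where
  open CommutativeRing R
  open RingProperties ring using (-0#≈0#; -‿involutive; -‿distribˡ-*; -‿distribʳ-*)
  open AbelianGroupProperties +-abelianGroup using (xyx⁻¹≈y; ⁻¹-∙-comm)
  open Mult semiring using (×-homo-+; ×1-homo-*; 1+×) renaming (_×_ to _×ᴿ_)
  open ≈-Reasoning setoid

  fromℤ : ℤ → Carrier
  fromℤ (+ n)    = n ×ᴿ 1#
  fromℤ -[1+ n ] = - (ℕ.suc n ×ᴿ 1#)

  private
    cancel-+ˡ : ∀ a x y → (a + x) - (a + y) ≈ x - y
    cancel-+ˡ a x y = begin
      (a + x) - (a + y)     ≈⟨ +-congˡ (⁻¹-∙-comm a y) ⟨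
      (a + x) + (- a - y)   ≈⟨ +-assoc (a + x) (- a) (- y) ⟨
      ((a + x) - a) - y     ≈⟨ +-congʳ (xyx⁻¹≈y a x) ⟩
      x - y ∎

    fromℤ-⊖ : ∀ m n → fromℤ (m ℤ.⊖ n) ≈ m ×ᴿ 1# - n ×ᴿ 1#
    fromℤ-⊖ m ℕ.zero = sym (trans (+-congˡ -0#≈0#) (+-identityʳ _))
    fromℤ-⊖ ℕ.zero (ℕ.suc n) = sym (+-identityˡ _)
    fromℤ-⊖ (ℕ.suc m) (ℕ.suc n) = begin
      fromℤ (ℕ.suc m ℤ.⊖ ℕ.suc n)         ≈⟨ reflexive (≡.cong fromℤ (ℤₚ.[1+m]⊖[1+n]≡m⊖n m n)) ⟩
      fromℤ (m ℤ.⊖ n)                     ≈⟨ fromℤ-⊖ m n ⟩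
      m ×ᴿ 1# - n ×ᴿ 1#                     ≈⟨ cancel-+ˡ 1# _ _ ⟨
      (1# + m ×ᴿ 1#) - (1# + n ×ᴿ 1#)       ≈⟨ +-cong (1+× m 1#) (-‿cong (1+× n 1#)) ⟨
      ℕ.suc m ×ᴿ 1# - ℕ.suc n ×ᴿ 1# ∎

    fromℤ-neg : ∀ i → fromℤ (ℤ.- i) ≈ - fromℤ i
    fromℤ-neg (+ ℕ.zero)    = sym -0#≈0#
    fromℤ-neg (+ (ℕ.suc n)) = refl
    fromℤ-neg -[1+ n ]      = sym (-‿involutive _)

    fromℤ-+ : ∀ i j → fromℤ (i ℤ.+ j) ≈ fromℤ i + fromℤ j
    fromℤ-+ (+ m) (+ n)       = ×-homo-+ 1# m n
    fromℤ-+ (+ m) -[1+ n ]    = fromℤ-⊖ m (ℕ.suc n)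
    fromℤ-+ -[1+ m ] (+ n)    = trans (fromℤ-⊖ n (ℕ.suc m)) (+-comm _ _)
    fromℤ-+ -[1+ m ] -[1+ n ] = begin
      - (ℕ.suc (ℕ.suc (m ℕ.+ n)) ×ᴿ 1#)   ≈⟨ -‿cong (begin
        ℕ.suc (ℕ.suc m ℕ.+ n) ×ᴿ 1#           ≈⟨ 1+× (ℕ.suc m ℕ.+ n) 1# ⟩
        1# + (ℕ.suc m ℕ.+ n) ×ᴿ 1#            ≈⟨ +-congˡ (×-homo-+ 1# (ℕ.suc m) n) ⟩
        1# + (ℕ.suc m ×ᴿ 1# + n ×ᴿ 1#)         ≈⟨ +-assoc _ _ _ ⟨
        (1# + ℕ.suc m ×ᴿ 1#) + n ×ᴿ 1#         ≈⟨ +-congʳ (+-comm _ _) ⟩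
        (ℕ.suc m ×ᴿ 1# + 1#) + n ×ᴿ 1#         ≈⟨ +-assoc _ _ _ ⟩
        ℕ.suc m ×ᴿ 1# + (1# + n ×ᴿ 1#)         ≈⟨ +-congˡ (1+× n 1#) ⟨
        ℕ.suc m ×ᴿ 1# + ℕ.suc n ×ᴿ 1# ∎) ⟩
      - (ℕ.suc m ×ᴿ 1# + ℕ.suc n ×ᴿ 1#)    ≈⟨ ⁻¹-∙-comm _ _ ⟨
      - (ℕ.suc m ×ᴿ 1#) - ℕ.suc n ×ᴿ 1# ∎

    fromℤ-*⁺ : ∀ m n → fromℤ (+ m ℤ.* + n) ≈ m ×ᴿ 1# * (n ×ᴿ 1#)
    fromℤ-*⁺ m n = trans (reflexive (≡.cong fromℤ (≡.sym (ℤₚ.pos-* m n)))) (×1-homo-* m n)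

    fromℤ-*ʳ : ∀ m j → fromℤ (+ m ℤ.* j) ≈ m ×ᴿ 1# * fromℤ j
    fromℤ-*ʳ m (+ n)    = fromℤ-*⁺ m n
    fromℤ-*ʳ m -[1+ n ] = begin
      fromℤ (+ m ℤ.* -[1+ n ])            ≈⟨ reflexive (≡.cong fromℤ (≡.sym (ℤₚ.neg-distribʳ-* (+ m) (+ ℕ.suc n)))) ⟩
      fromℤ (ℤ.- (+ m ℤ.* + ℕ.suc n))     ≈⟨ fromℤ-neg (+ m ℤ.* + ℕ.suc n) ⟩
      - fromℤ (+ m ℤ.* + ℕ.suc n)         ≈⟨ -‿cong (fromℤ-*⁺ m (ℕ.suc n)) ⟩
      - (m ×ᴿ 1# * (ℕ.suc n ×ᴿ 1#))         ≈⟨ -‿distribʳ-* _ _ ⟩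
      m ×ᴿ 1# * - (ℕ.suc n ×ᴿ 1#) ∎

    fromℤ-* : ∀ i j → fromℤ (i ℤ.* j) ≈ fromℤ i * fromℤ j
    fromℤ-* (+ m) j    = fromℤ-*ʳ m j
    fromℤ-* -[1+ m ] j = begin
      fromℤ (-[1+ m ] ℤ.* j)              ≈⟨ reflexive (≡.cong fromℤ (≡.sym (ℤₚ.neg-distribˡ-* (+ ℕ.suc m) j))) ⟩
      fromℤ (ℤ.- (+ ℕ.suc m ℤ.* j))       ≈⟨ fromℤ-neg (+ ℕ.suc m ℤ.* j) ⟩
      - fromℤ (+ ℕ.suc m ℤ.* j)           ≈⟨ -‿cong (fromℤ-*ʳ (ℕ.suc m) j) ⟩
      - (ℕ.suc m ×ᴿ 1# * fromℤ j)          ≈⟨ -‿distribˡ-* _ _ ⟩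
      - (ℕ.suc m ×ᴿ 1#) * fromℤ j ∎

    fromℤ-≟ : ∀ i j → Maybe (fromℤ i ≈ fromℤ j)
    fromℤ-≟ i j with i ℤₚ.≟ j
    ... | yes i≡j = just (reflexive (≡.cong fromℤ i≡j))
    ... | no  _   = nothing

    morphism : ℤ.+-*-rawRing ACR.-Raw-AlmostCommutative⟶ ACR.fromCommutativeRing R
    morphism = record
      { ⟦_⟧ = fromℤ ; +-homo = fromℤ-+ ; *-homo = fromℤ-* ; -‿homo = fromℤ-neg
      ; 0-homo = refl ; 1-homo = refl }

  open RingSolver ℤ.+-*-rawRing (ACR.fromCommutativeRing R) morphism fromℤ-≟ public
    using (solve; _:=_; _:+_; _:*_; _:-_; :-_; con)

-- Arithmetic of the valuation.

[]-injective⁺ : ∀ {a b : ℤ} → _≡_ {A = ℤ ⁺} [ a ] [ b ] → a ≡ b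
[]-injective⁺ ≡.refl = ≡.refl

module Valuation {c ℓ f ℓf} (K : CompletedField c ℓ f ℓf) where
  open CompletedField K hiding (zero)
  private module ℤ+ = AbelianGroupProperties ℤₚ.+-0-abelianGroup

  infix 4 _≼_

  -- z ≼ x says x ∈ ϖ^z 𝒪.
  _≼_ : ℤ → Carrier → Set
  z ≼ x = [ z ] ≤⁺ v x

  v-≢⊤ : ∀ {x z} → v x ≡ [ z ] → ¬ (x ≈ 0#)
  v-≢⊤ vx x≈0 with ≡.trans (≡.sym vx) (≡.trans (v-cong x≈0) v-0)
  ... | ()

  valuation : ∀ x → ¬ (x ≈ 0#) → ∃[ z ] v x ≡ [ z ]
  valuation x x≉0 with v x in eq
  ... | [ z ] = z , ≡.refl
  ... | ⊤⁺    = ⊥-elim (x≉0 (v-⊤ x eq))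

  v-1 : v 1# ≡ [ + 0 ]
  v-1 with valuation 1# 1≉0
  ... | z , v1 = ≡.trans v1 (≡.cong [_] (ℤ+.identityˡ-unique z z ([]-injective⁺ z+z≡z)))
    where
    z+z≡z : [ z ℤ.+ z ] ≡ [ z ]
    z+z≡z = ≡.trans (≡.sym (≡.trans (v-* 1# 1#) (≡.cong₂ _+⁺_ v1 v1)))
                    (≡.trans (v-cong (*-identityˡ 1#)) v1)

  v-*⁼ : ∀ {x y a b} → v x ≡ [ a ] → v y ≡ [ b ] → v (x * y) ≡ [ a ℤ.+ b ]
  v-*⁼ vx vy = ≡.trans (v-* _ _) (≡.cong₂ _+⁺_ vx vy)

  v-inverse : ∀ {x y a} → v x ≡ [ a ] → x * y ≈ 1# → v y ≡ [ ℤ.- a ]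
  v-inverse {x} {y} {a} vx xy≈1 with v y in eq
  ... | [ b ] = ≡.cong [_] (ℤ+.inverseʳ-unique a b ([]-injective⁺ a+b≡0))
      where
      a+b≡0 : [ a ℤ.+ b ] ≡ [ + 0 ]
      a+b≡0 = ≡.trans (≡.sym (v-*⁼ vx eq)) (≡.trans (v-cong xy≈1) v-1)
  ... | ⊤⁺ = ⊥-elim (1≉0 (trans (sym xy≈1) (trans (*-congˡ (v-⊤ y eq)) (zeroʳ x))))

  v-^ : ∀ z → v (ϖ^ z) ≡ [ z ]
  v-^ (+ ℕ.zero)              = v-1
  v-^ (+ (ℕ.suc n))           = v-*⁼ v-ϖ (v-^ (+ n))
  v-^ -[1+ ℕ.zero ]           =
    v-*⁼ (v-inverse v-ϖ (proj₂ (inverse ϖ ϖ≉0))) v-1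
  v-^ -[1+ ℕ.suc n ]          =
    v-*⁼ (v-inverse v-ϖ (proj₂ (inverse ϖ ϖ≉0))) (v-^ -[1+ n ])

  ≼-resp : ∀ {a x y} → x ≈ y → a ≼ x → a ≼ y
  ≼-resp x≈y = ≡.subst (_ ≤⁺_) (v-cong x≈y)

  ≼-weaken : ∀ {a b x} → a ℤ.≤ b → b ≼ x → a ≼ x
  ≼-weaken a≤b = ≤⁺-trans ℤₚ.≤-trans [ a≤b ]

  ≡⇒≼ : ∀ {a x} → v x ≡ [ a ] → a ≼ x
  ≡⇒≼ vx = ≤⁺-reflexive-≡ ℤₚ.≤-reflexive (≡.sym vx)

  ≼⇒≤ : ∀ {a b x} → v x ≡ [ b ] → a ≼ x → a ℤ.≤ b
  ≼⇒≤ vx a≼x = [≤]-injective (≡.subst (_ ≤⁺_) vx a≼x)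

  ≤-v0 : ∀ s {y} → y ≈ 0# → s ≤⁺ v y
  ≤-v0 s y≈0 = ≡.subst (s ≤⁺_) (≡.sym (≡.trans (v-cong y≈0) v-0)) (s ≤⊤⁺)

  ≼-0 : ∀ {a} → a ≼ 0#
  ≼-0 = ≤-v0 _ refl

  ≼-+ : ∀ {a x y} → a ≼ x → a ≼ y → a ≼ x + y
  ≼-+ = v-+ _ _ _

  ≼-* : ∀ {a b x y} → a ≼ x → b ≼ y → a ℤ.+ b ≼ x * y
  ≼-* {x = x} {y} a≼x b≼y = ≡.subst (_ ≤⁺_) (≡.sym (v-* x y)) (+⁺-mono a≼x b≼y)
    where
    +⁺-mono : ∀ {a b s t} → [ a ] ≤⁺ s → [ b ] ≤⁺ t → [ a ℤ.+ b ] ≤⁺ s +⁺ t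
    +⁺-mono [ p ]     [ q ]     = [ ℤₚ.+-mono-≤ p q ]
    +⁺-mono [ p ]     (_ ≤⊤⁺)   = _ ≤⊤⁺
    +⁺-mono (_ ≤⊤⁺) q           = _ ≤⊤⁺

  ≼-scale : ∀ {k a e x} → v e ≡ [ k ] → a ≼ x → k ℤ.+ a ≼ e * x
  ≼-scale ve = ≼-* (≡⇒≼ ve)

  -k+[k+a]≡a : ∀ k a → ℤ.- k ℤ.+ (k ℤ.+ a) ≡ a
  -k+[k+a]≡a k a = ≡.trans (≡.sym (ℤₚ.+-assoc (ℤ.- k) k a))
    (≡.trans (≡.cong (λ t → t ℤ.+ a) (ℤₚ.+-inverseˡ k)) (ℤₚ.+-identityˡ a))

  ≼-unscale : ∀ {k a e x} → v e ≡ [ k ] → k ℤ.+ a ≼ e * x → a ≼ x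
  ≼-unscale {k} {a} {e} {x} ve p with inverse e (v-≢⊤ ve)
  ... | e⁻¹ , ee⁻¹ = ≼-resp e⁻¹ex≈x (≡.subst (_≼ e⁻¹ * (e * x)) (-k+[k+a]≡a k a)
                       (≼-scale (v-inverse ve ee⁻¹) p))
    where
    e⁻¹ex≈x : e⁻¹ * (e * x) ≈ x
    e⁻¹ex≈x = trans (sym (*-assoc _ _ _))
      (trans (*-congʳ (trans (*-comm _ _) ee⁻¹)) (*-identityˡ x))

  𝒪-* : ∀ {a x y} → 𝒪 x → a ≼ y → a ≼ x * y
  𝒪-* {a} {x} {y} p q = ≡.subst (_≼ x * y) (ℤₚ.+-identityˡ a) (≼-* p q)

  𝒪-1 : 𝒪 1#
  𝒪-1 = ≡⇒≼ v-1

  open IntegerSolver k₀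

  -- The axioms of a valuation do not mention negation. Since (-1)(-1) = 1, twice v(-1) is 0, so
  -- v(-1) = 0 and multiplication by -1 preserves every ϖ^a 𝒪.
  ≼-neg : ∀ {a x} → a ≼ x → a ≼ - x
  ≼-neg {a} {x} p = ≼-resp (solve 1 (λ x → (:- con (+ 1)) :* x := :- x) refl x) (𝒪-* 𝒪-[-1] p)
    where
    𝒪-[-1] : 𝒪 (- 1#)
    𝒪-[-1] with valuation (- 1#) (λ -1≈0 → 1≉0 (trans
                  (solve 0 (con (+ 1) := (:- con (+ 1)) :* (:- con (+ 1))) refl)
                  (trans (*-congˡ -1≈0) (zeroʳ _))))
    ... | z , v-1≡z = ≡⇒≼ (≡.trans v-1≡z (≡.cong [_] (z+z≡0⇒z≡0 z ([]-injective⁺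
            (≡.trans (≡.sym (v-*⁼ v-1≡z v-1≡z)) (≡.trans
              (v-cong (solve 0 ((:- con (+ 1)) :* (:- con (+ 1)) := con (+ 1)) refl)) v-1))))))
      where
      z+z≡0⇒z≡0 : ∀ z → z ℤ.+ z ≡ + 0 → z ≡ + 0
      -- For any other form of z the sum computes to a nonzero constructor form, so this is the only
      -- clause.
      z+z≡0⇒z≡0 (+ ℕ.zero) _ = ≡.refl

  ≼-- : ∀ {a x y} → a ≼ x → a ≼ y → a ≼ x - y
  ≼-- p q = ≼-+ p (≼-neg q)

  -- The case y = 0 is included, so a pivot of least valuation divides every entry it is compared
  -- with, zeros too.
  𝒪-quotient : ∀ {x x⁻¹ y} → x * x⁻¹ ≈ 1# → v x ≤⁺ v y → 𝒪 (y * x⁻¹)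
  𝒪-quotient {x} {x⁻¹} {y} xx⁻¹ p with valuation x (λ x≈0 → 1≉0 (trans (sym xx⁻¹)
                                      (trans (*-congʳ x≈0) (zeroˡ _))))
  ... | z , vx = ≼-resp (*-comm _ _) (≡.subst (_≼ x⁻¹ * y) (ℤₚ.+-inverseˡ z)
                   (≼-scale (v-inverse vx xx⁻¹) (≡.subst (_≤⁺ v y) vx p)))

  -- A family of zeros is split off because its least valuation ⊤⁺ offers no pivot to divide by.
  least-valuation : ∀ {n} (a : Fin n → Carrier) →
    (∀ i → a i ≈ 0#) ⊎ (∃[ i ] (¬ a i ≈ 0#) × ∀ j → v (a i) ≤⁺ v (a j))
  least-valuation {ℕ.zero}  a = inj₁ λ ()
  least-valuation {ℕ.suc n} a with ≈0? (a zero) | least-valuation (λ i → a (suc i))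
  ... | inj₁ a₀≈0 | inj₁ a≈0 = inj₁ λ { zero → a₀≈0 ; (suc i) → a≈0 i }
  ... | inj₂ a₀≉0 | inj₁ a≈0 = inj₂ (zero , a₀≉0 , λ
    { zero    → ≤⁺-reflexive-≡ ℤₚ.≤-reflexive ≡.refl
    ; (suc j) → ≤-v0 (v (a zero)) (a≈0 j) })
  ... | inj₁ a₀≈0 | inj₂ (i , aᵢ≉0 , min) = inj₂ (suc i , aᵢ≉0 , λ
    { zero    → ≤-v0 (v (a (suc i))) a₀≈0
    ; (suc j) → min j })
  ... | inj₂ a₀≉0 | inj₂ (i , aᵢ≉0 , min) with ≤⁺-total ℤₚ.≤-total (v (a zero)) (v (a (suc i)))
  ...   | inj₁ a₀≤aᵢ = inj₂ (zero , a₀≉0 , λ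
    { zero    → ≤⁺-reflexive-≡ ℤₚ.≤-reflexive ≡.refl
    ; (suc j) → ≤⁺-trans ℤₚ.≤-trans a₀≤aᵢ (min j) })
  ...   | inj₂ aᵢ≤a₀ = inj₂ (suc i , aᵢ≉0 , λ { zero → aᵢ≤a₀ ; (suc j) → min j })

-- Linear combinations and elimination over 𝒪.

module Elimination {c ℓ f ℓf} (K : CompletedField c ℓ f ℓf) where
  open CompletedField K hiding (zero)
  open IntegerSolver k₀
  open Valuation K
  open SemiringSum semiring using (sum; *-distribʳ-sum)

  comb : ∀ {n} → (Fin n → Carrier) → (Fin n → Carrier) → Carrier
  comb a g = sum (λ i → a i * g i)

  comb-cong : ∀ {n} a {g h : Fin n → Carrier} → (∀ i → g i ≈ h i) → comb a g ≈ comb a h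
  comb-cong {ℕ.zero}  a g≈h = refl
  comb-cong {ℕ.suc n} a g≈h =
    +-cong (*-congˡ (g≈h zero)) (comb-cong (λ i → a (suc i)) (λ i → g≈h (suc i)))

  comb-0 : ∀ {n} (a : Fin n → Carrier) {g} → (∀ i → g i ≈ 0#) → comb a g ≈ 0#
  comb-0 {ℕ.zero}  a g≈0 = refl
  comb-0 {ℕ.suc n} a g≈0 = trans
    (+-cong (trans (*-congˡ (g≈0 zero)) (zeroʳ _)) (comb-0 (λ i → a (suc i)) (λ i → g≈0 (suc i))))
    (+-identityʳ 0#)

  comb-*ʳ : ∀ {n} (a g : Fin n → Carrier) t → comb a (λ i → g i * t) ≈ comb a g * t
  comb-*ʳ {ℕ.zero}  a g t = sym (zeroˡ t)
  comb-*ʳ {ℕ.suc n} a g t = trans (+-congˡ (comb-*ʳ (λ i → a (suc i)) (λ i → g (suc i)) t))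
    (solve 4 (λ a g t s → a :* (g :* t) :+ s :* t := (a :* g :+ s) :* t) refl _ _ _ _)

  comb-- : ∀ {n} (a g h : Fin n → Carrier) → comb a (λ i → g i - h i) ≈ comb a g - comb a h
  comb-- {ℕ.zero}  a g h = solve 0 (con (+ 0) := con (+ 0) :- con (+ 0)) refl
  comb-- {ℕ.suc n} a g h = trans
    (+-congˡ (comb-- (λ i → a (suc i)) (λ i → g (suc i)) (λ i → h (suc i))))
    (solve 5 (λ a g h s t → a :* (g :- h) :+ (s :- t) := (a :* g :+ s) :- (a :* h :+ t))
      refl _ _ _ _ _)

  comb-updateAt : ∀ {n} (a : Fin n → Carrier) i t g →
                  comb (updateAt a i (_+ t)) g ≈ comb a g + t * g i
  comb-updateAt a zero t g =
    solve 4 (λ a t g s → (a :+ t) :* g :+ s := (a :* g :+ s) :+ t :* g) refl _ _ _ _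
  comb-updateAt a (suc i) t g = trans
    (+-congˡ (comb-updateAt (λ i → a (suc i)) i t (λ i → g (suc i)))) (sym (+-assoc _ _ _))

  𝒪-updateAt : ∀ {n} (a : Fin n → Carrier) i {t} → 𝒪 t → (∀ j → 𝒪 (a j)) →
               ∀ j → 𝒪 (updateAt a i (_+ t) j)
  𝒪-updateAt a zero    𝒪t 𝒪a zero    = ≼-+ (𝒪a zero) 𝒪t
  𝒪-updateAt a zero    𝒪t 𝒪a (suc j) = 𝒪a (suc j)
  𝒪-updateAt a (suc i) 𝒪t 𝒪a zero    = 𝒪a zero
  𝒪-updateAt a (suc i) 𝒪t 𝒪a (suc j) = 𝒪-updateAt (λ i → a (suc i)) i 𝒪t (λ i → 𝒪a (suc i)) j

  𝒪-comb : ∀ {n} (a g : Fin n → Carrier) → (∀ i → 𝒪 (a i)) → (∀ i → 𝒪 (g i)) → 𝒪 (comb a g)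
  𝒪-comb {ℕ.zero}  a g 𝒪a 𝒪g = ≼-0
  𝒪-comb {ℕ.suc n} a g 𝒪a 𝒪g = ≼-+ (𝒪-* (𝒪a zero) (𝒪g zero))
    (𝒪-comb (λ i → a (suc i)) (λ i → g (suc i)) (λ i → 𝒪a (suc i)) (λ i → 𝒪g (suc i)))

  -- The generators are the rows of G; a matrix whose columns generate a lattice is transposed
  -- before it appears here.
  RowSpan : ∀ {N n} → (Fin N → Fin n → Carrier) → (Fin n → Carrier) → Set (c ⊔ ℓ)
  RowSpan G x = ∃[ a ] (∀ i → 𝒪 (a i)) × ∀ j → x j ≈ comb a (λ i → G i j)

  Full : ∀ {N n} → (Fin N → Fin n → Carrier) → Set (c ⊔ ℓ)
  Full {n = n} G = ∀ (x : Fin n → Carrier) → ∃[ a ] ∀ j → x j ≈ comb a (λ i → G i j)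

  -- The remaining coordinates of x - x₀ (1, w), that is, of the projection of x along (1, w) to the
  -- hyperplane where the first coordinate vanishes.
  shear : ∀ {n} → (Fin n → Carrier) → (Fin (ℕ.suc n) → Carrier) → Fin n → Carrier
  shear w x j = x (suc j) - x zero * w j

  -- Pivot on a row whose first entry has least valuation.
  eliminate : ∀ {N n} (G : Fin N → Fin (ℕ.suc n) → Carrier) → Full G →
    Σ[ τ ∈ Carrier ] (¬ τ ≈ 0#) × Σ[ w ∈ (Fin n → Carrier) ] Full (λ i → shear w (G i)) ×
    (∀ x → RowSpan G x ⇔ (𝒪 (x zero * τ) × RowSpan (λ i → shear w (G i)) (shear w x)))
  eliminate {N} {n} G full with least-valuation (λ i → G i zero)
  ... | inj₁ G₀≈0 = ⊥-elim (1≉0 (let a , 1≈ = full (1# ∷ᶠ λ _ → 0#) in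
                      trans (1≈ zero) (comb-0 a G₀≈0)))
  ... | inj₂ (p , h≉0 , least) = τ , τ≉0 , w , full′ , λ x → mk⇔ (to x) (from x)
    where
    h = G p zero
    τ = proj₁ (inverse h h≉0)
    hτ≈1 : h * τ ≈ 1#
    hτ≈1 = proj₂ (inverse h h≉0)
    τ≉0 : ¬ τ ≈ 0#
    τ≉0 = inverse≉0 h h≉0
    -- (1, w) is the pivot row divided by its first entry, so the shear sends the pivot row to zero.
    -- That row is kept in `G′` all the same, which leaves the index set `Fin N` unchanged.
    w : Fin n → Carrier
    w j = τ * G p (suc j)
    G′ : Fin N → Fin n → Carrier
    G′ i = shear w (G i)

    comb-shear : ∀ a j → comb a (λ i → G′ i j)
                 ≈ comb a (λ i → G i (suc j)) - comb a (λ i → G i zero) * w j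
    comb-shear a j = trans (comb-- a _ _) (+-congˡ (-‿cong (comb-*ʳ a _ _)))

    shear-comb : ∀ a x → (∀ j → x j ≈ comb a (λ i → G i j)) →
                 ∀ j → shear w x j ≈ comb a (λ i → G′ i j)
    shear-comb a x x≈ j = trans (+-cong (x≈ (suc j)) (-‿cong (*-congʳ (x≈ zero))))
                                (sym (comb-shear a j))

    full′ : Full G′
    full′ y = let a , x≈ = full (0# ∷ᶠ y) in a , λ j →
      trans (solve 2 (λ y w → y := y :- con (+ 0) :* w) refl _ _) (shear-comb a (0# ∷ᶠ y) x≈ j)

    𝒪-heads : ∀ a → (∀ i → 𝒪 (a i)) → 𝒪 (comb a (λ i → G i zero) * τ)
    𝒪-heads a 𝒪a = ≼-resp (comb-*ʳ a _ τ)
      (𝒪-comb a (λ i → G i zero * τ) 𝒪a (λ i → 𝒪-quotient hτ≈1 (least i)))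

    to : ∀ x → RowSpan G x → 𝒪 (x zero * τ) × RowSpan G′ (shear w x)
    to x (a , 𝒪a , x≈) = ≼-resp (*-congʳ (sym (x≈ zero))) (𝒪-heads a 𝒪a)
                       , a , 𝒪a , shear-comb a x x≈

    from : ∀ x → 𝒪 (x zero * τ) × RowSpan G′ (shear w x) → RowSpan G x
    from x (𝒪x₀ , a , 𝒪a , y≈) = updateAt a p (_+ t)
                               , 𝒪-updateAt a p (≼-- 𝒪x₀ (𝒪-heads a 𝒪a)) 𝒪a
                               , λ j → trans (x≈ j) (sym (comb-updateAt a p t _))
      where
      s₀ = comb a (λ i → G i zero)
      -- The multiple of the pivot row that corrects the first coordinate from s₀ to x₀. It is
      -- integral because x₀ τ and s₀ τ are, and it leaves the sheared coordinates alone.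
      t  = x zero * τ - s₀ * τ
      x≈ : ∀ j → x j ≈ comb a (λ i → G i j) + t * G p j
      x≈ zero = begin
        x zero                                        ≈⟨ solve 2 (λ x s → x := s :+ (x :- s) :* con (+ 1)) refl _ _ ⟩
        s₀ + (x zero - s₀) * 1#                       ≈⟨ +-congˡ (*-congˡ (sym hτ≈1)) ⟩
        s₀ + (x zero - s₀) * (h * τ)                  ≈⟨ solve 4 (λ x s h τ → s :+ (x :- s) :* (h :* τ)
                                                             := s :+ (x :* τ :- s :* τ) :* h) refl _ _ _ _ ⟩
        s₀ + t * h ∎
        where open ≈-Reasoning setoid
      x≈ (suc j) = begin
        x (suc j)                                     ≈⟨ solve 3 (λ y x w → y := (y :- x :* w) :+ x :* w) refl (x (suc j)) (x zero) (w j) ⟩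
        shear w x j + x zero * w j                    ≈⟨ +-congʳ (trans (y≈ j) (comb-shear a j)) ⟩
        (s₁ - s₀ * w j) + x zero * w j                ≈⟨ solve 5 (λ s₁ s₀ x τ g → (s₁ :- s₀ :* (τ :* g)) :+ x :* (τ :* g)
                                                             := s₁ :+ (x :* τ :- s₀ :* τ) :* g) refl s₁ s₀ (x zero) τ (G p (suc j)) ⟩
        s₁ + t * G p (suc j) ∎
        where
        open ≈-Reasoning setoid
        s₁ = comb a (λ i → G i (suc j))

-- Conjugacy of pairs of lattices in coordinates.

module Conjugacy {c ℓ f ℓf} (K : CompletedField c ℓ f ℓf) where
  open CompletedField K hiding (zero)
  open IntegerSolver k₀
  open Valuation K
  open Equivalence using (to; from)

  record Matrix₂ : Set c where
    constructor mat
    field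
      a₁₁ a₁₂ a₂₁ a₂₂ : Carrier

    row₁ row₂ : Carrier → Carrier → Carrier
    row₁ x y = a₁₁ * x + a₁₂ * y
    row₂ x y = a₂₁ * x + a₂₂ * y

    det₂ : Carrier
    det₂ = a₁₁ * a₂₂ - a₁₂ * a₂₁

  open Matrix₂

  -- The coordinates of the elements of a pair of lattices.
  record Pair p : Set (c ⊔ ℓ ⊔ lsuc p) where
    field
      inV    : Carrier → Carrier → Carrier → Set p
      inW    : Carrier → Carrier → Set p
      V-resp : ∀ {x x′ y y′ z z′} → x ≈ x′ → y ≈ y′ → z ≈ z′ → inV x y z → inV x′ y′ z′
      W-resp : ∀ {x x′ y y′} → x ≈ x′ → y ≈ y′ → inW x y → inW x′ y′

  open Pair

  infix 4 _~[_]_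

  -- The third coordinate is carried along unchanged because h acts as the identity on D. The two
  -- sides may live at different levels: spans are existential statements over `Carrier`, while the
  -- standard pairs are plain inequalities of valuations.
  record _~[_]_ {p q} (X : Pair p) (z : ℤ) (Y : Pair q) : Set (c ⊔ ℓ ⊔ p ⊔ q) where
    constructor conj
    field
      A     : Matrix₂
      v-det : v (det₂ A) ≡ [ z ]
      V⇔    : ∀ x y z → inV X x y z ⇔ inV Y (row₁ A x y) (row₂ A x y) z
      W⇔    : ∀ x y → inW X x y ⇔ inW Y (row₁ A x y) (row₂ A x y)

  private
    variable
      p q r : Level
      X Y Z : Pair p

  I₂ : Matrix₂
  I₂ = mat 1# 0# 0# 1#

  v-det-I₂ : v (det₂ I₂) ≡ [ + 0 ]
  v-det-I₂ = ≡.trans (v-cong (solve 0 (:1 :* :1 :- :0 :* :0 := :1) refl)) v-1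
    where :0 = con (+ 0) ; :1 = con (+ 1)

  row₁-I₂ : ∀ x y → row₁ I₂ x y ≈ x
  row₁-I₂ = solve 2 (λ x y → con (+ 1) :* x :+ con (+ 0) :* y := x) refl

  row₂-I₂ : ∀ x y → row₂ I₂ x y ≈ y
  row₂-I₂ = solve 2 (λ x y → con (+ 0) :* x :+ con (+ 1) :* y := y) refl

  ≐⇒~ : (∀ x y z → inV X x y z ⇔ inV Y x y z) → (∀ x y → inW X x y ⇔ inW Y x y) → X ~[ + 0 ] Y
  ≐⇒~ {X = X} {Y = Y} V⇔ W⇔ = conj I₂ v-det-I₂
    (λ x y z → mk⇔ (λ s → V-resp Y (sym (row₁-I₂ x y)) (sym (row₂-I₂ x y)) refl (to (V⇔ x y z) s))
                   (λ s → from (V⇔ x y z) (V-resp Y (row₁-I₂ x y) (row₂-I₂ x y) refl s)))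
    (λ x y → mk⇔ (λ s → W-resp Y (sym (row₁-I₂ x y)) (sym (row₂-I₂ x y)) (to (W⇔ x y) s))
                 (λ s → from (W⇔ x y) (W-resp Y (row₁-I₂ x y) (row₂-I₂ x y) s)))

  ~-refl : X ~[ + 0 ] X
  ~-refl = ≐⇒~ (λ _ _ _ → mk⇔ (λ s → s) (λ s → s)) (λ _ _ → mk⇔ (λ s → s) (λ s → s))

  module Inverse₂ (A : Matrix₂) (δ : Carrier) (Dδ≈1 : det₂ A * δ ≈ 1#) where
    A⁻¹ : Matrix₂
    A⁻¹ = mat (a₂₂ A * δ) (- (a₁₂ A * δ)) (- (a₂₁ A * δ)) (a₁₁ A * δ)

    private
      cancel-det : ∀ x → det₂ A * δ * x ≈ x
      cancel-det x = trans (*-congʳ Dδ≈1) (*-identityˡ x)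

    row₁-inverse : ∀ x y → row₁ A (row₁ A⁻¹ x y) (row₂ A⁻¹ x y) ≈ x
    row₁-inverse x y = trans
      (solve 7 (λ a b c d δ x y →
        a :* (d :* δ :* x :+ (:- (b :* δ)) :* y) :+ b :* ((:- (c :* δ)) :* x :+ a :* δ :* y)
          := (a :* d :- b :* c) :* δ :* x) refl (a₁₁ A) (a₁₂ A) (a₂₁ A) (a₂₂ A) δ x y)
      (cancel-det x)

    row₂-inverse : ∀ x y → row₂ A (row₁ A⁻¹ x y) (row₂ A⁻¹ x y) ≈ y
    row₂-inverse x y = trans
      (solve 7 (λ a b c d δ x y →
        c :* (d :* δ :* x :+ (:- (b :* δ)) :* y) :+ d :* ((:- (c :* δ)) :* x :+ a :* δ :* y)
          := (a :* d :- b :* c) :* δ :* y) refl (a₁₁ A) (a₁₂ A) (a₂₁ A) (a₂₂ A) δ x y)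
      (cancel-det y)

    inverse-row₁ : ∀ x y → row₁ A⁻¹ (row₁ A x y) (row₂ A x y) ≈ x
    inverse-row₁ x y = trans
      (solve 7 (λ a b c d δ x y →
        d :* δ :* (a :* x :+ b :* y) :+ (:- (b :* δ)) :* (c :* x :+ d :* y)
          := (a :* d :- b :* c) :* δ :* x) refl (a₁₁ A) (a₁₂ A) (a₂₁ A) (a₂₂ A) δ x y)
      (cancel-det x)

    inverse-row₂ : ∀ x y → row₂ A⁻¹ (row₁ A x y) (row₂ A x y) ≈ y
    inverse-row₂ x y = trans
      (solve 7 (λ a b c d δ x y →
        (:- (c :* δ)) :* (a :* x :+ b :* y) :+ a :* δ :* (c :* x :+ d :* y)
          := (a :* d :- b :* c) :* δ :* y) refl (a₁₁ A) (a₁₂ A) (a₂₁ A) (a₂₂ A) δ x y)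
      (cancel-det y)

    det-inverse : det₂ A * det₂ A⁻¹ ≈ 1#
    det-inverse = trans
      (solve 5 (λ a b c d δ →
        (a :* d :- b :* c) :* (d :* δ :* (a :* δ) :- (:- (b :* δ)) :* (:- (c :* δ)))
          := (a :* d :- b :* c) :* δ :* ((a :* d :- b :* c) :* δ))
        refl (a₁₁ A) (a₁₂ A) (a₂₁ A) (a₂₂ A) δ)
      (trans (cancel-det (det₂ A * δ)) Dδ≈1)

  ~-sym : ∀ {z} → X ~[ z ] Y → Y ~[ ℤ.- z ] X
  ~-sym {X = X} {Y = Y} (conj A v-det V⇔ W⇔) = conj A⁻¹ (v-inverse v-det det-inverse)
    (λ x y z → mk⇔
      (λ s → from (V⇔ _ _ z) (V-resp Y (sym (row₁-inverse x y)) (sym (row₂-inverse x y)) refl s))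
      (λ s → V-resp Y (row₁-inverse x y) (row₂-inverse x y) refl (to (V⇔ _ _ z) s)))
    (λ x y → mk⇔
      (λ s → from (W⇔ _ _) (W-resp Y (sym (row₁-inverse x y)) (sym (row₂-inverse x y)) s))
      (λ s → W-resp Y (row₁-inverse x y) (row₂-inverse x y) (to (W⇔ _ _) s)))
    where
    D⁻¹ = inverse (det₂ A) (v-≢⊤ v-det)
    open Inverse₂ A (proj₁ D⁻¹) (proj₂ D⁻¹)

  _∙₂_ : Matrix₂ → Matrix₂ → Matrix₂
  mat a b c d ∙₂ mat a′ b′ c′ d′ =
    mat (a * a′ + b * c′) (a * b′ + b * d′) (c * a′ + d * c′) (c * b′ + d * d′)

  det-∙₂ : ∀ B A → det₂ (B ∙₂ A) ≈ det₂ A * det₂ B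
  det-∙₂ (mat a b c d) (mat a′ b′ c′ d′) = solve 8 (λ a b c d a′ b′ c′ d′ →
    (a :* a′ :+ b :* c′) :* (c :* b′ :+ d :* d′) :- (a :* b′ :+ b :* d′) :* (c :* a′ :+ d :* c′)
      := (a′ :* d′ :- b′ :* c′) :* (a :* d :- b :* c)) refl a b c d a′ b′ c′ d′

  row-∙ : ∀ b₁ b₂ A x y → b₁ * row₁ A x y + b₂ * row₂ A x y
          ≈ (b₁ * a₁₁ A + b₂ * a₂₁ A) * x + (b₁ * a₁₂ A + b₂ * a₂₂ A) * y
  row-∙ b₁ b₂ (mat a b c d) x y = solve 8 (λ b₁ b₂ a b c d x y →
    b₁ :* (a :* x :+ b :* y) :+ b₂ :* (c :* x :+ d :* y)
      := (b₁ :* a :+ b₂ :* c) :* x :+ (b₁ :* b :+ b₂ :* d) :* y) refl b₁ b₂ a b c d x y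

  ~-trans : ∀ {z z′} → X ~[ z ] Y → Y ~[ z′ ] Z → X ~[ z ℤ.+ z′ ] Z
  ~-trans {Z = Z} (conj A vA V⇔ W⇔) (conj B vB V⇔′ W⇔′) =
    conj (B ∙₂ A) (≡.trans (v-cong (det-∙₂ B A)) (v-*⁼ vA vB))
      (λ x y z → mk⇔
        (λ s → V-resp Z (eq₁ x y) (eq₂ x y) refl (to (V⇔′ _ _ z) (to (V⇔ x y z) s)))
        (λ s → from (V⇔ x y z) (from (V⇔′ _ _ z) (V-resp Z (sym (eq₁ x y)) (sym (eq₂ x y)) refl s))))
      (λ x y → mk⇔
        (λ s → W-resp Z (eq₁ x y) (eq₂ x y) (to (W⇔′ _ _) (to (W⇔ x y) s)))
        (λ s → from (W⇔ x y) (from (W⇔′ _ _) (W-resp Z (sym (eq₁ x y)) (sym (eq₂ x y)) s))))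
    where
    eq₁ = row-∙ (a₁₁ B) (a₁₂ B) A
    eq₂ = row-∙ (a₂₁ B) (a₂₂ B) A

  ~-cast : ∀ {z z′} → z ≡ z′ → X ~[ z ] Y → X ~[ z′ ] Y
  ~-cast ≡.refl s = s

  -- The lattice generated by ϖ^s₁ e₁, ϖ^s₂ e₂ and ϖ^s (α, β, 1), together with the one generated by
  -- ϖ^e e₁ and ϖ^r e₂. The exponents s₁ and s₂ are kept apart from s for the intermediate shape
  -- with s₁ = s₂ = 0 and for `rep₀`, where s₁ = k + s.
  std : (s s₁ s₂ : ℤ) (α β : Carrier) (e r : ℤ) → Pair 0ℓ
  std s s₁ s₂ α β e r = record
    { inV    = λ x y z → s ≼ z × s₁ ≼ x - α * z × s₂ ≼ y - β * z
    ; inW    = λ x y → e ≼ x × r ≼ y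
    ; V-resp = λ x≈ y≈ z≈ (p , p₁ , p₂) → ≼-resp z≈ p
        , ≼-resp (+-cong x≈ (-‿cong (*-congˡ z≈))) p₁ , ≼-resp (+-cong y≈ (-‿cong (*-congˡ z≈))) p₂
    ; W-resp = λ x≈ y≈ (p₁ , p₂) → ≼-resp x≈ p₁ , ≼-resp y≈ p₂
    }

  -- The new parameters are prescribed up to ≈, so that they can be taken to be literal powers of ϖ.
  std-scale : ∀ {s s₁ s₂ α β e r k l t u α′ β′} → v t ≡ [ k ] → v u ≡ [ l ] →
    t * α ≈ α′ → u * β ≈ β′ →
    std s s₁ s₂ α β e r ~[ k ℤ.+ l ] std s (k ℤ.+ s₁) (l ℤ.+ s₂) α′ β′ (k ℤ.+ e) (l ℤ.+ r)
  std-scale {α = α} {β} {t = t} {u} {α′} {β′} vt vu tα uβ = conj (mat t 0# 0# u)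
    (≡.trans (v-cong (solve 2 (λ t u → t :* u :- con (+ 0) :* con (+ 0) := t :* u) refl t u))
             (v-*⁼ vt vu))
    (λ x y z → mk⇔
      (λ (p , p₁ , p₂) → p , ≼-resp (eqV₁ x y z) (≼-scale vt p₁) , ≼-resp (eqV₂ x y z) (≼-scale vu p₂))
      (λ (p , p₁ , p₂) → p , ≼-unscale vt (≼-resp (sym (eqV₁ x y z)) p₁)
                           , ≼-unscale vu (≼-resp (sym (eqV₂ x y z)) p₂)))
    (λ x y → mk⇔
      (λ (p₁ , p₂) → ≼-resp (eqW₁ x y) (≼-scale vt p₁) , ≼-resp (eqW₂ x y) (≼-scale vu p₂))
      (λ (p₁ , p₂) → ≼-unscale vt (≼-resp (sym (eqW₁ x y)) p₁)
                   , ≼-unscale vu (≼-resp (sym (eqW₂ x y)) p₂)))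
    where
    eqW₁ : ∀ x y → t * x ≈ t * x + 0# * y
    eqW₁ x y = solve 3 (λ t x y → t :* x := t :* x :+ con (+ 0) :* y) refl t x y
    eqW₂ : ∀ x y → u * y ≈ 0# * x + u * y
    eqW₂ x y = solve 3 (λ u x y → u :* y := con (+ 0) :* x :+ u :* y) refl u x y
    eqV₁ : ∀ x y z → t * (x - α * z) ≈ (t * x + 0# * y) - α′ * z
    eqV₁ x y z = trans (solve 5 (λ t x y α z → t :* (x :- α :* z)
        := (t :* x :+ con (+ 0) :* y) :- (t :* α) :* z) refl t x y α z)
      (+-congˡ (-‿cong (*-congʳ tα)))
    eqV₂ : ∀ x y z → u * (y - β * z) ≈ (0# * x + u * y) - β′ * z
    eqV₂ x y z = trans (solve 5 (λ u x y β z → u :* (y :- β :* z)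
        := (con (+ 0) :* x :+ u :* y) :- (u :* β) :* z) refl u x y β z)
      (+-congˡ (-‿cong (*-congʳ uβ)))

  -- For z in ϖ^s 𝒪 the points z (α, β) and z (α′, β′) agree modulo ϖ^s 𝒪², so the two pairs are
  -- already equal as sets.
  std-shift : ∀ {s α β e r α′ β′} → 𝒪 (α - α′) → 𝒪 (β - β′) →
    std s s s α β e r ~[ + 0 ] std s s s α′ β′ e r
  std-shift {s} dα dβ = ≐⇒~
    (λ x y z → mk⇔ (λ (p , p₁ , p₂) → p , move dα p p₁ , move dβ p p₂)
                   (λ (p , p₁ , p₂) → p , move (flip dα) p p₁ , move (flip dβ) p p₂))
    (λ x y → mk⇔ (λ p → p) (λ p → p))
    where
    flip : ∀ {α α′} → 𝒪 (α - α′) → 𝒪 (α′ - α)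
    flip p = ≼-resp (solve 2 (λ α α′ → :- (α :- α′) := α′ :- α) refl _ _) (≼-neg p)
    move : ∀ {α α′ x z} → 𝒪 (α - α′) → s ≼ z → s ≼ x - α * z → s ≼ x - α′ * z
    move d pz px = ≼-resp
      (solve 4 (λ α α′ x z → (x :- α :* z) :+ (α :- α′) :* z := x :- α′ :* z) refl _ _ _ _)
      (≼-+ px (𝒪-* d pz))

  shearʸ : ∀ {s α β e r t} → 𝒪 t → r ℤ.≤ e →
    std s s s α β e r ~[ + 0 ] std s s s α (β - t * α) e r
  shearʸ {s} {α} {β} {e} {r} {t} 𝒪t r≤e = conj (mat 1# 0# (- t) 1#)
    (≡.trans (v-cong (solve 1 (λ t → con (+ 1) :* con (+ 1) :- con (+ 0) :* (:- t) := con (+ 1)) refl t)) v-1)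
    (λ x y z → mk⇔
      (λ (p , p₁ , p₂) → p , ≼-resp (sym (eqV₁ x y z)) p₁
                           , ≼-resp (sym (eqV₂ x y z)) (≼-- p₂ (𝒪-* 𝒪t p₁)))
      (λ (p , p₁ , p₂) → let p₁′ = ≼-resp (eqV₁ x y z) p₁ in
        p , p₁′ , ≼-resp (add-back _ _) (≼-+ (≼-resp (eqV₂ x y z) p₂) (𝒪-* 𝒪t p₁′))))
    (λ x y → mk⇔
      (λ (p₁ , p₂) → ≼-resp (sym (eqW₁ x y)) p₁
                   , ≼-resp (sym (eqW₂ x y)) (≼-- p₂ (𝒪-* 𝒪t (≼-weaken r≤e p₁))))
      (λ (p₁ , p₂) → let p₁′ = ≼-resp (eqW₁ x y) p₁ in
        p₁′ , ≼-resp (add-back _ _) (≼-+ (≼-resp (eqW₂ x y) p₂) (𝒪-* 𝒪t (≼-weaken r≤e p₁′)))))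
    where
    add-back : ∀ y w → (y - w) + w ≈ y
    add-back = solve 2 (λ y w → (y :- w) :+ w := y) refl
    eqW₁ : ∀ x y → 1# * x + 0# * y ≈ x
    eqW₁ = row₁-I₂
    eqW₂ : ∀ x y → (- t) * x + 1# * y ≈ y - t * x
    eqW₂ x y = solve 3 (λ t x y → (:- t) :* x :+ con (+ 1) :* y := y :- t :* x) refl t x y
    eqV₁ : ∀ x y z → (1# * x + 0# * y) - α * z ≈ x - α * z
    eqV₁ x y z = +-congʳ (eqW₁ x y)
    eqV₂ : ∀ x y z → ((- t) * x + 1# * y) - (β - t * α) * z ≈ (y - β * z) - t * (x - α * z)
    eqV₂ x y z = solve 6 (λ t x y z α β → ((:- t) :* x :+ con (+ 1) :* y) :- (β :- t :* α) :* z
      := (y :- β :* z) :- t :* (x :- α :* z)) refl t x y z α β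

  -- The shear moves ϖ^r e₂ by -t ϖ^r e₁, which stays in the lattice of W as soon as v t ≥ d,
  -- whereas in `shearʸ` integrality of t is enough. Here d is any integer, so 𝒪 t is a separate
  -- condition.
  shearˣ : ∀ {s α β r d t} → 𝒪 t → d ≼ t →
    std s s s α β (d ℤ.+ r) r ~[ + 0 ] std s s s (α - t * β) β (d ℤ.+ r) r
  shearˣ {s} {α} {β} {r} {d} {t} 𝒪t d≼t = conj (mat 1# (- t) 0# 1#)
    (≡.trans (v-cong (solve 1 (λ t → con (+ 1) :* con (+ 1) :- (:- t) :* con (+ 0) := con (+ 1)) refl t)) v-1)
    (λ x y z → mk⇔
      (λ (p , p₁ , p₂) → p , ≼-resp (sym (eqV₁ x y z)) (≼-- p₁ (𝒪-* 𝒪t p₂))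
                           , ≼-resp (sym (eqV₂ x y z)) p₂)
      (λ (p , p₁ , p₂) → let p₂′ = ≼-resp (eqV₂ x y z) p₂ in
        p , ≼-resp (add-back _ _) (≼-+ (≼-resp (eqV₁ x y z) p₁) (𝒪-* 𝒪t p₂′)) , p₂′))
    (λ x y → mk⇔
      (λ (p₁ , p₂) → ≼-resp (sym (eqW₁ x y)) (≼-- p₁ (≼-* d≼t p₂))
                   , ≼-resp (sym (eqW₂ x y)) p₂)
      (λ (p₁ , p₂) → let p₂′ = ≼-resp (eqW₂ x y) p₂ in
        ≼-resp (add-back _ _) (≼-+ (≼-resp (eqW₁ x y) p₁) (≼-* d≼t p₂′)) , p₂′))
    where
    add-back : ∀ y w → (y - w) + w ≈ y
    add-back = solve 2 (λ y w → (y :- w) :+ w := y) refl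
    eqW₂ : ∀ x y → 0# * x + 1# * y ≈ y
    eqW₂ = row₂-I₂
    eqW₁ : ∀ x y → 1# * x + (- t) * y ≈ x - t * y
    eqW₁ x y = solve 3 (λ t x y → con (+ 1) :* x :+ (:- t) :* y := x :- t :* y) refl t x y
    eqV₂ : ∀ x y z → (0# * x + 1# * y) - β * z ≈ y - β * z
    eqV₂ x y z = +-congʳ (eqW₂ x y)
    eqV₁ : ∀ x y z → (1# * x + (- t) * y) - (α - t * β) * z ≈ (x - α * z) - t * (y - β * z)
    eqV₁ x y z = solve 6 (λ t x y z α β → (con (+ 1) :* x :+ (:- t) :* y) :- (α :- t :* β) :* z
      := (x :- α :* z) :- t :* (y :- β :* z)) refl t x y z α β

  -- rep ⟪ s , r , d , m , n ⟫ in coordinates.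
  Q[_,_,_,_,_] : (s r : ℤ) (d m n : ℕ) → Pair 0ℓ
  Q[ s , r , d , m , n ] = std s s s (ϖ^ (ℤ.- + m)) (ϖ^ (ℤ.- + n)) (+ d ℤ.+ r) r

  private
    -- For t = ϖ^a / ϖ^b the difference ϖ^a - t ϖ^b vanishes; it is compared with
    -- 1#, the power ϖ^0 that a killed exponent leaves in the matrix.
    ratio : ∀ a b → Σ[ t ∈ Carrier ] v t ≡ [ a ℤ.- b ] × 𝒪 ((ϖ^ a - t * ϖ^ b) - 1#)
    ratio a b = ϖ^ a * β⁻¹ , v-*⁼ (v-^ a) (v-inverse (v-^ b) ββ⁻¹)
              , ≼-resp (sym α-tβ-1) (≼-neg 𝒪-1)
      where
      β = ϖ^ b
      β⁻¹ = proj₁ (inverse β (ϖ^≉0 b))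
      ββ⁻¹ : β * β⁻¹ ≈ 1#
      ββ⁻¹ = proj₂ (inverse β (ϖ^≉0 b))
      open ≈-Reasoning setoid
      α-tβ-1 : (ϖ^ a - ϖ^ a * β⁻¹ * β) - 1# ≈ - 1#
      α-tβ-1 = begin
        (ϖ^ a - ϖ^ a * β⁻¹ * β) - 1#   ≈⟨ solve 3 (λ α β β⁻¹ → (α :- α :* β⁻¹ :* β) :- con (+ 1)
                                            := α :* (con (+ 1) :- β :* β⁻¹) :- con (+ 1)) refl (ϖ^ a) β β⁻¹ ⟩
        ϖ^ a * (1# - β * β⁻¹) - 1#     ≈⟨ +-congʳ (*-congˡ (+-congˡ (-‿cong ββ⁻¹))) ⟩
        ϖ^ a * (1# - 1#) - 1#          ≈⟨ solve 1 (λ α → α :* (con (+ 1) :- con (+ 1)) :- con (+ 1)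
                                            := :- con (+ 1)) refl (ϖ^ a) ⟩
        - 1# ∎

    𝒪-x-x : ∀ x → 𝒪 (x - x)
    𝒪-x-x x = ≼-resp (sym (-‿inverseʳ x)) ≼-0

    ≤⇒≤-exp : ∀ {m n d} → m ℕ.+ d ℕ.≤ n → + d ℤ.≤ ℤ.- + m ℤ.- (ℤ.- + n)
    ≤⇒≤-exp {m} {n} {d} m+d≤n = ≡.subst₂ ℤ._≤_ left right
        (ℤₚ.+-monoʳ-≤ (ℤ.- + m) (ℤ.+≤+ m+d≤n))
      where
      left : ℤ.- + m ℤ.+ (+ m ℤ.+ + d) ≡ + d
      left = ≡.trans (≡.sym (ℤₚ.+-assoc (ℤ.- + m) (+ m) (+ d)))
        (≡.trans (≡.cong (λ t → t ℤ.+ + d) (ℤₚ.+-inverseˡ (+ m))) (ℤₚ.+-identityˡ (+ d)))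
      right : ℤ.- + m ℤ.+ + n ≡ ℤ.- + m ℤ.- (ℤ.- + n)
      right = ≡.cong (λ t → ℤ.- + m ℤ.+ t) (≡.sym (ℤₚ.neg-involutive (+ n)))

  -- With t = ϖ^(n - m), up to ≈, the shear x - t y clears the entry ϖ^(-m) exactly; the hypothesis
  -- says that v t = n - m is at least d.
  ~-kill-m : ∀ {s r d m n} → m ℕ.+ d ℕ.≤ n →
    Q[ s , r , d , m , n ] ~[ + 0 ] Q[ s , r , d , 0 , n ]
  ~-kill-m {d = d} {m} {n} m+d≤n with ratio (ℤ.- + m) (ℤ.- + n)
  ... | t , vt , small = ~-trans (shearˣ (≼-weaken (ℤ.+≤+ ℕ.z≤n) d≼t) d≼t) (std-shift small (𝒪-x-x _))
    where
    d≼t : + d ≼ t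
    d≼t = ≼-weaken (≤⇒≤-exp m+d≤n) (≡⇒≼ vt)

  ~-kill-n : ∀ {s r d m n} → n ℕ.≤ m →
    Q[ s , r , d , m , n ] ~[ + 0 ] Q[ s , r , d , m , 0 ]
  ~-kill-n {r = r} {d} {m} {n} n≤m with ratio (ℤ.- + n) (ℤ.- + m)
  ... | t , vt , small = ~-trans (shearʸ 𝒪t r≤d+r) (std-shift (𝒪-x-x _) small)
    where
    𝒪t : 𝒪 t
    -- The exponent bound at d = 0, for t of valuation m - n.
    𝒪t = ≼-weaken (≤⇒≤-exp (≡.subst (ℕ._≤ m) (≡.sym (ℕₚ.+-identityʳ n)) n≤m)) (≡⇒≼ vt)
    r≤d+r : r ℤ.≤ + d ℤ.+ r
    r≤d+r = ≡.subst (ℤ._≤ + d ℤ.+ r) (ℤₚ.+-identityˡ r) (ℤₚ.+-monoˡ-≤ r (ℤ.+≤+ ℕ.z≤n))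

-- Invariants of the standard pairs.

module Invariants {c ℓ f ℓf} (K : CompletedField c ℓ f ℓf) where
  open CompletedField K hiding (zero)
  open IntegerSolver k₀
  open Valuation K
  open Conjugacy K
  open Matrix₂
  open _~[_]_
  open Equivalence using (to; from)
  private module ℤS = ℤSolver.+-*-Solver

  ≼-shift : ∀ k {a x} → k ℤ.+ a ≼ x ⇔ a ≼ ϖ^ (ℤ.- k) * x
  ≼-shift k {a} {x} = mk⇔
    (λ p → ≡.subst (_≼ ϖ^ (ℤ.- k) * x) (-k+[k+a]≡a k a) (≼-scale (v-^ (ℤ.- k)) p))
    (λ p → ≼-unscale (v-^ (ℤ.- k)) (≡.subst (_≼ ϖ^ (ℤ.- k) * x) (≡.sym (-k+[k+a]≡a k a)) p))

  row-* : ∀ a b t x y → t * (a * x + b * y) ≈ a * (t * x) + b * (t * y)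
  row-* = solve 5 (λ a b t x y → t :* (a :* x :+ b :* y) := a :* (t :* x) :+ b :* (t :* y)) refl

  -- By linearity, carrying one lattice of W to another carries their multiples by ϖ^k to each other
  -- as well.
  W⇔-scaled : ∀ {s s₁ s₂ α β e r s′ s₁′ s₂′ α′ β′ e′ r′ z}
    (g : std s s₁ s₂ α β e r ~[ z ] std s′ s₁′ s₂′ α′ β′ e′ r′) k x y →
    (k ℤ.+ e ≼ x × k ℤ.+ r ≼ y)
      → (k ℤ.+ e′ ≼ row₁ (A g) x y × k ℤ.+ r′ ≼ row₂ (A g) x y)
  W⇔-scaled g k x y (p , q) =
    let p′ , q′ = to (W⇔ g _ _) (to (≼-shift k) p , to (≼-shift k) q)
    in from (≼-shift k) (≼-resp (sym (row-* _ _ _ _ _)) p′)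
     , from (≼-shift k) (≼-resp (sym (row-* _ _ _ _ _)) q′)

  preimage : ∀ {p q} {X : Pair p} {Y : Pair q} {z} (g : X ~[ z ] Y) x y →
    ∃[ x′ ] ∃[ y′ ] row₁ (A g) x′ y′ ≈ x × row₂ (A g) x′ y′ ≈ y
  preimage g x y = _ , _ , row₁-inverse x y , row₂-inverse x y
    where
    D⁻¹ = inverse (det₂ (A g)) (v-≢⊤ (v-det g))
    open Inverse₂ (A g) (proj₁ D⁻¹) (proj₂ D⁻¹)

  ϖ^-mem : ∀ {s s₁ s₂ α β} → s ≼ ϖ^ s × s₁ ≼ α * ϖ^ s - α * ϖ^ s × s₂ ≼ β * ϖ^ s - β * ϖ^ s
  ϖ^-mem {s} = ≡⇒≼ (v-^ s) , x-x , x-x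
    where
    x-x : ∀ {a x} → a ≼ x - x
    x-x {x = x} = ≼-resp (sym (-‿inverseʳ x)) ≼-0

  -- The least valuation of the third coordinate on the first lattice is s, attained at ϖ^s (α, β,
  -- 1), and H does not touch that coordinate.
  s-mono : ∀ {s s₁ s₂ α β e r s′ s₁′ s₂′ α′ β′ e′ r′ z} →
    std s s₁ s₂ α β e r ~[ z ] std s′ s₁′ s₂′ α′ β′ e′ r′ → s′ ℤ.≤ s
  s-mono {s} {s₁} {s₂} {α} {β} g =
    ≼⇒≤ (v-^ s) (proj₁ (to (V⇔ g (α * ϖ^ s) (β * ϖ^ s) (ϖ^ s)) (ϖ^-mem {s₁ = s₁} {s₂})))

  -- As V⇔ fixes z, the intersection of the lattices with the plane z = 0, that
  -- is ϖ^s 𝒪², is preserved; so are then its multiples.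
  module _ {s α β e r α′ β′ e′ r′ z}
           (g : std s s s α β e r ~[ z ] std s s s α′ β′ e′ r′) where

    private
      x-0 : ∀ t x → x ≈ x - t * 0#
      x-0 = solve 2 (λ t x → x := x :- t :* con (+ 0)) refl

      plane : ∀ x y → (s ≼ x × s ≼ y) ⇔ (s ≼ row₁ (A g) x y × s ≼ row₂ (A g) x y)
      plane x y = mk⇔
        (λ (p , q) → let _ , p′ , q′ = to (V⇔ g x y 0#) (≼-0 , ≼-resp (x-0 α x) p , ≼-resp (x-0 β y) q)
                     in ≼-resp (sym (x-0 α′ _)) p′ , ≼-resp (sym (x-0 β′ _)) q′)
        (λ (p , q) → let _ , p′ , q′ = from (V⇔ g x y 0#) (≼-0 , ≼-resp (x-0 α′ _) p , ≼-resp (x-0 β′ _) q)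
                     in ≼-resp (sym (x-0 α _)) p′ , ≼-resp (sym (x-0 β _)) q′)

    ball : ∀ a x y → (a ≼ x × a ≼ y) ⇔ (a ≼ row₁ (A g) x y × a ≼ row₂ (A g) x y)
    ball a x y = mk⇔
      (λ (p , q) → let p′ , q′ = to (plane _ _) (down p , down q)
                   in up (≼-resp (sym (row-* _ _ _ _ _)) p′) , up (≼-resp (sym (row-* _ _ _ _ _)) q′))
      (λ (p , q) → let p′ , q′ = from (plane _ _) (≼-resp (row-* _ _ _ _ _) (down p)
                                                   , ≼-resp (row-* _ _ _ _ _) (down q))
                   in up p′ , up q′)
      where
      k = a ℤ.- s
      k+s≡a : k ℤ.+ s ≡ a
      k+s≡a = ≡.trans (ℤₚ.+-assoc a (ℤ.- s) s)
        (≡.trans (≡.cong (λ t → a ℤ.+ t) (ℤₚ.+-inverseˡ s)) (ℤₚ.+-identityʳ a))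
      down : ∀ {x} → a ≼ x → s ≼ ϖ^ (ℤ.- k) * x
      down {x} p = to (≼-shift k) (≡.subst (_≼ x) (≡.sym k+s≡a) p)
      up : ∀ {x} → s ≼ ϖ^ (ℤ.- k) * x → a ≼ x
      up {x} p = ≡.subst (_≼ x) k+s≡a (from (≼-shift k) p)

    -- `ball` at exponent 0 says that the matrix preserves 𝒪², so its columns, the images of the
    -- unit vectors, are integral.
    0≤v-det : + 0 ℤ.≤ z
    0≤v-det = ≼⇒≤ (v-det g) (≼-- (𝒪-* (proj₁ col₁) (proj₂ col₂)) (𝒪-* (proj₁ col₂) (proj₂ col₁)))
      where
      col₁ : 𝒪 (a₁₁ (A g)) × 𝒪 (a₂₁ (A g))
      col₁ = let p , q = to (ball (+ 0) 1# 0#) (𝒪-1 , ≼-0) in ≼-resp (eq _ _) p , ≼-resp (eq _ _) q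
        where
        eq : ∀ a b → a * 1# + b * 0# ≈ a
        eq = solve 2 (λ a b → a :* con (+ 1) :+ b :* con (+ 0) := a) refl
      col₂ : 𝒪 (a₁₂ (A g)) × 𝒪 (a₂₂ (A g))
      col₂ = let p , q = to (ball (+ 0) 0# 1#) (≼-0 , 𝒪-1) in ≼-resp (eq _ _) p , ≼-resp (eq _ _) q
        where
        eq : ∀ a b → a * 0# + b * 1# ≈ b
        eq = solve 2 (λ a b → a :* con (+ 0) :+ b :* con (+ 1) := b) refl

    -- For r′ ≤ e′ the second lattice of W lies in ϖ^r′ 𝒪², and `ball` transports this inclusion
    -- back to the first one, which contains ϖ^r e₂.
    r-mono : r′ ℤ.≤ e′ → r′ ℤ.≤ r
    r-mono r′≤e′ = let p , q = to (W⇔ g 0# (ϖ^ r)) (≼-0 , ≡⇒≼ (v-^ r)) in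
      ≼⇒≤ (v-^ r) (proj₂ (from (ball r′ _ _) (≼-weaken r′≤e′ p , q)))

    -- Dual to `r-mono`: for r ≤ e the lattice of W contains ϖ^e 𝒪², hence its image contains ϖ^e 𝒪²
    -- too, and with it ϖ^e e₁.
    e-mono : r ℤ.≤ e → e′ ℤ.≤ e
    e-mono r≤e = let x , y , x≈ , y≈ = preimage g (ϖ^ e) 0#
                     p , q = from (ball e x y) (≼-resp (sym x≈) (≡⇒≼ (v-^ e)) , ≼-resp (sym y≈) ≼-0)
                 in ≼⇒≤ (v-^ e) (≼-resp x≈ (proj₁ (to (W⇔ g x y) (p , ≼-weaken r≤e q))))

  -- The vector (ϖ^(s-m), ϖ^(s-n), ϖ^s) of the first lattice is sent to one
  -- congruent to (ϖ^(s-m′), ϖ^(s-n′), ϖ^s) modulo ϖ^s.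
  module _ s r d m n r′ d′ m′ n′ {z}
           (g : Q[ s , r , d , m , n ] ~[ z ] Q[ s , r′ , d′ , m′ , n′ ]) where
    private
      x₀ = ϖ^ (ℤ.- + m) * ϖ^ s
      y₀ = ϖ^ (ℤ.- + n) * ϖ^ s

      v-ϖ^ϖ^ : ∀ k → v (ϖ^ (ℤ.- + k) * ϖ^ s) ≡ [ ℤ.- + k ℤ.+ s ]
      v-ϖ^ϖ^ k = v-*⁼ (v-^ (ℤ.- + k)) (v-^ s)

      exp-≤ : ∀ {i j} → i ℕ.≤ j → ℤ.- + j ℤ.+ s ℤ.≤ ℤ.- + i ℤ.+ s
      exp-≤ i≤j = ℤₚ.+-monoˡ-≤ s (ℤₚ.neg-mono-≤ (ℤ.+≤+ i≤j))

      exp-≤⁻ : ∀ {i j} → ℤ.- + j ℤ.+ s ℤ.≤ ℤ.- + i ℤ.+ s → i ℕ.≤ j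
      exp-≤⁻ {i} {j} p = ℤₚ.drop‿+≤+ (ℤₚ.neg-cancel-≤ {+ j} {+ i} (≡.subst₂ ℤ._≤_ (eq j) (eq i)
          (ℤₚ.+-monoˡ-≤ (ℤ.- s) p)))
        where
        eq : ∀ k → ℤ.- + k ℤ.+ s ℤ.- s ≡ ℤ.- + k
        eq k = ≡.trans (ℤₚ.+-assoc (ℤ.- + k) s (ℤ.- s))
          (≡.trans (≡.cong (λ t → ℤ.- + k ℤ.+ t) (ℤₚ.+-inverseʳ s)) (ℤₚ.+-identityʳ _))

      bound : ∀ {i j x} → ℤ.- + j ℤ.+ s ≼ x → s ≼ x - ϖ^ (ℤ.- + i) * ϖ^ s → i ℕ.≤ j
      bound {i} {j} {x} p q = exp-≤⁻ (≼⇒≤ (v-ϖ^ϖ^ i) (≼-resp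
        (solve 2 (λ x y → x :- (x :- y) := y) refl x _)
        -- Since j ≥ 0, an error in ϖ^s 𝒪 also lies in ϖ^(s-j) 𝒪, so x and ϖ^(s-i) can be exchanged
        -- in the bound.
        (≼-- p (≼-weaken (≡.subst (ℤ.- + j ℤ.+ s ℤ.≤_) (ℤₚ.+-identityˡ s) (exp-≤ {0} {j} ℕ.z≤n)) q))))

      image : s ≼ row₁ (A g) x₀ y₀ - ϖ^ (ℤ.- + m′) * ϖ^ s
            × s ≼ row₂ (A g) x₀ y₀ - ϖ^ (ℤ.- + n′) * ϖ^ s
      image = proj₂ (to (V⇔ g x₀ y₀ (ϖ^ s)) ϖ^-mem)

    -- That m and n are at most j means that (ϖ^(s-m), ϖ^(s-n)) lies in ϖ^(s-j) 𝒪², a condition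
    -- preserved by `ball`; the congruence modulo ϖ^s then transfers it to m′ and n′.
    I₁-mono : ∀ j → m ℕ.≤ j → n ℕ.≤ j → m′ ℕ.≤ j × n′ ℕ.≤ j
    I₁-mono j m≤j n≤j =
      let p , q = to (ball g (ℤ.- + j ℤ.+ s) x₀ y₀)
                    (≼-weaken (exp-≤ m≤j) (≡⇒≼ (v-ϖ^ϖ^ m)) , ≼-weaken (exp-≤ n≤j) (≡⇒≼ (v-ϖ^ϖ^ n)))
      in bound p (proj₁ image) , bound q (proj₂ image)

    -- The argument of `I₁-mono` with a multiple of the lattice of W in place of the ball:
    -- membership now reads m ≤ j and n ≤ j + d, that is max(m, n - d) ≤ j.
    I₂-mono : r′ ≡ r → d′ ≡ d → ∀ j → m ℕ.≤ j → n ℕ.≤ j ℕ.+ d → m′ ℕ.≤ j × n′ ℕ.≤ j ℕ.+ d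
    I₂-mono ≡.refl ≡.refl j m≤j n≤j+d =
      let p , q = W⇔-scaled g k x₀ y₀
                    ( ≡.subst (_≼ x₀) (≡.sym k+e) (≼-weaken (exp-≤ m≤j) (≡⇒≼ (v-ϖ^ϖ^ m)))
                    , ≡.subst (_≼ y₀) (≡.sym k+r) (≼-weaken (exp-≤ n≤j+d) (≡⇒≼ (v-ϖ^ϖ^ n))))
      in bound (≡.subst (_≼ row₁ (A g) x₀ y₀) k+e p) (proj₁ image)
       , bound (≡.subst (_≼ row₂ (A g) x₀ y₀) k+r q) (proj₂ image)
      where
      -- Chosen so that ϖ^k times the lattice of W is ϖ^(s-j) 𝒪 ⊕ ϖ^(s-j-d) 𝒪.
      k = ℤ.- + j ℤ.+ s ℤ.- (+ d ℤ.+ r)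
      k+e : k ℤ.+ (+ d ℤ.+ r) ≡ ℤ.- + j ℤ.+ s
      k+e = ℤS.solve 4 (λ j s d r → (ℤS.:- j ℤS.:+ s ℤS.:- (d ℤS.:+ r)) ℤS.:+ (d ℤS.:+ r)
                          ℤS.:= ℤS.:- j ℤS.:+ s) ≡.refl (+ j) s (+ d) r
      k+r : k ℤ.+ r ≡ ℤ.- + (j ℕ.+ d) ℤ.+ s
      k+r = ℤS.solve 4 (λ j s d r → (ℤS.:- j ℤS.:+ s ℤS.:- (d ℤS.:+ r)) ℤS.:+ r
                          ℤS.:= ℤS.:- (j ℤS.:+ d) ℤS.:+ s) ≡.refl (+ j) s (+ d) r

  record SameInvariants (s r : ℤ) (d m n : ℕ) (s′ r′ : ℤ) (d′ m′ n′ : ℕ) : Set where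
    field
      s≡  : s ≡ s′
      r≡  : r ≡ r′
      d≡  : d ≡ d′
      I₁≡ : m ℕ.⊔ n ≡ m′ ℕ.⊔ n′
      I₂≡ : m ℕ.⊔ (n ∸ d) ≡ m′ ℕ.⊔ (n′ ∸ d′)

  private
    r≤d+r : ∀ d r → r ℤ.≤ + d ℤ.+ r
    r≤d+r d r = ≡.subst (ℤ._≤ + d ℤ.+ r) (ℤₚ.+-identityˡ r) (ℤₚ.+-monoˡ-≤ r (ℤ.+≤+ ℕ.z≤n))

    d-mono : ∀ d d′ r → + d ℤ.+ r ℤ.≤ + d′ ℤ.+ r → d ℕ.≤ d′
    d-mono d d′ r p = ℤₚ.drop‿+≤+ (≡.subst₂ ℤ._≤_ (eq d) (eq d′) (ℤₚ.+-monoˡ-≤ (ℤ.- r) p))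
      where
      eq : ∀ d → + d ℤ.+ r ℤ.- r ≡ + d
      eq d = ℤS.solve 2 (λ d r → d ℤS.:+ r ℤS.:- r ℤS.:= d) ≡.refl (+ d) r

    I₁-≤ : ∀ s r d m n r′ d′ m′ n′ {z} → Q[ s , r , d , m , n ] ~[ z ] Q[ s , r′ , d′ , m′ , n′ ] →
           m′ ℕ.⊔ n′ ℕ.≤ m ℕ.⊔ n
    I₁-≤ s r d m n r′ d′ m′ n′ g =
      let p , q = I₁-mono s r d m n r′ d′ m′ n′ g (m ℕ.⊔ n) (ℕₚ.m≤m⊔n m n) (ℕₚ.m≤n⊔m m n)
      in ℕₚ.⊔-lub p q

    I₂-≤ : ∀ s r d m n m′ n′ {z} → Q[ s , r , d , m , n ] ~[ z ] Q[ s , r , d , m′ , n′ ] →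
           m′ ℕ.⊔ (n′ ∸ d) ℕ.≤ m ℕ.⊔ (n ∸ d)
    I₂-≤ s r d m n m′ n′ g =
      let p , q = I₂-mono s r d m n r d m′ n′ g ≡.refl ≡.refl j (ℕₚ.m≤m⊔n m (n ∸ d)) n≤j+d
      in ℕₚ.⊔-lub p (≡.subst (n′ ∸ d ℕ.≤_) (ℕₚ.m+n∸n≡m j d) (ℕₚ.∸-monoˡ-≤ d q))
      where
      j = m ℕ.⊔ (n ∸ d)
      n≤j+d : n ℕ.≤ j ℕ.+ d
      n≤j+d = ℕₚ.≤-trans (ℕₚ.m≤n+m∸n n d)
        (ℕₚ.≤-trans (ℕₚ.+-monoʳ-≤ d (ℕₚ.m≤n⊔m m (n ∸ d))) (ℕₚ.≤-reflexive (ℕₚ.+-comm d j)))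

  -- The equalities are established in the order s, r, d because each makes the next comparison
  -- meaningful: `ball` compares pairs with equal s, the bounds from `e-mono` become bounds on d
  -- once r agrees, and `I₂-mono` compares multiples of one and the same lattice of W.
  ~⇒SameInvariants : ∀ s r d m n s′ r′ d′ m′ n′ {z} →
    Q[ s , r , d , m , n ] ~[ z ] Q[ s′ , r′ , d′ , m′ , n′ ] →
    SameInvariants s r d m n s′ r′ d′ m′ n′
  ~⇒SameInvariants s r d m n s′ r′ d′ m′ n′ g =
    case-s (ℤₚ.≤-antisym (s-mono g) (s-mono (~-sym g))) g
    where
    case-d : ∀ {d′ z} → d′ ≡ d → Q[ s , r , d , m , n ] ~[ z ] Q[ s , r , d′ , m′ , n′ ] →
             SameInvariants s r d m n s r d′ m′ n′
    case-d ≡.refl g = record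
      { s≡  = ≡.refl
      ; r≡  = ≡.refl
      ; d≡  = ≡.refl
      ; I₁≡ = ℕₚ.≤-antisym (I₁-≤ s r d m′ n′ r d m n (~-sym g)) (I₁-≤ s r d m n r d m′ n′ g)
      ; I₂≡ = ℕₚ.≤-antisym (I₂-≤ s r d m′ n′ m n (~-sym g)) (I₂-≤ s r d m n m′ n′ g)
      }
    case-r : ∀ {r′ z} → r′ ≡ r → Q[ s , r , d , m , n ] ~[ z ] Q[ s , r′ , d′ , m′ , n′ ] →
             SameInvariants s r d m n s r′ d′ m′ n′
    case-r ≡.refl g = case-d (ℕₚ.≤-antisym (d-mono d′ d r (e-mono g (r≤d+r d r)))
                                           (d-mono d d′ r (e-mono (~-sym g) (r≤d+r d′ r)))) g
    case-s : ∀ {s′ z} → s′ ≡ s → Q[ s , r , d , m , n ] ~[ z ] Q[ s′ , r′ , d′ , m′ , n′ ] →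
             SameInvariants s r d m n s′ r′ d′ m′ n′
    case-s ≡.refl g = case-r (ℤₚ.≤-antisym (r-mono g (r≤d+r d′ r′)) (r-mono (~-sym g) (r≤d+r d r))) g

  -- The determinant of a stabilizing matrix is integral, and so is that of the inverse matrix.
  self-conj⇒0 : ∀ {s α β e r z} → std s s s α β e r ~[ z ] std s s s α β e r → z ≡ + 0
  self-conj⇒0 {z = z} g = ℤₚ.≤-antisym
    (≡.subst (ℤ._≤ + 0) (ℤₚ.neg-involutive z) (ℤₚ.neg-mono-≤ (0≤v-det (~-sym g)))) (0≤v-det g)

-- From generators to integrality conditions.

module Reduction {c ℓ f ℓf} (K : CompletedField c ℓ f ℓf) where
  open CompletedField K hiding (zero)
  open IntegerSolver k₀
  open Valuation K
  open Elimination K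
  open Conjugacy K
  open Matrix₂
  open Pair
  open Equivalence using (to; from)
  private module ℤS = ℤSolver.+-*-Solver

  private
    variable
      p q : Level
      X Y : Pair p

  infix 4 _~_

  _~_ : Pair p → Pair q → Set _
  X ~ Y = ∃[ z ] X ~[ z ] Y

  ~-via : ∀ A → ¬ det₂ A ≈ 0# →
    (∀ x y z → inV X x y z ⇔ inV Y (row₁ A x y) (row₂ A x y) z) →
    (∀ x y → inW X x y ⇔ inW Y (row₁ A x y) (row₂ A x y)) → X ~ Y
  ~-via A D≉0 V⇔ W⇔ = let z , vD = valuation (det₂ A) D≉0 in z , conj A vD V⇔ W⇔

  unit≉0 : ∀ {x y} → x * y ≈ 1# → ¬ x ≈ 0#
  unit≉0 xy≈1 x≈0 = 1≉0 (trans (sym xy≈1) (trans (*-congʳ x≈0) (zeroˡ _)))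

  RowSpan-resp : ∀ {N n} {G : Fin N → Fin n → Carrier} {x y : Fin n → Carrier} →
    (∀ j → x j ≈ y j) → RowSpan G x → RowSpan G y
  RowSpan-resp x≈y (a , 𝒪a , x≈) = a , 𝒪a , λ j → trans (sym (x≈y j)) (x≈ j)

  infixr 5 _,₂_

  _,₂_ : Carrier → Carrier → Fin 2 → Carrier
  x ,₂ y = x ∷ᶠ y ∷ᶠ []ᶠ

  ,₂-cong : ∀ {x x′ y y′} → x ≈ x′ → y ≈ y′ → ∀ j → (x ,₂ y) j ≈ (x′ ,₂ y′) j
  ,₂-cong x≈ y≈ zero       = x≈
  ,₂-cong x≈ y≈ (suc zero) = y≈

  ,₃-cong : ∀ {x x′ y y′ z z′} → x ≈ x′ → y ≈ y′ → z ≈ z′ →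
    ∀ j → (x ∷ᶠ (y ,₂ z)) j ≈ (x′ ∷ᶠ (y′ ,₂ z′)) j
  ,₃-cong x≈ y≈ z≈ zero    = x≈
  ,₃-cong x≈ y≈ z≈ (suc j) = ,₂-cong y≈ z≈ j

  rows : ∀ {N N′} → (Fin N → Fin 3 → Carrier) → (Fin N′ → Fin 2 → Carrier) → Pair (c ⊔ ℓ)
  rows G G′ = record
    { inV    = λ x y z → RowSpan G (x ∷ᶠ (y ,₂ z))
    ; inW    = λ x y → RowSpan G′ (x ,₂ y)
    ; V-resp = λ x≈ y≈ z≈ → RowSpan-resp (,₃-cong x≈ y≈ z≈)
    ; W-resp = λ x≈ y≈ → RowSpan-resp (,₂-cong x≈ y≈)
    }

  -- Two eliminations leave two linear forms, the rows of a triangular E, and the lattice is the set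
  -- where both are integral.
  lattice₂ : ∀ {N} (G : Fin N → Fin 2 → Carrier) → Full G →
    ∃[ E ] (¬ det₂ E ≈ 0#) ×
      ∀ x → RowSpan G x ⇔ (𝒪 (row₁ E (x zero) (x (suc zero))) × 𝒪 (row₂ E (x zero) (x (suc zero))))
  lattice₂ G full with eliminate G full
  ... | τ , τ≉0 , w , full′ , G⇔ with eliminate (λ i → shear w (G i)) full′
  ...   | τ′ , τ′≉0 , _ , _ , G′⇔ = mat τ 0# (- (w zero * τ′)) τ′
      , (λ D≈0 → *≉0 τ≉0 τ′≉0 (trans (det-eq τ τ′ (w zero)) D≈0))
      , λ x → mk⇔
        (λ s → let p , s′ = to (G⇔ x) s ; p′ , _ = to (G′⇔ _) s′ in
          ≼-resp (eq₁ _ _ _) p , ≼-resp (eq₂ _ _ _ _) p′)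
        (λ (p , p′) → from (G⇔ x) (≼-resp (sym (eq₁ _ _ (x (suc zero)))) p ,
          -- No coordinate is left after the second elimination, so zero coefficients witness
          -- membership in the remaining span.
          from (G′⇔ _) (≼-resp (sym (eq₂ _ _ _ _)) p′ , (λ _ → 0#) , (λ _ → ≼-0) , λ ())))
    where
    det-eq : ∀ τ τ′ w → τ * τ′ ≈ τ * τ′ - 0# * - (w * τ′)
    det-eq = solve 3 (λ τ τ′ w → τ :* τ′ := τ :* τ′ :- con (+ 0) :* (:- (w :* τ′))) refl
    eq₁ : ∀ x τ y → x * τ ≈ τ * x + 0# * y
    eq₁ = solve 3 (λ x τ y → x :* τ := τ :* x :+ con (+ 0) :* y) refl
    eq₂ : ∀ x y w τ′ → (y - x * w) * τ′ ≈ - (w * τ′) * x + τ′ * y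
    eq₂ = solve 4 (λ x y w τ′ → (y :- x :* w) :* τ′ := (:- (w :* τ′)) :* x :+ τ′ :* y) refl

  -- The rows of E are the linear forms dual to an 𝒪-basis of the second lattice.
  half-std : ℤ → Carrier → Carrier → Matrix₂ → Pair 0ℓ
  half-std s α β E = record
    { inV    = inV P
    ; inW    = λ x y → 𝒪 (row₁ E x y) × 𝒪 (row₂ E x y)
    ; V-resp = V-resp P
    ; W-resp = λ x≈ y≈ (p , q) → ≼-resp (+-cong (*-congˡ x≈) (*-congˡ y≈)) p
                               , ≼-resp (+-cong (*-congˡ x≈) (*-congˡ y≈)) q
    }
    where P = std s (+ 0) (+ 0) α β (+ 0) (+ 0)

  -- `eliminate` removes the first coordinate. It has to be z, the one fixed by H, so that what
  -- remains is a lattice in the two coordinates on which H acts.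
  rotate : ∀ {N} → (Fin N → Fin 3 → Carrier) → Fin N → Fin 3 → Carrier
  rotate G i = G i (suc (suc zero)) ∷ᶠ (G i zero ,₂ G i (suc zero))

  rotate-full : ∀ {N} (G : Fin N → Fin 3 → Carrier) → Full G → Full (rotate G)
  rotate-full G full x = let a , x≈ = full (x (suc zero) ∷ᶠ (x (suc (suc zero)) ,₂ x zero)) in
    a , λ { zero → x≈ (suc (suc zero)) ; (suc zero) → x≈ zero ; (suc (suc zero)) → x≈ (suc zero) }

  private
    unrotate : ∀ {N} (G : Fin N → Fin 3 → Carrier) x y z →
      RowSpan G (x ∷ᶠ (y ,₂ z)) ⇔ RowSpan (rotate G) (z ∷ᶠ (x ,₂ y))
    unrotate G x y z = mk⇔
      (λ (a , 𝒪a , x≈) → a , 𝒪a , λ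
        { zero → x≈ (suc (suc zero)) ; (suc zero) → x≈ zero ; (suc (suc zero)) → x≈ (suc zero) })
      (λ (a , 𝒪a , x≈) → a , 𝒪a , λ
        { zero → x≈ (suc zero) ; (suc zero) → x≈ (suc (suc zero)) ; (suc (suc zero)) → x≈ zero })

  lattice₃ : ∀ {N} (G : Fin N → Fin 3 → Carrier) → Full G →
    ∃[ τ ] ∃[ w₁ ] ∃[ w₂ ] ∃[ B ] (¬ τ ≈ 0#) × (¬ det₂ B ≈ 0#) ×
      ∀ x y z → RowSpan G (x ∷ᶠ (y ,₂ z)) ⇔
        (𝒪 (z * τ) × 𝒪 (row₁ B (x - z * w₁) (y - z * w₂)) × 𝒪 (row₂ B (x - z * w₁) (y - z * w₂)))
  lattice₃ G full = step (eliminate (rotate G) (rotate-full G full))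
    where
    step : _ → _
    step (τ , τ≉0 , w , full′ , G⇔) = step′ (lattice₂ _ full′)
      where
      step′ : _ → _
      step′ (B , B≉0 , B⇔) = τ , w zero , w (suc zero) , B , τ≉0 , B≉0 , λ x y z → mk⇔
        (λ t → let p , t′ = to (G⇔ _) (to (unrotate G x y z) t) in p , to (B⇔ _) t′)
        (λ (p , t) → from (unrotate G x y z) (from (G⇔ _) (p , from (B⇔ _) t)))

  private
    𝒪-row-∙ : ∀ E A x y →
      (𝒪 (row₁ E (row₁ A x y) (row₂ A x y)) × 𝒪 (row₂ E (row₁ A x y) (row₂ A x y)))
      ⇔ (𝒪 (row₁ (E ∙₂ A) x y) × 𝒪 (row₂ (E ∙₂ A) x y))
    𝒪-row-∙ E A x y = mk⇔
      (λ (p , q) → ≼-resp eq₁ p , ≼-resp eq₂ q)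
      (λ (p , q) → ≼-resp (sym eq₁) p , ≼-resp (sym eq₂) q)
      where
      eq₁ = row-∙ (a₁₁ E) (a₁₂ E) A x y
      eq₂ = row-∙ (a₂₁ E) (a₂₂ E) A x y

    row-- : ∀ b₁ b₂ w₁ w₂ x y z → b₁ * (x - z * w₁) + b₂ * (y - z * w₂)
            ≈ (b₁ * x + b₂ * y) - (b₁ * w₁ + b₂ * w₂) * z
    row-- = solve 7 (λ b₁ b₂ w₁ w₂ x y z → b₁ :* (x :- z :* w₁) :+ b₂ :* (y :- z :* w₂)
      := (b₁ :* x :+ b₂ :* y) :- (b₁ :* w₁ :+ b₂ :* w₂) :* z) refl

    ≼-𝒪-* : ∀ {τ t} → v τ ≡ [ t ] → ∀ z → ℤ.- t ≼ z ⇔ 𝒪 (z * τ)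
    ≼-𝒪-* {τ} {t} vτ z = mk⇔
      (λ p → ≼-resp (*-comm τ z) (≡.subst (_≼ τ * z) (ℤₚ.+-inverseʳ t) (≼-scale vτ p)))
      (λ p → ≼-unscale vτ (≡.subst (_≼ τ * z) (≡.sym (ℤₚ.+-inverseʳ t)) (≼-resp (*-comm z τ) p)))

    -- Substituting A (x, y) for (x, y), with A a right inverse of B, turns the forms B into the
    -- coordinates themselves: Λ becomes 𝒪², the centre (w₁, w₂) becomes B (w₁, w₂), and the forms E
    -- become E A.
    half-std~ : ∀ (X : Pair p) τ w₁ w₂ B E A {t} → v τ ≡ [ t ] → ¬ det₂ A ≈ 0# →
      (∀ x y → row₁ B (row₁ A x y) (row₂ A x y) ≈ x) →
      (∀ x y → row₂ B (row₁ A x y) (row₂ A x y) ≈ y) →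
      (∀ x y z → inV X x y z ⇔
        (𝒪 (z * τ) × 𝒪 (row₁ B (x - z * w₁) (y - z * w₂)) × 𝒪 (row₂ B (x - z * w₁) (y - z * w₂)))) →
      (∀ x y → inW X x y ⇔ (𝒪 (row₁ E x y) × 𝒪 (row₂ E x y))) →
      half-std (ℤ.- t) (row₁ B w₁ w₂) (row₂ B w₁ w₂) (E ∙₂ A) ~ X
    half-std~ X τ w₁ w₂ B E A vτ A≉0 BA₁ BA₂ X⇔ E⇔ = ~-via A A≉0
      (λ x y z → mk⇔
        (λ (p , p₁ , p₂) → from (X⇔ _ _ z)
          (to (≼-𝒪-* vτ z) p , ≼-resp (sym (e₁ x y z)) p₁ , ≼-resp (sym (e₂ x y z)) p₂))
        (λ s → let p , p₁ , p₂ = to (X⇔ _ _ z) s in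
          from (≼-𝒪-* vτ z) p , ≼-resp (e₁ x y z) p₁ , ≼-resp (e₂ x y z) p₂))
      (λ x y → mk⇔
        (λ s → from (E⇔ _ _) (from (𝒪-row-∙ E A x y) s))
        (λ s → to (𝒪-row-∙ E A x y) (to (E⇔ _ _) s)))
      where
      e₁ : ∀ x y z → row₁ B (row₁ A x y - z * w₁) (row₂ A x y - z * w₂) ≈ x - row₁ B w₁ w₂ * z
      e₁ x y z = trans (row-- (a₁₁ B) (a₁₂ B) w₁ w₂ _ _ z) (+-congʳ (BA₁ x y))
      e₂ : ∀ x y z → row₂ B (row₁ A x y - z * w₁) (row₂ A x y - z * w₂) ≈ y - row₂ B w₁ w₂ * z
      e₂ x y z = trans (row-- (a₂₁ B) (a₂₂ B) w₁ w₂ _ _ z) (+-congʳ (BA₂ x y))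

  ~⇒half-std : ∀ (X : Pair p) τ w₁ w₂ B E → ¬ τ ≈ 0# → ¬ det₂ B ≈ 0# → ¬ det₂ E ≈ 0# →
    (∀ x y z → inV X x y z ⇔
      (𝒪 (z * τ) × 𝒪 (row₁ B (x - z * w₁) (y - z * w₂)) × 𝒪 (row₂ B (x - z * w₁) (y - z * w₂)))) →
    (∀ x y → inW X x y ⇔ (𝒪 (row₁ E x y) × 𝒪 (row₂ E x y))) →
    ∃[ s ] ∃[ α ] ∃[ β ] ∃[ E′ ] (¬ det₂ E′ ≈ 0#) × X ~ half-std s α β E′
  ~⇒half-std X τ w₁ w₂ B E τ≉0 B≉0 E≉0 X⇔ E⇔ =
    _ , _ , _ , E ∙₂ A⁻¹ , E′≉0 , _ , ~-sym (proj₂ (half-std~ X τ w₁ w₂ B E A⁻¹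
      (proj₂ (valuation τ τ≉0)) A⁻¹≉0 row₁-inverse row₂-inverse X⇔ E⇔))
    where
    open Inverse₂ B (proj₁ (inverse (det₂ B) B≉0)) (proj₂ (inverse (det₂ B) B≉0))

    A⁻¹≉0 : ¬ det₂ A⁻¹ ≈ 0#
    A⁻¹≉0 = unit≉0 (trans (*-comm _ _) det-inverse)

    E′≉0 : ¬ det₂ (E ∙₂ A⁻¹) ≈ 0#
    E′≉0 D≈0 = *≉0 A⁻¹≉0 E≉0 (trans (sym (det-∙₂ E A⁻¹)) D≈0)

-- Diagonalization and reduction to the representatives.

module NormalForm {c ℓ f ℓf} (K : CompletedField c ℓ f ℓf) where
  open CompletedField K hiding (zero)
  open IntegerSolver k₀
  open Valuation K
  open Elimination K
  open Conjugacy K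
  open Reduction K
  open Matrix₂
  open Pair
  open Equivalence using (to; from)
  private module ℤS = ℤSolver.+-*-Solver

  private
    variable
      p q r : Level
      X Y Z : Pair p

  _⟨~⟩_ : X ~ Y → Y ~ Z → X ~ Z
  (_ , g) ⟨~⟩ (_ , h) = _ , ~-trans g h

  swap-forms : ∀ s α β a b c d → half-std s α β (mat a b c d) ~ half-std s α β (mat c d a b)
  swap-forms s α β a b c d = _ , ≐⇒~ (λ _ _ _ → mk⇔ (λ t → t) (λ t → t))
    (λ _ _ → mk⇔ (λ (p , q) → q , p) (λ (p , q) → q , p))

  -- Unlike the exchange of the two forms, which changes neither lattice, this is a nontrivial
  -- element of H, whence the exchange of α and β.
  swap-basis : ∀ s α β a b c d → half-std s α β (mat a b c d) ~ half-std s β α (mat b a d c)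
  swap-basis s α β a b c d = ~-via (mat 0# 1# 1# 0#)
    (unit≉0 (solve 0 ((con (+ 0) :* con (+ 0) :- con (+ 1) :* con (+ 1)) :* (:- con (+ 1))
      := con (+ 1)) refl))
    (λ x y z → mk⇔
      (λ (p , p₁ , p₂) → p , ≼-resp (+-congʳ (sym (eq₁ x y))) p₂ , ≼-resp (+-congʳ (sym (eq₂ x y))) p₁)
      (λ (p , p₁ , p₂) → p , ≼-resp (+-congʳ (eq₂ x y)) p₂ , ≼-resp (+-congʳ (eq₁ x y)) p₁))
    (λ x y → mk⇔
      (λ (p , q) → ≼-resp (sym (eq a b x y)) p , ≼-resp (sym (eq c d x y)) q)
      (λ (p , q) → ≼-resp (eq a b x y) p , ≼-resp (eq c d x y) q))
    where
    eq₁ : ∀ x y → 0# * x + 1# * y ≈ y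
    eq₁ = solve 2 (λ x y → con (+ 0) :* x :+ con (+ 1) :* y := y) refl
    eq₂ : ∀ x y → 1# * x + 0# * y ≈ x
    eq₂ = solve 2 (λ x y → con (+ 1) :* x :+ con (+ 0) :* y := x) refl
    eq : ∀ a b x y → b * (0# * x + 1# * y) + a * (1# * x + 0# * y) ≈ a * x + b * y
    eq = solve 4 (λ a b x y → b :* (con (+ 0) :* x :+ con (+ 1) :* y)
      :+ a :* (con (+ 1) :* x :+ con (+ 0) :* y) := a :* x :+ b :* y) refl

  det-swap-forms : ∀ a b c d → - (a * d - b * c) ≈ c * b - d * a
  det-swap-forms = solve 4 (λ a b c d → :- (a :* d :- b :* c) := c :* b :- d :* a) refl

  det-swap-basis : ∀ a b c d → - (a * d - b * c) ≈ b * c - a * d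
  det-swap-basis = solve 4 (λ a b c d → :- (a :* d :- b :* c) := b :* c :- a :* d) refl

  -≉0 : ∀ {x y} → - x ≈ y → ¬ x ≈ 0# → ¬ y ≈ 0#
  -≉0 {x} -x≈y x≉0 y≈0 = x≉0 (trans (solve 1 (λ x → x := :- (:- x)) refl x)
    (trans (-‿cong (trans -x≈y y≈0)) (solve 0 (:- con (+ 0) := con (+ 0)) refl)))

  -- The inequality r ≤ e is what later allows e = d + r with a natural number d.
  Diagonalizable : ℤ → Carrier → Carrier → Matrix₂ → Set _
  Diagonalizable s α β E = ∃[ α′ ] ∃[ β′ ] ∃[ e ] ∃[ r ] r ℤ.≤ e ×
    half-std s α β E ~ std s (+ 0) (+ 0) α′ β′ e r

  -- Both divisions by a are integral. Clearing b is the change of coordinates x + (b / a) y, which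
  -- preserves 𝒪² and moves α to α + t β; clearing c subtracts an integral multiple of the first
  -- form from the second, which does not change the lattice. What remains is a and d′ = det / a.
  diagonalize-least : ∀ s α β a b c d a⁻¹ μ → a * a⁻¹ ≈ 1# → v a ≡ [ μ ] →
    μ ≼ b → μ ≼ c → μ ≼ d → ¬ (a * d - b * c) ≈ 0# → Diagonalizable s α β (mat a b c d)
  diagonalize-least s α β a b c d a⁻¹ μ aa⁻¹ va μ≼b μ≼c μ≼d D≉0 =
    finish (valuation d′ d′≉0)
    where
    t = b * a⁻¹
    d′ = d - c * a⁻¹ * b

    𝒪-a⁻¹ : ∀ {y} → μ ≼ y → 𝒪 (y * a⁻¹)
    𝒪-a⁻¹ {y} μ≼y = 𝒪-quotient aa⁻¹ (≡.subst (_≤⁺ v y) (≡.sym va) μ≼y)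

    -- The solver treats `a` and `a⁻¹` as unrelated variables, so the factor a a⁻¹ is inserted
    -- explicitly.
    use-inverse : ∀ {x} y → a * a⁻¹ * y ≈ x → y ≈ x
    use-inverse y eq = trans (sym (trans (*-congʳ aa⁻¹) (*-identityˡ y))) eq

    d′≉0 : ¬ d′ ≈ 0#
    d′≉0 d′≈0 = D≉0 (trans (+-congˡ (-‿cong (use-inverse (b * c) refl)))
      (trans (solve 5 (λ a b c d a⁻¹ → a :* d :- a :* a⁻¹ :* (b :* c) := a :* (d :- c :* a⁻¹ :* b))
               refl a b c d a⁻¹)
             (trans (*-congˡ d′≈0) (zeroʳ a))))

    μ≼d′ : μ ≼ d′
    μ≼d′ = ≼-- μ≼d (𝒪-* (𝒪-a⁻¹ μ≼c) μ≼b)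

    A = mat 1# t 0# 1#

    first : ∀ x y → a * (1# * x + t * y) ≈ a * x + b * y
    first x y = trans (solve 5 (λ a b a⁻¹ x y → a :* (con (+ 1) :* x :+ b :* a⁻¹ :* y)
        := a :* x :+ a :* a⁻¹ :* (b :* y)) refl a b a⁻¹ x y)
      (+-congˡ (sym (use-inverse (b * y) refl)))

    second : ∀ x y → d′ * y ≈ (c * x + d * y) - c * a⁻¹ * (a * x + b * y)
    second x y = trans
      (solve 6 (λ b c d a⁻¹ x y → (d :- c :* a⁻¹ :* b) :* y
        := (c :* x :+ d :* y) :- (c :* x :+ c :* a⁻¹ :* (b :* y))) refl b c d a⁻¹ x y)
      (trans (+-congˡ (-‿cong (+-congʳ (use-inverse (c * x) refl))))
        (solve 7 (λ a b c d a⁻¹ x y → (c :* x :+ d :* y) :- (a :* a⁻¹ :* (c :* x) :+ c :* a⁻¹ :* (b :* y))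
          := (c :* x :+ d :* y) :- c :* a⁻¹ :* (a :* x :+ b :* y)) refl a b c d a⁻¹ x y))

    ≼⇔ : ∀ {u k} → v u ≡ [ k ] → ∀ x → 𝒪 (u * x) ⇔ ℤ.- k ≼ x
    ≼⇔ {u} {k} vu x = mk⇔
      (λ p → ≼-unscale vu (≡.subst (_≼ u * x) (≡.sym (ℤₚ.+-inverseʳ k)) p))
      (λ p → ≡.subst (_≼ u * x) (ℤₚ.+-inverseʳ k) (≼-scale vu p))

    add-back : ∀ x y → (x - y) + y ≈ x
    add-back = solve 2 (λ x y → (x :- y) :+ y := x) refl

    finish : ∃[ ν ] v d′ ≡ [ ν ] → Diagonalizable s α β (mat a b c d)
    -- The forms a x and d′ y are integral exactly when v x ≥ -μ and v y ≥ -ν. Signs are reversed,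
    -- so the pivot of least valuation yields the larger exponent e, in the first coordinate as
    -- required.
    finish (ν , vd′) = α + t * β , β , ℤ.- μ , ℤ.- ν , ℤₚ.neg-mono-≤ (≼⇒≤ vd′ μ≼d′)
      , ~-via A (unit≉0 (solve 1 (λ t → (con (+ 1) :* con (+ 1) :- t :* con (+ 0)) :* con (+ 1)
                  := con (+ 1)) refl t))
        (λ x y z → mk⇔
          (λ (p , p₁ , p₂) → p , ≼-resp (eq₁ x y z) (≼-+ p₁ (𝒪-* (𝒪-a⁻¹ μ≼b) p₂))
                               , ≼-resp (eq₂ x y z) p₂)
          (λ (p , p₁ , p₂) → let p₂′ = ≼-resp (sym (eq₂ x y z)) p₂ in
            p , ≼-resp (cancel x y z) (≼-- p₁ (𝒪-* (𝒪-a⁻¹ μ≼b) p₂′)) , p₂′))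
        (λ x y → mk⇔
          (λ (p₁ , p₂) → to (≼⇔ va _) (≼-resp (sym (first x y)) p₁)
            , ≼-resp (sym (row₂-I₂ x y)) (to (≼⇔ vd′ y)
                (≼-resp (sym (second x y)) (≼-- p₂ (𝒪-* (𝒪-a⁻¹ μ≼c) p₁)))))
          (λ (p₁ , p₂) → let p₁′ = ≼-resp (first x y) (from (≼⇔ va _) p₁) in
            p₁′ , ≼-resp (trans (+-congʳ (second x y)) (add-back _ _))
              (≼-+ (from (≼⇔ vd′ y) (≼-resp (row₂-I₂ x y) p₂)) (𝒪-* (𝒪-a⁻¹ μ≼c) p₁′))))
      where
      eq₁ : ∀ x y z → (x - α * z) + t * (y - β * z) ≈ (1# * x + t * y) - (α + t * β) * z
      eq₁ x y z = solve 6 (λ t x y z α β → (x :- α :* z) :+ t :* (y :- β :* z)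
        := (con (+ 1) :* x :+ t :* y) :- (α :+ t :* β) :* z) refl t x y z α β
      eq₂ : ∀ x y z → y - β * z ≈ (0# * x + 1# * y) - β * z
      eq₂ x y z = +-congʳ (sym (row₂-I₂ x y))
      cancel : ∀ x y z → ((1# * x + t * y) - (α + t * β) * z) - t * (y - β * z) ≈ x - α * z
      cancel x y z = solve 6 (λ t x y z α β →
        ((con (+ 1) :* x :+ t :* y) :- (α :+ t :* β) :* z) :- t :* (y :- β :* z)
          := x :- α :* z) refl t x y z α β

  diagonalize-pivot : ∀ s α β a b c d → ¬ a ≈ 0# → v a ≤⁺ v b → v a ≤⁺ v c → v a ≤⁺ v d →
    ¬ (a * d - b * c) ≈ 0# → Diagonalizable s α β (mat a b c d)
  diagonalize-pivot s α β a b c d a≉0 b≥a c≥a d≥a = from-valuation (valuation a a≉0)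
    where
    from-valuation : ∃[ μ ] v a ≡ [ μ ] → ¬ (a * d - b * c) ≈ 0# → Diagonalizable s α β (mat a b c d)
    from-valuation (μ , va) = diagonalize-least s α β a b c d _ μ (proj₂ (inverse a a≉0)) va
      (μ≼ b≥a) (μ≼ c≥a) (μ≼ d≥a)
      where
      μ≼ : ∀ {y} → v a ≤⁺ v y → μ ≼ y
      μ≼ {y} = ≡.subst (_≤⁺ v y) va

  via-swap : ∀ {s α β α′ β′ E E′} → half-std s α β E ~ half-std s α′ β′ E′ →
    Diagonalizable s α′ β′ E′ → Diagonalizable s α β E
  via-swap g (α″ , β″ , e , r , r≤e , h) = α″ , β″ , e , r , r≤e , g ⟨~⟩ h

  -- Exchanging the forms permutes the rows and exchanging the basis vectors permutes the columns,
  -- so each of the four entries can be brought to the pivot position; the determinant changes at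
  -- most its sign.
  diagonalize : ∀ s α β a b c d → ¬ (a * d - b * c) ≈ 0# → Diagonalizable s α β (mat a b c d)
  diagonalize s α β a b c d D≉0 = pivot (least-valuation (a ∷ᶠ b ∷ᶠ c ∷ᶠ d ∷ᶠ []ᶠ))
    where
    entries = a ∷ᶠ b ∷ᶠ c ∷ᶠ d ∷ᶠ []ᶠ
    pivot : (∀ i → entries i ≈ 0#) ⊎ (∃[ i ] (¬ entries i ≈ 0#) × ∀ j → v (entries i) ≤⁺ v (entries j)) →
            Diagonalizable s α β (mat a b c d)
    pivot (inj₁ all≈0) = ⊥-elim (D≉0 (trans
      (+-cong (*-congʳ (all≈0 zero)) (-‿cong (*-congʳ (all≈0 (suc zero)))))
      (solve 2 (λ c d → con (+ 0) :* d :- con (+ 0) :* c := con (+ 0)) refl c d)))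
    pivot (inj₂ (zero , ≉0 , min)) = diagonalize-pivot s α β a b c d ≉0
      (min (suc zero)) (min (suc (suc zero))) (min (suc (suc (suc zero)))) D≉0
    pivot (inj₂ (suc zero , ≉0 , min)) = via-swap (swap-basis s α β a b c d)
      (diagonalize-pivot s β α b a d c ≉0 (min zero) (min (suc (suc (suc zero)))) (min (suc (suc zero)))
        (-≉0 (det-swap-basis a b c d) D≉0))
    pivot (inj₂ (suc (suc zero) , ≉0 , min)) = via-swap (swap-forms s α β a b c d)
      (diagonalize-pivot s α β c d a b ≉0 (min (suc (suc (suc zero)))) (min zero) (min (suc zero))
        (-≉0 (det-swap-forms a b c d) D≉0))
    pivot (inj₂ (suc (suc (suc zero)) , ≉0 , min)) =
      via-swap (swap-forms s α β a b c d ⟨~⟩ swap-basis s α β c d a b)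
      (diagonalize-pivot s β α d c b a ≉0 (min (suc (suc zero))) (min (suc zero)) (min zero)
        (-≉0 (det-swap-basis c d a b) (-≉0 (det-swap-forms a b c d) D≉0)))

  -- When v α < 0, the unit ϖ^(v α) / α multiplies α to a power of ϖ exactly.
  polar-part : ∀ α → ∃[ m ] ∃[ t ] v t ≡ [ + 0 ] × 𝒪 (t * α - ϖ^ (ℤ.- + m))
  polar-part α = by-cases (v α) ≡.refl
    where
    integral : 𝒪 α → ∃[ m ] ∃[ t ] v t ≡ [ + 0 ] × 𝒪 (t * α - ϖ^ (ℤ.- + m))
    -- An integral α and ϖ^0 = 1 both vanish modulo 𝒪.
    integral 𝒪α = 0 , 1# , v-1 , ≼-- (𝒪-* 𝒪-1 𝒪α) 𝒪-1

    by-cases : ∀ w → v α ≡ w → ∃[ m ] ∃[ t ] v t ≡ [ + 0 ] × 𝒪 (t * α - ϖ^ (ℤ.- + m))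
    by-cases ⊤⁺ vα≡⊤ = integral (≼-resp (sym (v-⊤ α vα≡⊤)) ≼-0)
    by-cases [ + n ] vα = integral (≼-weaken (ℤ.+≤+ ℕ.z≤n) (≡⇒≼ vα))
    by-cases [ -[1+ n ] ] vα = ℕ.suc n , P * α⁻¹
      , ≡.trans (v-*⁼ (v-^ -[1+ n ]) (v-inverse vα αα⁻¹)) (≡.cong [_] (ℤₚ.+-inverseʳ -[1+ n ]))
      , ≼-resp (sym (trans (+-congʳ cancel) (-‿inverseʳ P))) ≼-0
      where
      P = ϖ^ -[1+ n ]
      α⁻¹ = proj₁ (inverse α (v-≢⊤ vα))
      αα⁻¹ : α * α⁻¹ ≈ 1#
      αα⁻¹ = proj₂ (inverse α (v-≢⊤ vα))
      cancel : P * α⁻¹ * α ≈ P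
      cancel = trans (*-assoc P α⁻¹ α)
        (trans (*-congˡ (trans (*-comm α⁻¹ α) αα⁻¹)) (*-identityʳ P))

  std-cast : ∀ {s s₁ s₂ α β e r s₁′ s₂′ e′ r′} → s₁ ≡ s₁′ → s₂ ≡ s₂′ → e ≡ e′ → r ≡ r′ →
    X ~ std s s₁ s₂ α β e r → X ~ std s s₁′ s₂′ α β e′ r′
  std-cast ≡.refl ≡.refl ≡.refl ≡.refl g = g

  private
    difference : ∀ {e r} → r ℤ.≤ e → ∃[ d ] e ≡ + d ℤ.+ r
    difference {e} {r} r≤e = ℤ.∣ e ℤ.- r ∣ , (begin
      e                            ≡⟨ ℤS.solve 2 (λ e r → e ℤS.:= e ℤS.:- r ℤS.:+ r) ≡.refl e r ⟩
      e ℤ.- r ℤ.+ r                ≡⟨ ≡.cong (λ t → t ℤ.+ r) (ℤₚ.0≤i⇒+∣i∣≡i (ℤₚ.i≤j⇒0≤j-i r≤e)) ⟨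
      + ℤ.∣ e ℤ.- r ∣ ℤ.+ r ∎)
      where open ≡.≡-Reasoning

  -- A homothety of W brings Λ = 𝒪² to ϖ^s 𝒪², the shape in which α and β matter only modulo 𝒪.
  scale-to-s : ∀ {s α β e r} → ∃[ α′ ] ∃[ β′ ]
    std s (+ 0) (+ 0) α β e r ~ std s s s α′ β′ (s ℤ.+ e) (s ℤ.+ r)
  scale-to-s {s} = _ , _ , std-cast (ℤₚ.+-identityʳ s) (ℤₚ.+-identityʳ s) ≡.refl ≡.refl
    (_ , std-scale (v-^ s) (v-^ s) refl refl)

  std~Q : ∀ s α β e r d → e ≡ + d ℤ.+ r → ∃[ m ] ∃[ n ] std s s s α β e r ~ Q[ s , r , d , m , n ]
  std~Q s α β e r d e≡d+r = normalize (polar-part α) (polar-part β)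
    where
    normalize : ∃[ m ] ∃[ t ] v t ≡ [ + 0 ] × 𝒪 (t * α - ϖ^ (ℤ.- + m)) →
                ∃[ m ] ∃[ t ] v t ≡ [ + 0 ] × 𝒪 (t * β - ϖ^ (ℤ.- + m)) →
                ∃[ m ] ∃[ n ] std s s s α β e r ~ Q[ s , r , d , m , n ]
    normalize (m , t , vt , tα) (n , u , vu , uβ) = m , n ,
      (std-cast (ℤₚ.+-identityˡ s) (ℤₚ.+-identityˡ s) (≡.trans (ℤₚ.+-identityˡ e) e≡d+r) (ℤₚ.+-identityˡ r)
         (_ , std-scale vt vu refl refl)
       ⟨~⟩ (_ , std-shift tα uβ))

  rows~Q : ∀ {N N′} (G : Fin N → Fin 3 → Carrier) (G′ : Fin N′ → Fin 2 → Carrier) →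
    Full G → Full G′ → ∃[ s ] ∃[ r ] ∃[ d ] ∃[ m ] ∃[ n ] rows G G′ ~ Q[ s , r , d , m , n ]
  rows~Q G G′ full full′ = step₁ (lattice₃ G full) (lattice₂ G′ full′)
    where
    Goal = ∃[ s ] ∃[ r ] ∃[ d ] ∃[ m ] ∃[ n ] rows G G′ ~ Q[ s , r , d , m , n ]

    step₄ : ∀ s α β e r → rows G G′ ~ std s s s α β e r → ∃[ d ] e ≡ + d ℤ.+ r → Goal
    step₄ s α β e r g (d , e≡) = let m , n , h = std~Q s α β e r d e≡ in s , r , d , m , n , (g ⟨~⟩ h)

    step₃ : ∀ s α β E → rows G G′ ~ half-std s α β E → Diagonalizable s α β E → Goal
    step₃ s α β E g (α′ , β′ , e , r , r≤e , h) = let α″ , β″ , k = scale-to-s in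
      step₄ s α″ β″ (s ℤ.+ e) (s ℤ.+ r) ((g ⟨~⟩ h) ⟨~⟩ k) (difference (ℤₚ.+-monoʳ-≤ s r≤e))

    step₂ : (∃[ s ] ∃[ α ] ∃[ β ] ∃[ E ] (¬ det₂ E ≈ 0#) × rows G G′ ~ half-std s α β E) → Goal
    step₂ (s , α , β , E , E≉0 , g) =
      step₃ s α β E g (diagonalize s α β (a₁₁ E) (a₁₂ E) (a₂₁ E) (a₂₂ E) E≉0)

    step₁ : _ → _ → Goal
    step₁ (τ , w₁ , w₂ , B , τ≉0 , B≉0 , V⇔) (E , E≉0 , W⇔) =
      step₂ (~⇒half-std (rows G G′) τ w₁ w₂ B E τ≉0 B≉0 E≉0 V⇔ (λ x y → W⇔ (x ,₂ y)))

-- Coordinates of a lattice with respect to a basis.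

module LatticeCoordinates {c ℓ f ℓf a ℓa} (K : CompletedField c ℓ f ℓf)
    (M : LeftModule (CompletedField.ring K) a ℓa)
    {n} (b : Fin n → LeftModule.Carrierᴹ M)
    (b-basis : LinearAlgebra.IsBasis {R = CompletedField.k₀ K} M b) where
  open CompletedField K hiding (zero)
  open Elimination K
  open LeftModule M
  open LinearAlgebra {R = k₀} M
  open Lattices K M
  open IsBasis b-basis using (spans; independent)
  open IsBasis b-basis public using (coord)
  open RingProperties ring using (-1*x≈-x; x∙y⁻¹≈ε⇒x≈y)

  coord-eq : ∀ x → x ≈ᴹ lc (coord x) b
  coord-eq x = proj₂ (spans x)

  lc-unique : ∀ {x y} → lc x b ≈ᴹ lc y b → ∀ i → x i ≈ y i
  lc-unique {x} {y} x≈y i = x∙y⁻¹≈ε⇒x≈y _ _ (trans (+-congˡ (sym (-1*x≈-x (y i))))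
    (independent (λ i → x i + - 1# * y i) (begin
      lc (λ i → x i + - 1# * y i) b            ≈⟨ lc-+ x (λ i → - 1# * y i) b ⟩
      lc x b +ᴹ lc (λ i → - 1# * y i) b        ≈⟨ +ᴹ-cong x≈y (lc-* (- 1#) y b) ⟩
      lc y b +ᴹ - 1# *ₗ lc y b                 ≈⟨ +ᴹ-congʳ (*ₗ-identityˡ (lc y b)) ⟨
      1# *ₗ lc y b +ᴹ - 1# *ₗ lc y b           ≈⟨ *ₗ-distribʳ (lc y b) 1# (- 1#) ⟨
      (1# - 1#) *ₗ lc y b                      ≈⟨ *ₗ-congʳ (-‿inverseʳ 1#) ⟩
      0# *ₗ lc y b                             ≈⟨ *ₗ-zeroˡ (lc y b) ⟩
      0ᴹ ∎) i))
    where open ≈-Reasoning ≈ᴹ-setoid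

  coord-unique : ∀ {x y} → x ≈ᴹ lc y b → ∀ i → coord x i ≈ y i
  coord-unique {x} x≈ = lc-unique (≈ᴹ-trans (≈ᴹ-sym (coord-eq x)) x≈)

  lc-lc : ∀ {N} a (G : Fin N → Fin n → Carrier) (g : Fin N → Carrierᴹ) →
    (∀ i → g i ≈ᴹ lc (G i) b) → lc a g ≈ᴹ lc (λ j → comb a (λ i → G i j)) b
  lc-lc {ℕ.zero}  a G g g≈ = ≈ᴹ-sym (lc-0 b)
  lc-lc {ℕ.suc N} a G g g≈ = begin
    a zero *ₗ g zero +ᴹ lc (λ i → a (suc i)) (λ i → g (suc i))
      ≈⟨ +ᴹ-cong (*ₗ-congˡ (g≈ zero))
                 (lc-lc (λ i → a (suc i)) (λ i → G (suc i)) (λ i → g (suc i)) (λ i → g≈ (suc i))) ⟩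
    a zero *ₗ lc (G zero) b +ᴹ lc (λ j → comb (λ i → a (suc i)) (λ i → G (suc i) j)) b
      ≈⟨ +ᴹ-congʳ (lc-* (a zero) (G zero) b) ⟨
    lc (λ j → a zero * G zero j) b +ᴹ lc (λ j → comb (λ i → a (suc i)) (λ i → G (suc i) j)) b
      ≈⟨ lc-+ _ _ b ⟨
    lc (λ j → comb a (λ i → G i j)) b ∎
    where open ≈-Reasoning ≈ᴹ-setoid

  genCoords : (L : Hyp) → Fin (Hyp.#gens L) → Fin n → Carrier
  genCoords L i = coord (Hyp.gens L i)

  -- Compatibility with ≈ᴹ is not part of the definition of a lattice; it is recovered from the
  -- description by generators.
  ∋-resp : ∀ (L : Hyp) {x y} → x ≈ᴹ y → Hyp._∋_ L x → Hyp._∋_ L y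
  ∋-resp L x≈y x∈L = let a , 𝒪a , x≈ = proj₁ (Hyp.gen-by L) x∈L in
    proj₂ (Hyp.gen-by L) (a , 𝒪a , ≈ᴹ-trans (≈ᴹ-sym x≈y) x≈)

  -- Any coordinates of the generators are allowed: those of a lattice given by a matrix can then be
  -- its entries, rather than the output of `coord`.
  ∋⇔RowSpan : ∀ (L : Hyp) (G : Fin (Hyp.#gens L) → Fin n → Carrier) →
    (∀ i → Hyp.gens L i ≈ᴹ lc (G i) b) → ∀ x → Hyp._∋_ L (lc x b) ⇔ RowSpan G x
  ∋⇔RowSpan L G g≈ x = mk⇔
    (λ x∈L → let a , 𝒪a , x≈ = proj₁ (Hyp.gen-by L) x∈L in
      a , 𝒪a , lc-unique (≈ᴹ-trans x≈ (lc-lc a G _ g≈)))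
    (λ (a , 𝒪a , x≈) → proj₂ (Hyp.gen-by L)
      (a , 𝒪a , ≈ᴹ-trans (lc-cong b x≈) (≈ᴹ-sym (lc-lc a G _ g≈))))

  ∋⇔ : ∀ (L : Hyp) x → Hyp._∋_ L (lc x b) ⇔ RowSpan (genCoords L) x
  ∋⇔ L = ∋⇔RowSpan L (genCoords L) (λ i → coord-eq (Hyp.gens L i))

  genCoords-full : ∀ (L : Hyp) → Full (genCoords L)
  genCoords-full L x = let a , x≈ = Hyp.spanning L (lc x b) in
    a , lc-unique (≈ᴹ-trans x≈ (lc-lc a (genCoords L) _ (λ i → coord-eq (Hyp.gens L i))))

-- The basis of V adapted to W and D.

module Frame {c ℓ f ℓf u ℓu w ℓw l ℓl} {K : CompletedField c ℓ f ℓf}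
             (C : Configuration K u ℓu w ℓw l ℓl) where
  open CompletedField K hiding (zero)
  open Configuration C
  private
    module inW = IsLeftModuleMonomorphism inW-mono
    module inD = IsLeftModuleMonomorphism inD-mono
    module eD = DL.IsBasis eD-basis

  open Reduction K using (_,₂_)
  open RingProperties ring using (-‿distribˡ-*)

  lc-frame : ∀ x → VL.lc x frame V.≈ᴹ
    inW (WL.lc (x zero ,₂ x (suc zero)) eW) V.+ᴹ x (suc (suc zero)) V.*ₗ inD (eD zero)
  lc-frame x = begin
    x zero V.*ₗ inW (eW zero) V.+ᴹ (x (suc zero) V.*ₗ inW (eW (suc zero)) V.+ᴹ (z V.+ᴹ V.0ᴹ))
      ≈⟨ V.+ᴹ-congˡ (V.+ᴹ-congˡ (V.+ᴹ-identityʳ z)) ⟩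
    x zero V.*ₗ inW (eW zero) V.+ᴹ (x (suc zero) V.*ₗ inW (eW (suc zero)) V.+ᴹ z)
      ≈⟨ V.+ᴹ-assoc _ _ _ ⟨
    (x zero V.*ₗ inW (eW zero) V.+ᴹ x (suc zero) V.*ₗ inW (eW (suc zero))) V.+ᴹ z
      ≈⟨ V.+ᴹ-congʳ (V.+ᴹ-cong (inW.*ₗ-homo _ _)
           (V.≈ᴹ-trans (inW.⟦⟧-cong (W.+ᴹ-identityʳ _)) (inW.*ₗ-homo _ _))) ⟨
    (inW (x zero W.*ₗ eW zero) V.+ᴹ inW (x (suc zero) W.*ₗ eW (suc zero) W.+ᴹ W.0ᴹ)) V.+ᴹ z
      ≈⟨ V.+ᴹ-congʳ (inW.+ᴹ-homo _ _) ⟨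
    inW (WL.lc (x zero ,₂ x (suc zero)) eW) V.+ᴹ z ∎
    where
    open ≈-Reasoning V.≈ᴹ-setoid
    z = x (suc (suc zero)) V.*ₗ inD (eD zero)

  -- A relation with nonzero third coefficient would express the generator of D in W, against `D⊄W`;
  -- once that coefficient is 0, injectivity of `inW` reduces to independence of e₁, e₂.
  frame-basis : VL.IsBasis frame
  frame-basis = record { spans = frame-spans ; independent = independent }
    where
    open ≈-Reasoning V.≈ᴹ-setoid
    module _ (x : Fin 3 → Carrier) (x≈0 : VL.lc x frame V.≈ᴹ V.0ᴹ) where
      p = WL.lc (x zero ,₂ x (suc zero)) eW
      z = x (suc (suc zero))
      u₃ = inD (eD zero)

      sum≈0 : inW p V.+ᴹ z V.*ₗ u₃ V.≈ᴹ V.0ᴹ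
      sum≈0 = V.≈ᴹ-trans (V.≈ᴹ-sym (lc-frame x)) x≈0

      z≈0 : z ≈ 0#
      z≈0 with ≈0? z
      ... | inj₁ z≈0 = z≈0
      ... | inj₂ z≉0 = ⊥-elim (D⊄W λ y → let t , y≈ = eD.spans y in
        (t zero * (- z⁻¹)) W.*ₗ p , (begin
          inD y                                    ≈⟨ inD.⟦⟧-cong (D.≈ᴹ-trans y≈ (D.+ᴹ-identityʳ _)) ⟩
          inD (t zero D.*ₗ eD zero)                ≈⟨ inD.*ₗ-homo _ _ ⟩
          t zero V.*ₗ u₃                           ≈⟨ V.*ₗ-congˡ u₃≈ ⟩
          t zero V.*ₗ ((- z⁻¹) V.*ₗ inW p)         ≈⟨ V.*ₗ-assoc _ _ _ ⟨
          (t zero * (- z⁻¹)) V.*ₗ inW p            ≈⟨ inW.*ₗ-homo _ _ ⟨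
          inW ((t zero * (- z⁻¹)) W.*ₗ p) ∎))
        where
        z⁻¹ = proj₁ (inverse z z≉0)
        -z⁻¹z≈-1 : - z⁻¹ * z ≈ - 1#
        -z⁻¹z≈-1 = trans (sym (-‿distribˡ-* z⁻¹ z)) (-‿cong (trans (*-comm z⁻¹ z) (proj₂ (inverse z z≉0))))
        u₃≈ : u₃ V.≈ᴹ (- z⁻¹) V.*ₗ inW p
        u₃≈ = begin
          u₃
            ≈⟨ V.+ᴹ-identityˡ u₃ ⟨
          V.0ᴹ V.+ᴹ u₃
            ≈⟨ V.+ᴹ-cong (V.≈ᴹ-trans (V.*ₗ-congˡ sum≈0) (V.*ₗ-zeroʳ (- z⁻¹))) (V.*ₗ-identityˡ u₃) ⟨
          (- z⁻¹) V.*ₗ (inW p V.+ᴹ z V.*ₗ u₃) V.+ᴹ 1# V.*ₗ u₃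
            ≈⟨ V.+ᴹ-congʳ (V.≈ᴹ-trans (V.*ₗ-distribˡ _ _ _) (V.+ᴹ-congˡ
                 (V.≈ᴹ-trans (V.≈ᴹ-sym (V.*ₗ-assoc _ _ _)) (V.*ₗ-congʳ -z⁻¹z≈-1)))) ⟩
          ((- z⁻¹) V.*ₗ inW p V.+ᴹ (- 1#) V.*ₗ u₃) V.+ᴹ 1# V.*ₗ u₃
            ≈⟨ V.+ᴹ-assoc _ _ _ ⟩
          (- z⁻¹) V.*ₗ inW p V.+ᴹ ((- 1#) V.*ₗ u₃ V.+ᴹ 1# V.*ₗ u₃)
            ≈⟨ V.+ᴹ-congˡ (V.≈ᴹ-trans (V.≈ᴹ-sym (V.*ₗ-distribʳ u₃ _ _))
                 (V.≈ᴹ-trans (V.*ₗ-congʳ (-‿inverseˡ 1#)) (V.*ₗ-zeroˡ u₃))) ⟩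
          (- z⁻¹) V.*ₗ inW p V.+ᴹ V.0ᴹ
            ≈⟨ V.+ᴹ-identityʳ _ ⟩
          (- z⁻¹) V.*ₗ inW p ∎

      p≈0 : p W.≈ᴹ W.0ᴹ
      p≈0 = inW.injective (begin
        inW p                     ≈⟨ V.+ᴹ-identityʳ _ ⟨
        inW p V.+ᴹ V.0ᴹ           ≈⟨ V.+ᴹ-congˡ (V.≈ᴹ-trans (V.*ₗ-congʳ z≈0) (V.*ₗ-zeroˡ u₃)) ⟨
        inW p V.+ᴹ z V.*ₗ u₃      ≈⟨ sum≈0 ⟩
        V.0ᴹ                      ≈⟨ inW.0ᴹ-homo ⟨
        inW W.0ᴹ ∎)

    independent : ∀ x → VL.lc x frame V.≈ᴹ V.0ᴹ → ∀ i → x i ≈ 0#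
    independent x x≈0 zero             = WL.IsBasis.independent eW-basis (x zero ,₂ x (suc zero)) (p≈0 x x≈0) zero
    independent x x≈0 (suc zero)       = WL.IsBasis.independent eW-basis (x zero ,₂ x (suc zero)) (p≈0 x x≈0) (suc zero)
    independent x x≈0 (suc (suc zero)) = z≈0 x x≈0

-- Elements of H and their matrices.

module Bridge {c ℓ f ℓf u ℓu w ℓw l ℓl} {K : CompletedField c ℓ f ℓf}
              (C : Configuration K u ℓu w ℓw l ℓl) where
  open CompletedField K hiding (zero)
  open IntegerSolver k₀
  open Configuration C
  open Valuation K
  open Elimination K
  open Conjugacy K
  open Reduction K
  open Orbits C
  open Frame C
  open Matrix₂
  open _~[_]_
  open Equivalence using (to; from)
  private
    module LV = LatticeCoordinates K V frame frame-basis
    module LW = LatticeCoordinates K W eW eW-basis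
    module HV = Lattices K V
    module HW = Lattices K W
    module inW = IsLeftModuleMonomorphism inW-mono
    module inD = IsLeftModuleMonomorphism inD-mono

  vecW : Carrier → Carrier → W.Carrierᴹ
  vecW x y = WL.lc (x ,₂ y) eW

  vecV : Carrier → Carrier → Carrier → V.Carrierᴹ
  vecV x y z = VL.lc (x ∷ᶠ (y ,₂ z)) frame

  vecW-cong : ∀ {x x′ y y′} → x ≈ x′ → y ≈ y′ → vecW x y W.≈ᴹ vecW x′ y′
  vecW-cong x≈ y≈ = WL.lc-cong eW (,₂-cong x≈ y≈)

  vecV-cong : ∀ {x x′ y y′ z z′} → x ≈ x′ → y ≈ y′ → z ≈ z′ → vecV x y z V.≈ᴹ vecV x′ y′ z′
  vecV-cong x≈ y≈ z≈ = VL.lc-cong frame (,₃-cong x≈ y≈ z≈)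

  lc≈vecW : ∀ a {x y} → a zero ≈ x → a (suc zero) ≈ y → WL.lc a eW W.≈ᴹ vecW x y
  lc≈vecW a {x} {y} a₀ a₁ = WL.lc-cong {a = a} {x ,₂ y} eW λ { zero → a₀ ; (suc zero) → a₁ }

  lc≈vecV : ∀ a {x y z} → a zero ≈ x → a (suc zero) ≈ y → a (suc (suc zero)) ≈ z →
            VL.lc a frame V.≈ᴹ vecV x y z
  lc≈vecV a {x} {y} {z} a₀ a₁ a₂ = VL.lc-cong {a = a} {x ∷ᶠ (y ,₂ z)} frame
    λ { zero → a₀ ; (suc zero) → a₁ ; (suc (suc zero)) → a₂ }

  vecW-unique : ∀ {x x′ y y′} → vecW x y W.≈ᴹ vecW x′ y′ → x ≈ x′ × y ≈ y′
  vecW-unique {x} {x′} {y} {y′} eq = unique zero , unique (suc zero)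
    where unique = LW.lc-unique {x ,₂ y} {x′ ,₂ y′} eq

  vecV-unique : ∀ {x x′ y y′ z z′} → vecV x y z V.≈ᴹ vecV x′ y′ z′ → x ≈ x′ × y ≈ y′ × z ≈ z′
  vecV-unique {x} {x′} {y} {y′} {z} {z′} eq = unique zero , unique (suc zero) , unique (suc (suc zero))
    where unique = LV.lc-unique {x ∷ᶠ (y ,₂ z)} {x′ ∷ᶠ (y′ ,₂ z′)} eq

  decomposeW : ∀ p → ∃[ x ] ∃[ y ] p W.≈ᴹ vecW x y
  decomposeW p = _ , _ , W.≈ᴹ-trans (LW.coord-eq p)
    (lc≈vecW (LW.coord p) refl refl)

  decomposeV : ∀ p → ∃[ x ] ∃[ y ] ∃[ z ] p V.≈ᴹ vecV x y z
  decomposeV p = _ , _ , _ , V.≈ᴹ-trans (LV.coord-eq p)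
    (lc≈vecV (LV.coord p) refl refl refl)

  pair : Hyp² → Pair (c ⊔ ℓ)
  pair (L , M) = rows (LV.genCoords L) (LW.genCoords M)

  -- A relation rather than the function `matrixOf`, because the matrix read off from `fromMatrix A`
  -- agrees with A only up to ≈.
  Acts : H → Matrix₂ → Set _
  Acts h A = ∀ x y → WL.GL.to h (vecW x y) W.≈ᴹ vecW (row₁ A x y) (row₂ A x y)

  module _ (h : H) where
    private
      φ = WL.GL.to h
      module φ = IsLeftModuleIsomorphism (WL.GL.isIsomorphism h)

    φ-lc : ∀ {n} a (g : Fin n → W.Carrierᴹ) → φ (WL.lc a g) W.≈ᴹ WL.lc a (λ i → φ (g i))
    φ-lc {ℕ.zero}  a g = φ.0ᴹ-homo
    φ-lc {ℕ.suc n} a g = W.≈ᴹ-trans (φ.+ᴹ-homo _ _)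
      (W.+ᴹ-cong (φ.*ₗ-homo _ _) (φ-lc (λ i → a (suc i)) (λ i → g (suc i))))

    matrixOf : Matrix₂
    matrixOf = mat (LW.coord (φ (eW zero)) zero) (LW.coord (φ (eW (suc zero))) zero)
                   (LW.coord (φ (eW zero)) (suc zero)) (LW.coord (φ (eW (suc zero))) (suc zero))

    matrixOf-acts : Acts h matrixOf
    matrixOf-acts x y = W.≈ᴹ-trans (φ-lc (x ,₂ y) eW)
      (W.≈ᴹ-trans (LW.lc-lc (x ,₂ y) (λ i → LW.coord (φ (eW i))) _ (λ i → LW.coord-eq (φ (eW i))))
        (lc≈vecW (λ j → comb (x ,₂ y) (λ i → LW.coord (φ (eW i)) j)) (eq x y _ _) (eq x y _ _)))
      where
      eq : ∀ x y g g′ → x * g + (y * g′ + 0#) ≈ g * x + g′ * y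
      eq = solve 4 (λ x y g g′ → x :* g :+ (y :* g′ :+ con (+ 0)) := g :* x :+ g′ :* y) refl

    module _ (A : Matrix₂) (acts : Acts h A) where

      acts-injective : ∀ {x y x′ y′} → row₁ A x y ≈ row₁ A x′ y′ → row₂ A x y ≈ row₂ A x′ y′ →
                       x ≈ x′ × y ≈ y′
      acts-injective p q = vecW-unique (φ.injective (W.≈ᴹ-trans (acts _ _)
        (W.≈ᴹ-trans (vecW-cong p q) (W.≈ᴹ-sym (acts _ _)))))

      acts-surjective : ∀ x y → ∃[ x′ ] ∃[ y′ ] row₁ A x′ y′ ≈ x × row₂ A x′ y′ ≈ y
      acts-surjective x y =
        let p , φp≈ = φ.surjective (vecW x y)
            x′ , y′ , p≈ = decomposeW p
        in x′ , y′ , vecW-unique (W.≈ᴹ-trans (W.≈ᴹ-sym (acts x′ y′)) (φp≈ (W.≈ᴹ-sym p≈)))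

      -- Preimages of the two unit vectors are the columns of a right inverse, and the determinant
      -- is multiplicative.
      acts-det≉0 : ¬ det₂ A ≈ 0#
      acts-det≉0 =
        let x₁ , y₁ , p₁ , q₁ = acts-surjective 1# 0#
            x₂ , y₂ , p₂ , q₂ = acts-surjective 0# 1#
        in unit≉0 (trans (eq (a₁₁ A) (a₁₂ A) (a₂₁ A) (a₂₂ A) x₁ y₁ x₂ y₂)
             (trans (+-cong (*-cong p₁ q₂) (-‿cong (*-cong p₂ q₁)))
               (solve 0 (con (+ 1) :* con (+ 1) :- con (+ 0) :* con (+ 0) := con (+ 1)) refl)))
        where
        eq : ∀ a b c d x₁ y₁ x₂ y₂ → (a * d - b * c) * (x₁ * y₂ - x₂ * y₁)
             ≈ (a * x₁ + b * y₁) * (c * x₂ + d * y₂) - (a * x₂ + b * y₂) * (c * x₁ + d * y₁)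
        eq = solve 8 (λ a b c d x₁ y₁ x₂ y₂ → (a :* d :- b :* c) :* (x₁ :* y₂ :- x₂ :* y₁)
          := (a :* x₁ :+ b :* y₁) :* (c :* x₂ :+ d :* y₂) :- (a :* x₂ :+ b :* y₂) :* (c :* x₁ :+ d :* y₁)) refl

      acts-det : det h ≈ det₂ A
      acts-det = +-cong (*-cong (proj₁ col₁) (proj₂ col₂)) (-‿cong (*-cong (proj₁ col₂) (proj₂ col₁)))
        where
        at₁ : ∀ a b → a * 1# + b * 0# ≈ a
        at₁ = solve 2 (λ a b → a :* con (+ 1) :+ b :* con (+ 0) := a) refl
        at₂ : ∀ a b → a * 0# + b * 1# ≈ b
        at₂ = solve 2 (λ a b → a :* con (+ 0) :+ b :* con (+ 1) := b) refl
        col₁ : a₁₁ (matrixOf) ≈ a₁₁ A × a₂₁ (matrixOf) ≈ a₂₁ A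
        col₁ = let p , q = vecW-unique (W.≈ᴹ-trans (W.≈ᴹ-sym (matrixOf-acts 1# 0#)) (acts 1# 0#)) in
          trans (sym (at₁ _ _)) (trans p (at₁ _ _)) , trans (sym (at₁ _ _)) (trans q (at₁ _ _))
        col₂ : a₁₂ (matrixOf) ≈ a₁₂ A × a₂₂ (matrixOf) ≈ a₂₂ A
        col₂ = let p , q = vecW-unique (W.≈ᴹ-trans (W.≈ᴹ-sym (matrixOf-acts 0# 1#)) (acts 0# 1#)) in
          trans (sym (at₂ _ _)) (trans p (at₂ _ _)) , trans (sym (at₂ _ _)) (trans q (at₂ _ _))

      ⊕id-acts : ∀ {p x y z} → p V.≈ᴹ vecV x y z → (φ ⊕id) p V.≈ᴹ vecV (row₁ A x y) (row₂ A x y) z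
      ⊕id-acts {p} {x} {y} {z} p≈ = begin
        inW (φ (b zero W.*ₗ eW zero W.+ᴹ b (suc zero) W.*ₗ eW (suc zero)))
          V.+ᴹ inD (b (suc (suc zero)) D.*ₗ eD zero)
          ≈⟨ V.+ᴹ-cong (inW.⟦⟧-cong (φ.⟦⟧-cong (W.+ᴹ-cong (W.*ₗ-congʳ (b≈ zero))
               (W.≈ᴹ-trans (W.*ₗ-congʳ (b≈ (suc zero))) (W.≈ᴹ-sym (W.+ᴹ-identityʳ _))))))
               (V.≈ᴹ-trans (inD.*ₗ-homo _ _) (V.*ₗ-congʳ (b≈ (suc (suc zero))))) ⟩
        inW (φ (vecW x y)) V.+ᴹ z V.*ₗ inD (eD zero)
          ≈⟨ V.+ᴹ-congʳ (inW.⟦⟧-cong (acts x y)) ⟩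
        inW (vecW (row₁ A x y) (row₂ A x y)) V.+ᴹ z V.*ₗ inD (eD zero)
          ≈⟨ lc-frame (row₁ A x y ∷ᶠ (row₂ A x y ,₂ z)) ⟨
        vecV (row₁ A x y) (row₂ A x y) z ∎
        where
        open ≈-Reasoning V.≈ᴹ-setoid
        b = proj₁ (frame-spans p)
        b≈ : ∀ i → b i ≈ (x ∷ᶠ (y ,₂ z)) i
        b≈ = LV.coord-unique p≈

      -- For the converse direction `Image` only provides some preimage in L; injectivity of the
      -- action identifies its coordinates with the given x, y, z.
      imageV⇒ : ∀ L L′ → Image V._≈ᴹ_ (φ ⊕id) (HV.Hyp._∋_ L) ≐ HV.Hyp._∋_ L′ → ∀ x y z →
        RowSpan (LV.genCoords L) (x ∷ᶠ (y ,₂ z))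
          ⇔ RowSpan (LV.genCoords L′) (row₁ A x y ∷ᶠ (row₂ A x y ,₂ z))
      imageV⇒ L L′ (⊆ , ⊇) x y z = mk⇔
        (λ s → to (LV.∋⇔ L′ _) (⊆ (vecV x y z , from (LV.∋⇔ L _) s , ⊕id-acts V.≈ᴹ-refl)))
        (λ s → let p , p∈L , φp≈ = ⊇ (from (LV.∋⇔ L′ _) s)
                   x′ , y′ , z′ , p≈ = decomposeV p
                   e₁ , e₂ , e₃ = vecV-unique (V.≈ᴹ-trans (V.≈ᴹ-sym (⊕id-acts p≈)) φp≈)
                   x≈ , y≈ = acts-injective e₁ e₂
               in to (LV.∋⇔ L _) (LV.∋-resp L (V.≈ᴹ-trans p≈ (vecV-cong x≈ y≈ e₃)) p∈L))

      imageW⇒ : ∀ M M′ → Image W._≈ᴹ_ φ (HW.Hyp._∋_ M) ≐ HW.Hyp._∋_ M′ → ∀ x y →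
        RowSpan (LW.genCoords M) (x ,₂ y) ⇔ RowSpan (LW.genCoords M′) (row₁ A x y ,₂ row₂ A x y)
      imageW⇒ M M′ (⊆ , ⊇) x y = mk⇔
        (λ s → to (LW.∋⇔ M′ _) (⊆ (vecW x y , from (LW.∋⇔ M _) s , acts x y)))
        (λ s → let p , p∈M , φp≈ = ⊇ (from (LW.∋⇔ M′ _) s)
                   x′ , y′ , p≈ = decomposeW p
                   e₁ , e₂ = vecW-unique (W.≈ᴹ-trans (W.≈ᴹ-sym (W.≈ᴹ-trans (φ.⟦⟧-cong p≈) (acts x′ y′))) φp≈)
                   x≈ , y≈ = acts-injective e₁ e₂
               in to (LW.∋⇔ M _) (LW.∋-resp M (W.≈ᴹ-trans p≈ (vecW-cong x≈ y≈)) p∈M))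

      imageV⇐ : ∀ L L′ → (∀ x y z → RowSpan (LV.genCoords L) (x ∷ᶠ (y ,₂ z))
          ⇔ RowSpan (LV.genCoords L′) (row₁ A x y ∷ᶠ (row₂ A x y ,₂ z))) →
        Image V._≈ᴹ_ (φ ⊕id) (HV.Hyp._∋_ L) ≐ HV.Hyp._∋_ L′
      imageV⇐ L L′ L⇔ =
        (λ (p , p∈L , φp≈) →
          let x , y , z , p≈ = decomposeV p
          in LV.∋-resp L′ (V.≈ᴹ-trans (V.≈ᴹ-sym (⊕id-acts p≈)) φp≈) (from (LV.∋⇔ L′ _)
               (to (L⇔ x y z) (to (LV.∋⇔ L _) (LV.∋-resp L p≈ p∈L))))) ,
        (λ {q} q∈L′ →
          let x , y , z , q≈ = decomposeV q
              x′ , y′ , e₁ , e₂ = acts-surjective x y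
          in vecV x′ y′ z , from (LV.∋⇔ L _) (from (L⇔ x′ y′ z) (RowSpan-resp
               (,₃-cong (sym e₁) (sym e₂) refl) (to (LV.∋⇔ L′ _) (LV.∋-resp L′ q≈ q∈L′))))
             , V.≈ᴹ-trans (⊕id-acts V.≈ᴹ-refl) (V.≈ᴹ-trans (vecV-cong e₁ e₂ refl) (V.≈ᴹ-sym q≈)))

      imageW⇐ : ∀ M M′ → (∀ x y →
        RowSpan (LW.genCoords M) (x ,₂ y) ⇔ RowSpan (LW.genCoords M′) (row₁ A x y ,₂ row₂ A x y)) →
        Image W._≈ᴹ_ φ (HW.Hyp._∋_ M) ≐ HW.Hyp._∋_ M′
      imageW⇐ M M′ M⇔ =
        (λ (p , p∈M , φp≈) →
          let x , y , p≈ = decomposeW p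
          in LW.∋-resp M′ (W.≈ᴹ-trans (W.≈ᴹ-sym (W.≈ᴹ-trans (φ.⟦⟧-cong p≈) (acts x y))) φp≈)
               (from (LW.∋⇔ M′ _) (to (M⇔ x y) (to (LW.∋⇔ M _) (LW.∋-resp M p≈ p∈M))))) ,
        (λ {q} q∈M′ →
          let x , y , q≈ = decomposeW q
              x′ , y′ , e₁ , e₂ = acts-surjective x y
          in vecW x′ y′ , from (LW.∋⇔ M _) (from (M⇔ x′ y′) (RowSpan-resp
               (,₂-cong (sym e₁) (sym e₂)) (to (LW.∋⇔ M′ _) (LW.∋-resp M′ q≈ q∈M′))))
             , W.≈ᴹ-trans (acts x′ y′) (W.≈ᴹ-trans (vecW-cong e₁ e₂) (W.≈ᴹ-sym q≈)))

  module _ (A : Matrix₂) (A≉0 : ¬ det₂ A ≈ 0#) where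
    private
      open Inverse₂ A (proj₁ (inverse (det₂ A) A≉0)) (proj₂ (inverse (det₂ A) A≉0))

      columns : Fin 2 → Fin 2 → Carrier
      columns zero    = a₁₁ A ,₂ a₂₁ A
      columns (suc _) = a₁₂ A ,₂ a₂₂ A

      ψ-eW : Fin 2 → W.Carrierᴹ
      ψ-eW i = WL.lc (columns i) eW

      ψ : W.Carrierᴹ → W.Carrierᴹ
      ψ p = WL.lc (LW.coord p) ψ-eW

      ψ-lc : ∀ {p} x → p W.≈ᴹ WL.lc x eW → ψ p W.≈ᴹ WL.lc x ψ-eW
      ψ-lc {p} x p≈ = WL.lc-cong {a = LW.coord p} {x} ψ-eW (LW.coord-unique p≈)

      ψ-acts : ∀ {p x y} → p W.≈ᴹ vecW x y → ψ p W.≈ᴹ vecW (row₁ A x y) (row₂ A x y)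
      ψ-acts {p} {x} {y} p≈ = W.≈ᴹ-trans (ψ-lc (x ,₂ y) p≈)
        (W.≈ᴹ-trans (LW.lc-lc (x ,₂ y) columns ψ-eW (λ i → W.≈ᴹ-refl))
          (lc≈vecW (λ j → comb (x ,₂ y) (λ i → columns i j)) (eq x y _ _) (eq x y _ _)))
        where
        eq : ∀ x y g g′ → x * g + (y * g′ + 0#) ≈ g * x + g′ * y
        eq = solve 4 (λ x y g g′ → x :* g :+ (y :* g′ :+ con (+ 0)) := g :* x :+ g′ :* y) refl

      ψ-cong : ∀ {p q} → p W.≈ᴹ q → ψ p W.≈ᴹ ψ q
      ψ-cong {p} {q} p≈q = ψ-lc (LW.coord q) (W.≈ᴹ-trans p≈q (LW.coord-eq q))

      ψ-+ : ∀ p q → ψ (p W.+ᴹ q) W.≈ᴹ ψ p W.+ᴹ ψ q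
      ψ-+ p q = W.≈ᴹ-trans
        (ψ-lc (λ i → LW.coord p i + LW.coord q i)
          (W.≈ᴹ-trans (W.+ᴹ-cong (LW.coord-eq p) (LW.coord-eq q)) (W.≈ᴹ-sym (WL.lc-+ (LW.coord p) (LW.coord q) eW))))
        (WL.lc-+ (LW.coord p) (LW.coord q) ψ-eW)

      ψ-* : ∀ t p → ψ (t W.*ₗ p) W.≈ᴹ t W.*ₗ ψ p
      ψ-* t p = W.≈ᴹ-trans
        (ψ-lc (λ i → t * LW.coord p i)
          (W.≈ᴹ-trans (W.*ₗ-congˡ (LW.coord-eq p)) (W.≈ᴹ-sym (WL.lc-* t (LW.coord p) eW))))
        (WL.lc-* t (LW.coord p) ψ-eW)

      ψ-0 : ψ W.0ᴹ W.≈ᴹ W.0ᴹ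
      ψ-0 = W.≈ᴹ-trans (ψ-lc (λ _ → 0#) (W.≈ᴹ-sym (WL.lc-0 eW))) (WL.lc-0 ψ-eW)

      ψ-neg : ∀ p → ψ (W.-ᴹ p) W.≈ᴹ W.-ᴹ ψ p
      ψ-neg p = inverseʳ-unique _ _ (W.≈ᴹ-trans (W.≈ᴹ-sym (ψ-+ p (W.-ᴹ p)))
        (W.≈ᴹ-trans (ψ-cong (W.-ᴹ‿inverseʳ p)) ψ-0))
        where open AbelianGroupProperties W.+ᴹ-abelianGroup using (inverseʳ-unique)

      ψ-injective : ∀ {p q} → ψ p W.≈ᴹ ψ q → p W.≈ᴹ q
      ψ-injective {p} {q} ψp≈ψq =
        let x , y , p≈ = decomposeW p
            x′ , y′ , q≈ = decomposeW q
            e₁ , e₂ = vecW-unique (W.≈ᴹ-trans (W.≈ᴹ-sym (ψ-acts p≈)) (W.≈ᴹ-trans ψp≈ψq (ψ-acts q≈)))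
        in W.≈ᴹ-trans p≈ (W.≈ᴹ-trans (vecW-cong
             (trans (sym (inverse-row₁ x y)) (trans (+-cong (*-congˡ e₁) (*-congˡ e₂)) (inverse-row₁ x′ y′)))
             (trans (sym (inverse-row₂ x y)) (trans (+-cong (*-congˡ e₁) (*-congˡ e₂)) (inverse-row₂ x′ y′))))
             (W.≈ᴹ-sym q≈))

      ψ-surjective : ∀ q → ∃[ p ] ∀ {p′} → p′ W.≈ᴹ p → ψ p′ W.≈ᴹ q
      ψ-surjective q =
        let x , y , q≈ = decomposeW q
        in vecW (row₁ A⁻¹ x y) (row₂ A⁻¹ x y) , λ p′≈ → W.≈ᴹ-trans (ψ-acts p′≈)
             (W.≈ᴹ-trans (vecW-cong (row₁-inverse x y) (row₂-inverse x y)) (W.≈ᴹ-sym q≈))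

    fromMatrix : H
    fromMatrix = record
      { to = ψ
      ; isIsomorphism = record
        { isLeftModuleMonomorphism = record
          { isLeftModuleHomomorphism = record
            { +ᴹ-isGroupHomomorphism = record
              { isMonoidHomomorphism = record
                { isMagmaHomomorphism = record
                  { isRelHomomorphism = record { cong = ψ-cong }
                  ; homo = ψ-+ }
                ; ε-homo = ψ-0 }
              ; ⁻¹-homo = ψ-neg }
            ; *ₗ-homo = ψ-* }
          ; injective = ψ-injective }
        ; surjective = ψ-surjective } }

    fromMatrix-acts : Acts fromMatrix A
    fromMatrix-acts x y = ψ-acts W.≈ᴹ-refl

  Conjugates : H → Hyp² → Hyp² → Set _
  Conjugates h (L , M) (L′ , M′) =
    Image V._≈ᴹ_ (WL.GL.to h ⊕id) (HV.Hyp._∋_ L) ≐ HV.Hyp._∋_ L′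
    × Image W._≈ᴹ_ (WL.GL.to h) (HW.Hyp._∋_ M) ≐ HW.Hyp._∋_ M′

  Conjugates⇒~ : ∀ h X Y {z} → v (det h) ≡ [ z ] → Conjugates h X Y → pair X ~[ z ] pair Y
  -- `det h` unfolds to `det₂ (matrixOf h)`, so the hypothesis on the valuation applies as it
  -- stands.
  Conjugates⇒~ h (L , M) (L′ , M′) vdet (imV , imW) = conj (matrixOf h) vdet
    (imageV⇒ h (matrixOf h) (matrixOf-acts h) L L′ imV)
    (imageW⇒ h (matrixOf h) (matrixOf-acts h) M M′ imW)

  det≉0 : ∀ h → ¬ det h ≈ 0#
  det≉0 h = acts-det≉0 h (matrixOf h) (matrixOf-acts h)

  ~⇒Conjugates : ∀ X Y {z} → pair X ~[ z ] pair Y → ∃[ h ] v (det h) ≡ [ z ] × Conjugates h X Y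
  ~⇒Conjugates (L , M) (L′ , M′) (conj A vdet V⇔ W⇔) =
    h , ≡.trans (v-cong (acts-det h A acts)) vdet
      , imageV⇐ h A acts L L′ V⇔ , imageW⇐ h A acts M M′ W⇔
    where
    h = fromMatrix A (v-≢⊤ vdet)
    acts = fromMatrix-acts A (v-≢⊤ vdet)

-- Spans of triangular matrices as valuation conditions.

module Triangular {c ℓ f ℓf} (K : CompletedField c ℓ f ℓf) where
  open CompletedField K hiding (zero)
  open IntegerSolver k₀
  open Valuation K
  open Elimination K
  open Reduction K

  private
    ≼-multiple : ∀ {t s a} → v t ≡ [ s ] → 𝒪 a → s ≼ a * t
    ≼-multiple {t} {s} {a} vt 𝒪a = ≡.subst (_≼ a * t) (ℤₚ.+-identityˡ s) (≼-* 𝒪a (≡⇒≼ vt))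

    divide : ∀ {t s} → v t ≡ [ s ] → ∀ x → s ≼ x → ∃[ a ] 𝒪 a × a * t ≈ x
    divide {t} {s} vt x s≼x = x * t⁻¹
      , 𝒪-quotient tt⁻¹ (≡.subst (_≤⁺ v x) (≡.sym vt) s≼x)
      , trans (*-assoc x t⁻¹ t) (trans (*-congˡ (trans (*-comm t⁻¹ t) tt⁻¹)) (*-identityʳ x))
      where
      t⁻¹ = proj₁ (inverse t (v-≢⊤ vt))
      tt⁻¹ : t * t⁻¹ ≈ 1#
      tt⁻¹ = proj₂ (inverse t (v-≢⊤ vt))

  -- Back substitution: the third coordinate forces the coefficient z / t, and the rest, x - α z and
  -- y - β z, is divided by p and q. The generators are compared up to ≈ because matrix entries such
  -- as ϖ^s * 0# are zero only in that sense.
  triangular₃ : ∀ (G : Fin 3 → Fin 3 → Carrier) α β p q t {s₁ s₂ s} →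
    v p ≡ [ s₁ ] → v q ≡ [ s₂ ] → v t ≡ [ s ] →
    (∀ j → G zero j ≈ (p ∷ᶠ (0# ,₂ 0#)) j) → (∀ j → G (suc zero) j ≈ (0# ∷ᶠ (q ,₂ 0#)) j) →
    (∀ j → G (suc (suc zero)) j ≈ (α * t ∷ᶠ (β * t ,₂ t)) j) →
    ∀ x y z → RowSpan G (x ∷ᶠ (y ,₂ z)) ⇔ (s ≼ z × s₁ ≼ x - α * z × s₂ ≼ y - β * z)
  triangular₃ G α β p q t vp vq vt G₀ G₁ G₂ x y z = mk⇔
    (λ (a , 𝒪a , x≈) →
      let a₀ = a zero
          a₁ = a (suc zero)
          a₂ = a (suc (suc zero))
          z≈ = trans (x≈ (suc (suc zero))) (trans (col a (suc (suc zero)))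
                 (solve 4 (λ a₀ a₁ a₂ t → a₀ :* con (+ 0) :+ (a₁ :* con (+ 0) :+ (a₂ :* t :+ con (+ 0)))
                   := a₂ :* t) refl a₀ a₁ a₂ t))
      in ≼-resp (sym z≈) (≼-multiple vt (𝒪a (suc (suc zero))))
       , ≼-resp (trans
           (solve 6 (λ a₀ a₁ a₂ p α t → a₀ :* p
              := (a₀ :* p :+ (a₁ :* con (+ 0) :+ (a₂ :* (α :* t) :+ con (+ 0)))) :- α :* (a₂ :* t))
              refl a₀ a₁ a₂ p α t)
           (+-cong (sym (trans (x≈ zero) (col a zero))) (-‿cong (*-congˡ (sym z≈)))))
           (≼-multiple vp (𝒪a zero))
       , ≼-resp (trans
           (solve 6 (λ a₀ a₁ a₂ q β t → a₁ :* q
              := (a₀ :* con (+ 0) :+ (a₁ :* q :+ (a₂ :* (β :* t) :+ con (+ 0)))) :- β :* (a₂ :* t))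
              refl a₀ a₁ a₂ q β t)
           (+-cong (sym (trans (x≈ (suc zero)) (col a (suc zero)))) (-‿cong (*-congˡ (sym z≈)))))
           (≼-multiple vq (𝒪a (suc zero))))
    (λ (pz , px , py) →
      let a₀ , 𝒪a₀ , e₀ = divide vp (x - α * z) px
          a₁ , 𝒪a₁ , e₁ = divide vq (y - β * z) py
          a₂ , 𝒪a₂ , e₂ = divide vt z pz
          a = a₀ ∷ᶠ (a₁ ,₂ a₂)
      in a , (λ { zero → 𝒪a₀ ; (suc zero) → 𝒪a₁ ; (suc (suc zero)) → 𝒪a₂ }) , λ
        { zero → sym (trans (col a zero) (trans
            (solve 5 (λ u a₁ a₂ α t → u :+ (a₁ :* con (+ 0) :+ (a₂ :* (α :* t) :+ con (+ 0)))
              := u :+ α :* (a₂ :* t)) refl (a₀ * p) a₁ a₂ α t)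
            (trans (+-cong e₀ (*-congˡ e₂)) (add-back x α z))))
        ; (suc zero) → sym (trans (col a (suc zero)) (trans
            (solve 5 (λ u a₀ a₂ β t → a₀ :* con (+ 0) :+ (u :+ (a₂ :* (β :* t) :+ con (+ 0)))
              := u :+ β :* (a₂ :* t)) refl (a₁ * q) a₀ a₂ β t)
            (trans (+-cong e₁ (*-congˡ e₂)) (add-back y β z))))
        ; (suc (suc zero)) → sym (trans (col a (suc (suc zero))) (trans
            (solve 3 (λ u a₀ a₁ → a₀ :* con (+ 0) :+ (a₁ :* con (+ 0) :+ (u :+ con (+ 0)))
              := u) refl (a₂ * t) a₀ a₁) e₂)) })
    where
    add-back : ∀ x α z → (x - α * z) + α * z ≈ x
    add-back = solve 3 (λ x α z → (x :- α :* z) :+ α :* z := x) refl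
    T : Fin 3 → Fin 3 → Carrier
    T = (p ∷ᶠ (0# ,₂ 0#)) ∷ᶠ ((0# ∷ᶠ (q ,₂ 0#)) ∷ᶠ ((α * t ∷ᶠ (β * t ,₂ t)) ∷ᶠ []ᶠ))
    col : ∀ a j → comb a (λ i → G i j) ≈ comb a (λ i → T i j)
    col a j = comb-cong a {λ i → G i j} {λ i → T i j} λ { zero → G₀ j ; (suc zero) → G₁ j ; (suc (suc zero)) → G₂ j }

  diagonal₂ : ∀ (G : Fin 2 → Fin 2 → Carrier) p q {e r} → v p ≡ [ e ] → v q ≡ [ r ] →
    (∀ j → G zero j ≈ (p ,₂ 0#) j) → (∀ j → G (suc zero) j ≈ (0# ,₂ q) j) →
    ∀ x y → RowSpan G (x ,₂ y) ⇔ (e ≼ x × r ≼ y)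
  diagonal₂ G p q vp vq G₀ G₁ x y = mk⇔
    (λ (a , 𝒪a , x≈) →
        ≼-resp (sym (trans (x≈ zero) (trans (col a zero) (eq₀ (a zero) (a (suc zero)) p))))
          (≼-multiple vp (𝒪a zero))
      , ≼-resp (sym (trans (x≈ (suc zero)) (trans (col a (suc zero)) (eq₁ (a zero) (a (suc zero)) q))))
          (≼-multiple vq (𝒪a (suc zero))))
    (λ (px , py) →
      let a₀ , 𝒪a₀ , e₀ = divide vp x px
          a₁ , 𝒪a₁ , e₁ = divide vq y py
          a = a₀ ,₂ a₁
      in a , (λ { zero → 𝒪a₀ ; (suc zero) → 𝒪a₁ }) , λ
        { zero       → sym (trans (col a zero) (trans (eq₀ a₀ a₁ p) e₀))
        ; (suc zero) → sym (trans (col a (suc zero)) (trans (eq₁ a₀ a₁ q) e₁)) })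
    where
    T : Fin 2 → Fin 2 → Carrier
    T = (p ,₂ 0#) ∷ᶠ ((0# ,₂ q) ∷ᶠ []ᶠ)
    col : ∀ a j → comb a (λ i → G i j) ≈ comb a (λ i → T i j)
    col a j = comb-cong a {λ i → G i j} {λ i → T i j} λ { zero → G₀ j ; (suc zero) → G₁ j }
    eq₀ : ∀ a b p → a * p + (b * 0# + 0#) ≈ a * p
    eq₀ = solve 3 (λ a b p → a :* p :+ (b :* con (+ 0) :+ con (+ 0)) := a :* p) refl
    eq₁ : ∀ a b q → a * 0# + (b * q + 0#) ≈ b * q
    eq₁ = solve 3 (λ a b q → a :* con (+ 0) :+ (b :* q :+ con (+ 0)) := b :* q) refl

-- The explicit representatives and the two bijections.

module Representatives {c ℓ f ℓf u ℓu w ℓw l ℓl} {K : CompletedField c ℓ f ℓf}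
                       (C : Configuration K u ℓu w ℓw l ℓl) where
  open CompletedField K hiding (zero)
  open Configuration C
  open Valuation K
  open Elimination K
  open Conjugacy K
  open Invariants K
  open Reduction K
  open NormalForm K using (rows~Q)
  open Triangular K
  open Orbits C
  open Frame C
  open Bridge C
  open Equivalence using (to; from)
  private
    module LV = LatticeCoordinates K V frame frame-basis
    module LW = LatticeCoordinates K W eW eW-basis
    module ℤS = ℤSolver.+-*-Solver

  -- Both sides describe membership in the same lattice, once with computed coordinates of the
  -- generators and once with the columns of A.
  spanV⇔ : ∀ A sp x → RowSpan (LV.genCoords (Lattices.⟨_⟩ K V (colsV A) sp)) x
                      ⇔ RowSpan (λ j i → entry A i j) x
  spanV⇔ A sp x = mk⇔ (λ s → to G⇔ (from g⇔ s)) (λ s → to g⇔ (from G⇔ s))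
    where
    L = Lattices.⟨_⟩ K V (colsV A) sp
    g⇔ = LV.∋⇔ L x
    G⇔ = LV.∋⇔RowSpan L (λ j i → entry A i j) (λ _ → V.≈ᴹ-refl) x

  spanW⇔ : ∀ A sp x → RowSpan (LW.genCoords (Lattices.⟨_⟩ K W (colsW A) sp)) x
                      ⇔ RowSpan (λ j i → entry A i j) x
  spanW⇔ A sp x = mk⇔ (λ s → to G⇔ (from g⇔ s)) (λ s → to g⇔ (from G⇔ s))
    where
    L = Lattices.⟨_⟩ K W (colsW A) sp
    g⇔ = LW.∋⇔ L x
    G⇔ = LW.∋⇔RowSpan L (λ j i → entry A i j) (λ _ → W.≈ᴹ-refl) x

  private
    v-*1 : ∀ z → v (ϖ^ z * 1#) ≡ [ z ]
    v-*1 z = ≡.trans (v-cong (*-identityʳ _)) (v-^ z)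

    factor : ∀ s α → ϖ^ s * α ≈ α * (ϖ^ s * 1#)
    factor s α = trans (*-comm _ α) (*-congˡ (sym (*-identityʳ _)))

  rep~Q : ∀ s r d m n → pair (rep ⟪ s , r , d , m , n ⟫) ~[ + 0 ] Q[ s , r , d , m , n ]
  rep~Q s r d m n = ≐⇒~
    (λ x y z → Composition.equivalence (spanV⇔ (matV q) (matV-span q) _)
      (triangular₃ (λ j i → entry (matV q) i j) (ϖ^ (ℤ.- + m)) (ϖ^ (ℤ.- + n)) (ϖ^ s * 1#) (ϖ^ s * 1#) (ϖ^ s * 1#) vs vs vs
        (λ { zero → refl ; (suc zero) → zeroʳ _ ; (suc (suc zero)) → zeroʳ _ })
        (λ { zero → zeroʳ _ ; (suc zero) → refl ; (suc (suc zero)) → zeroʳ _ })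
        (λ { zero → factor s _ ; (suc zero) → factor s _ ; (suc (suc zero)) → refl }) x y z))
    (λ x y → Composition.equivalence (spanW⇔ (matW q) (matW-span q) _)
      (diagonal₂ (λ j i → entry (matW q) i j) (ϖ^ r * ϖ^ (+ d)) (ϖ^ r * 1#)
        (≡.trans (v-*⁼ (v-^ r) (v-^ (+ d))) (≡.cong [_] (ℤₚ.+-comm r (+ d))))
        (v-*1 r)
        (λ { zero → refl ; (suc zero) → zeroʳ _ })
        (λ { zero → zeroʳ _ ; (suc zero) → refl }) x y))
    where
    q = ⟪ s , r , d , m , n ⟫
    vs = v-*1 s

  -- The conjugating element is diag(t, 1) with v t = k, which accounts both for the k in the first
  -- rows of `matV₀` and `matW₀` and for the index.
  Q~rep₀ : ∀ k s r d m n → Q[ s , r , d , m , n ] ~[ k ] pair (rep₀ k ⟪ s , r , d , m , n ⟫)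
  Q~rep₀ k s r d m n = ~-cast (≡.trans (ℤₚ.+-identityʳ (k ℤ.+ + 0)) (ℤₚ.+-identityʳ k))
    (~-trans (std-scale vt v-1 (trans (*-assoc _ _ _) (trans (*-congˡ (trans (*-comm _ _) (proj₂ P⁻¹)))
                 (*-identityʳ _))) (*-identityˡ _))
      (~-sym std₀~))
    where
    q = ⟪ s , r , d , m , n ⟫
    P⁻¹ = inverse (ϖ^ (ℤ.- + m)) (ϖ^≉0 (ℤ.- + m))
    -- t is ϖ^k, in a form for which t ϖ^-m ≈ ϖ^(k-m) is immediate.
    t = ϖ^ (k ℤ.- + m) * proj₁ P⁻¹
    vt : v t ≡ [ k ]
    vt = ≡.trans (v-*⁼ (v-^ (k ℤ.- + m)) (v-inverse (v-^ (ℤ.- + m)) (proj₂ P⁻¹)))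
      (≡.cong [_] (ℤS.solve 2 (λ k m → k ℤS.:- m ℤS.:+ (ℤS.:- (ℤS.:- m)) ℤS.:= k) ≡.refl k (+ m)))
    -- The exponents are written in the form in which `std-scale` produces them for diag(t, 1).
    std₀~ : pair (rep₀ k q) ~[ + 0 ]
            std s (k ℤ.+ s) (+ 0 ℤ.+ s) (ϖ^ (k ℤ.- + m)) (ϖ^ (ℤ.- + n)) (k ℤ.+ (+ d ℤ.+ r)) (+ 0 ℤ.+ r)
    std₀~ = ≐⇒~
      (λ x y z → Composition.equivalence (spanV⇔ (matV₀ k q) (matV₀-span k q) _)
        (triangular₃ (λ j i → entry (matV₀ k q) i j) (ϖ^ (k ℤ.- + m)) (ϖ^ (ℤ.- + n))
          (ϖ^ s * ϖ^ k) (ϖ^ s * 1#) (ϖ^ s * 1#)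
          (≡.trans (v-*⁼ (v-^ s) (v-^ k)) (≡.cong [_] (ℤₚ.+-comm s k)))
          (≡.trans (v-*1 s) (≡.cong [_] (≡.sym (ℤₚ.+-identityˡ s)))) (v-*1 s)
          (λ { zero → refl ; (suc zero) → zeroʳ _ ; (suc (suc zero)) → zeroʳ _ })
          (λ { zero → zeroʳ _ ; (suc zero) → refl ; (suc (suc zero)) → zeroʳ _ })
          (λ { zero → factor s _ ; (suc zero) → factor s _ ; (suc (suc zero)) → refl }) x y z))
      (λ x y → Composition.equivalence (spanW⇔ (matW₀ k q) (matW₀-span k q) _)
        (diagonal₂ (λ j i → entry (matW₀ k q) i j) (ϖ^ (k ℤ.+ + d ℤ.+ r)) (ϖ^ r)
          (≡.trans (v-^ (k ℤ.+ + d ℤ.+ r)) (≡.cong [_] (ℤₚ.+-assoc k (+ d) r)))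
          (≡.trans (v-^ r) (≡.cong [_] (≡.sym (ℤₚ.+-identityˡ r))))
          (λ { zero → refl ; (suc zero) → refl })
          (λ { zero → refl ; (suc zero) → refl }) x y))

  ≈U⇒~ : ∀ X Y → X ≈[ U ] Y → pair X ~ pair Y
  ≈U⇒~ X Y (h , _ , imV , imW) =
    let z , vz = valuation (det h) (det≉0 h) in z , Conjugates⇒~ h X Y vz (imV , imW)

  ~⇒≈U : ∀ X Y → pair X ~ pair Y → X ≈[ U ] Y
  ~⇒≈U X Y (z , g) = let h , _ , ims = ~⇒Conjugates X Y g in h , _ , ims

  ≈H₀⇒~ : ∀ X Y → X ≈[ H₀ ] Y → pair X ~[ + 0 ] pair Y
  ≈H₀⇒~ X Y (h , vh , imV , imW) = Conjugates⇒~ h X Y vh (imV , imW)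

  ~⇒≈H₀ : ∀ X Y → pair X ~[ + 0 ] pair Y → X ≈[ H₀ ] Y
  ~⇒≈H₀ X Y g = ~⇒Conjugates X Y g

  ≈U-isEquivalence : IsEquivalence (λ X Y → X ≈[ U ] Y)
  ≈U-isEquivalence = record
    { refl  = λ {X} → ~⇒≈U X X (_ , ~-refl)
    ; sym   = λ {X} {Y} g → ~⇒≈U Y X (_ , ~-sym (proj₂ (≈U⇒~ X Y g)))
    ; trans = λ {X} {Y} {Z} g h → ~⇒≈U X Z (_ , ~-trans (proj₂ (≈U⇒~ X Y g)) (proj₂ (≈U⇒~ Y Z h)))
    }

  ≈H₀-isEquivalence : IsEquivalence (λ X Y → X ≈[ H₀ ] Y)
  ≈H₀-isEquivalence = record
    { refl  = λ {X} → ~⇒≈H₀ X X ~-refl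
    ; sym   = λ {X} {Y} g → ~⇒≈H₀ Y X (~-sym (≈H₀⇒~ X Y g))
    ; trans = λ {X} {Y} {Z} g h → ~⇒≈H₀ X Z (~-trans (≈H₀⇒~ X Y g) (≈H₀⇒~ Y Z h))
    }

  -- If n ≤ m, both quintuples reduce to the one with (m, 0), the standard one being (m, m). If m +
  -- d ≤ n, both reduce to (0, n), the standard one being (n - d, n). In the range m ≤ n ≤ m + d the
  -- quintuple is standard already.
  ∼-standard : ∀ s r d m n → ⟪ s , r , d , m , n ⟫ ∼ ⟪ s , r , d , m ℕ.⊔ (n ∸ d) , m ℕ.⊔ n ⟫
  ∼-standard s r d m n = cases (ℕₚ.≤-total n m) (ℕₚ.≤-total (m ℕ.+ d) n)
    where
    Goal : ℕ → ℕ → Set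
    Goal i j = ⟪ s , r , d , m , n ⟫ ∼ ⟪ s , r , d , i , j ⟫
    cases : n ℕ.≤ m ⊎ m ℕ.≤ n → m ℕ.+ d ℕ.≤ n ⊎ n ℕ.≤ m ℕ.+ d → Goal (m ℕ.⊔ (n ∸ d)) (m ℕ.⊔ n)
    cases (inj₁ n≤m) _ = ≡.subst₂ Goal
      (≡.sym (ℕₚ.m≥n⇒m⊔n≡m (ℕₚ.≤-trans (ℕₚ.m∸n≤m n d) n≤m))) (≡.sym (ℕₚ.m≥n⇒m⊔n≡m n≤m))
      (fwd (kill-n n≤m) ◅ bwd (kill-n ℕₚ.≤-refl) ◅ ε)
    cases (inj₂ m≤n) (inj₁ m+d≤n) = ≡.subst₂ Goal
      (≡.sym (ℕₚ.m≤n⇒m⊔n≡n (ℕₚ.m+n≤o⇒m≤o∸n m m+d≤n))) (≡.sym (ℕₚ.m≤n⇒m⊔n≡n m≤n))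
      (fwd (kill-m m+d≤n) ◅
       bwd (kill-m (ℕₚ.≤-reflexive (ℕₚ.m∸n+n≡m (ℕₚ.≤-trans (ℕₚ.m≤n+m d m) m+d≤n)))) ◅ ε)
    cases (inj₂ m≤n) (inj₂ n≤m+d) = ≡.subst₂ Goal
      (≡.sym (ℕₚ.m≥n⇒m⊔n≡m (ℕₚ.m≤n+o⇒m∸n≤o n d (≡.subst (n ℕ.≤_) (ℕₚ.+-comm m d) n≤m+d))))
      (≡.sym (ℕₚ.m≤n⇒m⊔n≡n m≤n)) ε

  SameInvariants⇒∼ : ∀ s r d m n s′ r′ d′ m′ n′ → SameInvariants s r d m n s′ r′ d′ m′ n′ →
    ⟪ s , r , d , m , n ⟫ ∼ ⟪ s′ , r′ , d′ , m′ , n′ ⟫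
  SameInvariants⇒∼ s r d m n s′ r′ d′ m′ n′ record { s≡ = ≡.refl ; r≡ = ≡.refl ; d≡ = ≡.refl ; I₁≡ = I₁≡ ; I₂≡ = I₂≡ } =
    EqClosure.transitive _∼₁_ (≡.subst₂ (λ i j → ⟪ s , r , d , m , n ⟫ ∼ ⟪ s , r , d , i , j ⟫) I₂≡ I₁≡
      (∼-standard s r d m n)) (EqClosure.symmetric _∼₁_ (∼-standard s r d m′ n′))

  rep-cong : ∀ {q q′} → q ∼ q′ → rep q ≈[ U ] rep q′
  rep-cong = EqClosure.gfold ≈U-isEquivalence rep step
    where
    step : ∀ {q q′} → q ∼₁ q′ → rep q ≈[ U ] rep q′
    step (kill-m {s} {r} {d} {m} {n} m+d≤n) = ~⇒≈U (rep ⟪ s , r , d , m , n ⟫) (rep ⟪ s , r , d , 0 , n ⟫) (_ , ~-trans (rep~Q s r d m n)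
      (~-trans (~-kill-m {s} {r} {d} {m} {n} m+d≤n) (~-sym (rep~Q s r d 0 n))))
    step (kill-n {s} {r} {d} {m} {n} n≤m) = ~⇒≈U (rep ⟪ s , r , d , m , n ⟫) (rep ⟪ s , r , d , m , 0 ⟫) (_ , ~-trans (rep~Q s r d m n)
      (~-trans (~-kill-n {s} {r} {d} {m} {n} n≤m) (~-sym (rep~Q s r d m 0))))

  rep-injective : ∀ {q q′} → rep q ≈[ U ] rep q′ → q ∼ q′
  rep-injective {⟪ s , r , d , m , n ⟫} {⟪ s′ , r′ , d′ , m′ , n′ ⟫} g =
    SameInvariants⇒∼ s r d m n s′ r′ d′ m′ n′ (~⇒SameInvariants s r d m n s′ r′ d′ m′ n′
      (~-trans (~-sym (rep~Q s r d m n))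
        (~-trans (proj₂ (≈U⇒~ (rep ⟪ s , r , d , m , n ⟫) (rep ⟪ s′ , r′ , d′ , m′ , n′ ⟫) g))
          (rep~Q s′ r′ d′ m′ n′))))

  rep-surjective : ∀ Y → ∃[ q ] rep q ≈[ U ] Y
  rep-surjective Y@(L , M) =
    let s , r , d , m , n , _ , g = rows~Q (LV.genCoords L) (LW.genCoords M)
                                      (LV.genCoords-full L) (LW.genCoords-full M)
    in ⟪ s , r , d , m , n ⟫ , ~⇒≈U (rep ⟪ s , r , d , m , n ⟫) Y
         (_ , ~-trans (rep~Q s r d m n) (~-sym g))

  rep~rep₀ : ∀ q k → pair (rep q) ~[ k ] pair (rep₀ k q)
  rep~rep₀ ⟪ s , r , d , m , n ⟫ k =
    ~-cast (ℤₚ.+-identityˡ k) (~-trans (rep~Q s r d m n) (Q~rep₀ k s r d m n))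

  -- Passing from the standard pair to itself through the two representatives is a self-conjugacy of
  -- index k - k′, which has to be 0.
  rep₀-injective : ∀ q {k k′} → rep₀ k q ≈[ H₀ ] rep₀ k′ q → k ≡ k′
  rep₀-injective ⟪ s , r , d , m , n ⟫ {k} {k′} g = ℤₚ.i-j≡0⇒i≡j k k′ (≡.trans
    (ℤS.solve 2 (λ k k′ → k ℤS.:- k′ ℤS.:= k ℤS.:+ (ℤS.con (+ 0) ℤS.:+ (ℤS.:- k′))) ≡.refl k k′)
    (self-conj⇒0 (~-trans (Q~rep₀ k s r d m n)
      (~-trans (≈H₀⇒~ (rep₀ k q) (rep₀ k′ q) g) (~-sym (Q~rep₀ k′ s r d m n))))))
    where q = ⟪ s , r , d , m , n ⟫

  -- With k the index of a conjugacy from `rep q` to Y, the path from `rep₀ k q` back to `rep q` and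
  -- on to Y has index -k + k = 0.
  rep₀-surjective : ∀ q (Y : Orbit (rep q)) → ∃[ k ] rep₀ k q ≈[ H₀ ] proj₁ Y
  rep₀-surjective q (Y , g) =
    let k , g′ = ≈U⇒~ (rep q) Y g in
    k , ~⇒≈H₀ (rep₀ k q) Y (~-cast (ℤₚ.+-inverseˡ k) (~-trans (~-sym (rep~rep₀ q k)) g′))

  rep-isBijection : IsBijection _∼_ (λ x y → x ≈[ U ] y) rep
  rep-isBijection = record
    { isInjection = record
      { isCongruent = record
        { cong           = rep-cong
        ; isEquivalence₁ = EqClosure.isEquivalence _∼₁_
        ; isEquivalence₂ = ≈U-isEquivalence
        }
      ; injective = rep-injective
      }
    ; surjective = λ Y → let q , g = rep-surjective Y in
        -- Surjectivity of a map of setoids concerns every q′ equivalent to q, hence the appeal to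
        -- `rep-cong`.
        q , λ {q′} q′∼q → IsEquivalence.trans ≈U-isEquivalence {rep q′} {rep q} {Y} (rep-cong q′∼q) g
    }

  inOrbit : ∀ q k → rep q ≈[ U ] rep₀ k q
  inOrbit q k = ~⇒≈U (rep q) (rep₀ k q) (k , rep~rep₀ q k)

  rep₀-isBijection : ∀ q → IsBijection _≡_ (_≈₀_ {rep q}) (λ k → rep₀ k q , inOrbit q k)
  rep₀-isBijection q = record
    { isInjection = record
      { isCongruent = record
        { cong           = λ { {k} ≡.refl → IsEquivalence.refl ≈H₀-isEquivalence {rep₀ k q} }
        ; isEquivalence₁ = ≡.isEquivalence
        ; isEquivalence₂ = record
          { refl  = λ {X} → IsEquivalence.refl ≈H₀-isEquivalence {proj₁ X}
          ; sym   = λ {X} {Y} → IsEquivalence.sym ≈H₀-isEquivalence {proj₁ X} {proj₁ Y}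
          ; trans = λ {X} {Y} {Z} → IsEquivalence.trans ≈H₀-isEquivalence {proj₁ X} {proj₁ Y} {proj₁ Z}
          }
        }
      ; injective = λ {k} {k′} → rep₀-injective q {k} {k′}
      }
    ; surjective = λ Y → let k , g = rep₀-surjective q Y in k , λ { ≡.refl → g }
    }

theorem1 : ∀ {c ℓ f ℓf u ℓu w ℓw l ℓl : Level}
    (K : CompletedField c ℓ f ℓf) (C : Configuration K u ℓu w ℓw l ℓl) →
    let open Orbits C in
    IsBijection _∼_ (λ x y → x ≈[ U ] y) rep
    × (∀ (q : Quintuple) →
    Σ[ inOrbit ∈ (∀ (k : ℤ) → rep q ≈[ U ] rep₀ k q) ]
    IsBijection _≡_ (_≈₀_ {rep q}) (λ k → (rep₀ k q , inOrbit k)))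
theorem1 K C = rep-isBijection , λ q → inOrbit q , rep₀-isBijection q
  where open Representatives C
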